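{- Let $p$ be a prime, $m\ge 1$ and $r$ integers with $r^p\equiv 1 \pmod m$, and let $G=\langle x, y\mid x^p=y^m=1,\ x^{ -1}yx=y^r\rangle$ (so $G\cong C_p\ltimes C_m$ and $|G|=pm$). Assume that $p$ is the smallest prime divisor of $|G|$ and that $\gcd(p(r-1), m)=1$. Then $\mathsf d(G)=m+p-2$ and $\mathsf E(G)=\mathsf d(G)+|G|$.
   Context: A sequence over a finite multiplicatively written group $G$ is a finite unordered list of elements of $G$ with repetition allowed (an element of the free abelian monoid on $G$); its length is the number of terms. For a sequence $S=g_1\cdot\ldots\cdot g_\ell$, $\pi(S)=\{g_{\tau(1)}\cdots g_{\tau(\ell)}:\tau \text{ a permutation of } [1,\ell]\}$ is its set of products. $S$ is product-one if $1\in\pi(S)$. A subsequence is obtained by taking some of the terms (with multiplicity). The small Davenport constant $\mathsf d(G)$ is the maximal integer $\ell$ such that there is a sequence of length $\ell$ over $G$ having no nonempty product-one subsequence. $\mathsf E(G)$ is the smallest integer $t$ such that every sequence of length $t$ over $G$ contains a product-one subsequence of length $|G|$. -}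

module Defs where

open import Algebra.Bundles using (Group)
open import Algebra.Bundles.Raw using (RawGroup)
import Algebra.Definitions.RawMonoid as RawMonoidDefs
open import Data.Fin.Base using (Fin)
open import Data.Integer.Base as ℤ using (ℤ; +_; -[1+_])
import Data.Integer.Divisibility as ℤ
open import Data.List.Base using (List; []; _++_; foldr; length)
import Data.List.Relation.Binary.Permutation.Setoid as Permutation
open import Data.Nat.Base using (ℕ; suc; _≤_)
open import Data.Nat.Divisibility using (_∣_)
open import Data.Nat.Primality using (Prime)
open import Data.Product.Base using (∃-syntax; _×_; _,_)
open import Function.Bundles using (Inverse)
open import Level using (Level; 0ℓ; _⊔_)
open import Relation.Binary.Core using (Rel)
open import Relation.Binary.PropositionalEquality using (_≡_; _≢_) renaming (setoid to ≡-setoid)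
open import Relation.Nullary using (¬_)

IsLeast : ∀ {ℓ} → (ℕ → Set ℓ) → ℕ → Set ℓ
IsLeast P n = P n × (∀ k → P k → n ≤ k)

IsGreatest : ∀ {ℓ} → (ℕ → Set ℓ) → ℕ → Set ℓ
IsGreatest P n = P n × (∀ k → P k → k ≤ n)

IsSmallestPrimeDivisor : ℕ → ℕ → Set
IsSmallestPrimeDivisor p n = IsLeast (λ q → Prime q × q ∣ n) p

infix 4 _≡_[mod_]

_≡_[mod_] : ℤ → ℤ → ℕ → Set
a ≡ b [mod m ] = + m ℤ.∣ a ℤ.- b

module _ {c ℓ : Level} (G : Group c ℓ) where

  open Group G
  open Permutation setoid using (_↭_)

  HasOrder : ℕ → Set (c ⊔ ℓ)
  HasOrder n = Inverse (≡-setoid (Fin n)) setoid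

  -- A sequence is represented by a list of its terms; two lists represent
  -- the same sequence exactly when they are related by the setoid
  -- permutation relation _↭_, which also allows terms to be replaced by
  -- _≈_-equal ones.
  Sequence : Set c
  Sequence = List Carrier

  -- Divisibility in the free abelian monoid on G.
  IsSubsequenceOf : Sequence → Sequence → Set (c ⊔ ℓ)
  IsSubsequenceOf T S = ∃[ U ] S ↭ T ++ U

  orderedProduct : Sequence → Carrier
  orderedProduct = foldr _∙_ ε

  infix 4 _∈π_

  _∈π_ : Carrier → Sequence → Set (c ⊔ ℓ)
  g ∈π S = ∃[ T ] (T ↭ S × g ≈ orderedProduct T)

  ProductOne : Sequence → Set (c ⊔ ℓ)
  ProductOne S = ε ∈π S

  ProductOneFree : Sequence → Set (c ⊔ ℓ)
  ProductOneFree S =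
    ¬ (∃[ T ] (T ≢ [] × IsSubsequenceOf T S × ProductOne T))

  IsSmallDavenportConstant : ℕ → Set (c ⊔ ℓ)
  IsSmallDavenportConstant =
    IsGreatest (λ k → ∃[ S ] (length S ≡ k × ProductOneFree S))

  -- "E(G) = t"; the number n is |G|.
  IsE : ℕ → Set (c ⊔ ℓ)
  IsE t = ∃[ n ] (HasOrder n × IsLeast (λ s →
    (S : Sequence) → length S ≡ s →
      ∃[ T ] (IsSubsequenceOf T S × length T ≡ n × ProductOne T)) t)

module _ {c ℓ : Level} (G : RawGroup c ℓ) where

  open RawGroup G
  open RawMonoidDefs rawMonoid using () renaming (_×_ to _times_)

  -- Integer powers; the library's `n times g` is additive notation for
  -- the n-fold product of g.
  power : Carrier → ℤ → Carrier
  power g (+ n)    = n times g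
  power g -[1+ n ] = (suc n times g) ⁻¹

infixl 7 _∙_
infix  8 _⁻¹

data Term (X : Set) : Set where
  gen : X → Term X
  ε   : Term X
  _∙_ : Term X → Term X → Term X
  _⁻¹ : Term X → Term X

termRawGroup : Set → RawGroup 0ℓ 0ℓ
termRawGroup X = record
  { Carrier = Term X ; _≈_ = _≡_ ; _∙_ = _∙_ ; ε = ε ; _⁻¹ = _⁻¹ }

infixr 9 _^_

_^_ : {X : Set} → Term X → ℤ → Term X
_^_ {X} = power (termRawGroup X)

-- The least congruence on terms that contains the defining relations R
-- and satisfies the group laws.
data Congruence {X : Set} (R : Rel (Term X) 0ℓ) : Rel (Term X) 0ℓ where
  relation  : ∀ {s t} → R s t → Congruence R s t
  ≈-refl    : ∀ {s} → Congruence R s s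
  ≈-sym     : ∀ {s t} → Congruence R s t → Congruence R t s
  ≈-trans   : ∀ {s t u} → Congruence R s t → Congruence R t u → Congruence R s u
  ∙-cong    : ∀ {s s′ t t′} → Congruence R s s′ → Congruence R t t′ →
              Congruence R (s ∙ t) (s′ ∙ t′)
  ⁻¹-cong   : ∀ {s t} → Congruence R s t → Congruence R (s ⁻¹) (t ⁻¹)
  assoc     : ∀ s t u → Congruence R ((s ∙ t) ∙ u) (s ∙ (t ∙ u))
  identityˡ : ∀ s → Congruence R (ε ∙ s) s
  identityʳ : ∀ s → Congruence R (s ∙ ε) s
  inverseˡ  : ∀ s → Congruence R (s ⁻¹ ∙ s) ε
  inverseʳ  : ∀ s → Congruence R (s ∙ s ⁻¹) ε

presentedGroup : (X : Set) → Rel (Term X) 0ℓ → Group 0ℓ 0ℓ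
presentedGroup X R = record
  { Carrier = Term X
  ; _≈_     = Congruence R
  ; _∙_     = _∙_
  ; ε       = ε
  ; _⁻¹     = _⁻¹
  ; isGroup = record
    { isMonoid = record
      { isSemigroup = record
        { isMagma = record
          { isEquivalence = record
            { refl = ≈-refl ; sym = ≈-sym ; trans = ≈-trans }
          ; ∙-cong = ∙-cong
          }
        ; assoc = assoc
        }
      ; identity = identityˡ , identityʳ
      }
    ; inverse = inverseˡ , inverseʳ
    ; ⁻¹-cong = ⁻¹-cong
    }
  }

data Generator : Set where
  𝕩 𝕪 : Generator

x y : Term Generator
x = gen 𝕩
y = gen 𝕪

data MetacyclicRelation (p m : ℕ) (r : ℤ) : Rel (Term Generator) 0ℓ where
  xᵖ≈1     : MetacyclicRelation p m r (x ^ (+ p)) ε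
  yᵐ≈1     : MetacyclicRelation p m r (y ^ (+ m)) ε
  x⁻¹yx≈yʳ : MetacyclicRelation p m r (x ⁻¹ ∙ y ∙ x) (y ^ r)

metacyclicGroup : ℕ → ℕ → ℤ → Group 0ℓ 0ℓ
metacyclicGroup p m r = presentedGroup Generator (MetacyclicRelation p m r)

{-# OPTIONS --safe #-}

-- G consists of the x^a y^b with (x^a y^b)(x^c y^d) = x^(a+c) y^(b r^c + d), and r^n − 1 is a unit modulo m
-- unless p ∣ n.  The key is that pm + m + p − 2 terms contain a product-one subsequence of length pm: padding
-- with pm − 1 identities then bounds d(G), and y^(m−1) x^(p−1) is extremal.
--
-- A term y^b inserted at different places of a product of terms outside ⟨y⟩ contributes b, b r^i, …  So exponents
-- are adjusted by sumsets in ℤ/m: adding {0} ∪ b ⟨r⟩ to an r-stable set which contains 0 either gains an orbit of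
-- p elements or shows that the set is a union of cosets of ⟨b⟩, in which case one passes to a quotient of ℤ/m.
-- If instead too many exponents are divisible by some d > 1, the theorem of Erdős, Ginzburg and Ziv in dℤ/m
-- already yields a product-one subsequence.
--
-- If p terms outside ⟨y⟩ lie in one coset, they serve as an anchor into which blocks of p terms with product in
-- ⟨y⟩ are inserted.  Otherwise there are at most (p−1)² terms outside ⟨y⟩.  All but p − 1 of them are split into
-- pieces with product in ⟨y⟩; the rotations of a piece of length l take l different values, so that by Chowla's
-- theorem the piece is worth as much as l single terms of ⟨y⟩.
module Submission where

open import Defs
open import Data.Nat.Base using (ℕ; _≤_; _+_; _*_; _∸_)
open import Data.Nat.Primality using (Prime)
open import Data.Integer.Base as ℤ using (ℤ; 1ℤ)
open import Data.Integer.GCD using (gcd)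
open import Data.Product.Base using (_×_)
open import Relation.Binary.PropositionalEquality using (_≡_)

open import Algebra.Bundles using (Group)
import Algebra.Properties.Group as GroupProperties
open import Data.Empty using (⊥; ⊥-elim)
open import Data.Fin.Base as Fin using (Fin)
import Data.Fin.Properties as Fin
open import Data.Integer.Base using (+_; -[1+_]; 0ℤ)
import Data.Integer.DivMod as ℤ
open import Data.Integer.Divisibility.Signed as ℤS using (divides)
import Data.Integer.Properties as ℤ
open import Data.Integer.Tactic.RingSolver using () renaming (solve-∀ to ℤ-solve)
open import Data.List.Base
  using (List; []; _∷_; _++_; length; map; concatMap; filter; upTo; applyUpTo; replicate; take; drop; catMaybes)
import Data.List.Membership.Propositional as Membership
import Data.List.Membership.Propositional.Properties as Membership
open import Data.List.Properties as List
  using (length-map; length-upTo; length-++; filter-notAll; length-applyUpTo; filter-++; filter-none;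
        length-filter; ++-identityʳ; ++-assoc; filter-all; concatMap-++; map-++; ∷-injective; filter-≐;
        length-replicate; catMaybes-++; length-catMaybes; length-take; take++drop≡id)
import Data.List.Relation.Binary.Permutation.Homogeneous as Homogeneous
open import Data.List.Relation.Binary.Permutation.Propositional
  using (_↭_; prep; swap; ↭-sym; ↭-trans; ↭-refl; ↭-reflexive)
import Data.List.Relation.Binary.Permutation.Propositional as Perm
open import Data.List.Relation.Binary.Permutation.Propositional.Properties as Perm
  using (++⁺ˡ; ++⁺ʳ; ++⁺; ++-comm; shift; shifts; ↭-length)
import Data.List.Relation.Binary.Permutation.Setoid.Properties as PermSetoid
open import Data.List.Relation.Binary.Pointwise.Base using (Pointwise; []; _∷_)
open import Data.List.Relation.Unary.All as All using (All; []; _∷_)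
import Data.List.Relation.Unary.All.Properties as All
open import Data.List.Relation.Unary.AllPairs as AllPairs using (AllPairs; []; _∷_)
import Data.List.Relation.Unary.AllPairs.Properties as AllPairs
open import Data.List.Relation.Unary.Any as Any using (Any; here; there)
import Data.List.Relation.Unary.Any.Properties as Any
open import Data.Maybe.Base using (Maybe; just; nothing; maybe)
open import Data.Nat.Base as ℕ using (zero; suc; _<_; z≤n; s≤s; NonZero)
open import Data.Nat.DivMod as ℕ using (_%_; _/_; m%n<n; m≡m%n+[m/n]*n)
open import Data.Nat.Divisibility as ℕ
  using (_∣_; _∣?_; ∣⇒≤; ∣-refl; ∣-trans; ∣m∣n⇒∣m+n; ∣n⇒∣m*n; n∣m*n; 0∣⇒≡0; quotient-<; quotient>1; ∣m+n∣m⇒∣n;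
        >⇒∤; m%n≡0⇒n∣m; ∣1⇒≡1; m∣m*n)
import Data.Nat.GCD as ℕ
open import Data.Nat.ListAction using (sum)
open import Data.Nat.Primality
  using (prime?; prime[2]; ¬prime[0]; euclidsLemma; prime⇒nonTrivial; prime⇒irreducible; ¬prime⇒composite)
open import Data.Nat.Properties as ℕ
  using (≤-trans; ≤-reflexive; +-mono-≤; +-comm; +-identityʳ; +-monoʳ-≤; *-identityˡ; ≤-pred; +-assoc; <⇒≤;
        m≤m+n; *-identityʳ; m+[n∸m]≡n; +-suc; suc-pred; m≤n⇒∃[o]m+o≡n; <-trans; m∸n≤m; <-cmp; ≤-refl; ≮⇒≥;
        *-comm; +-monoˡ-≤; <⇒≱; m≤n⇒m<n∨m≡n; *-zeroʳ; m≤n+o⇒m∸n≤o; ≰⇒>; +-cancelʳ-≤; <-irrefl; n<1⇒n≡0;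
        *-monoʳ-≤; ≤∧≢⇒<; ≤-<-trans; m≤n⇒m≤1+n; *-suc; m≤n+m; m∸n+n≡m; m<n⇒0<n∸m; +-cancelˡ-≤; *-distribʳ-+;
        n≤1+n; *-cancelˡ-≤; <⇒≢; n≢0⇒n>0; m+n≤o⇒m≤o; m≤n⇒m≤o+n; anyUpTo?; *-cancelʳ-≤; *-assoc; *-monoˡ-≤;
        +-cancelˡ-≡; m+n≤o⇒m≤o∸n; ≤-antisym; m+n≡0⇒m≡0; m+n≡0⇒n≡0; *-mono-≤; n≮0; m*n≢0; m≤n⇒m⊓n≡m)
open import Data.Nat.Tactic.RingSolver using () renaming (solve-∀ to ℕ-solve)
open import Data.Product.Base using (∃-syntax; _,_; proj₁; proj₂)
open import Data.Sum.Base as Sum using (_⊎_; inj₁; inj₂)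
open import Function.Base using (_∘_; id)
open import Level using (0ℓ)
open import Relation.Binary.Bundles using (Setoid)
open import Relation.Binary.Definitions using (tri<; tri≈; tri>)
open import Relation.Binary.PropositionalEquality
  using (_≢_; refl; sym; trans; cong; cong₂; subst; subst₂; module ≡-Reasoning)
import Relation.Binary.Reasoning.Setoid as SetoidReasoning
open import Relation.Nullary using (¬_; Dec; yes; no; contradiction)
open import Relation.Nullary.Decidable as Dec using (¬?)

-- Congruences and units

-- The obstacle is the prescribed length pm: a sumset argument leaves items out, so the length of a
-- product would vary with the exponent reached. Two devices repair this. With the first, every item
-- c is inserted in any case and only its position varies, so that it contributes c or c u; the
-- length is then constant, but an item gains only one new value, and about m - 1 nonzero items are
-- needed. With the second, items may be dropped and each dropped one is replaced by an item of
-- value 0; whole orbits or piece values can then be gained, but enough zeros must be present, so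
-- the number of optional items has to be bounded as well. The main case distinctions ask which
-- device has the material it needs. Beside an anchor the balance is exact: with m = 1 + p e there
-- are pe + e blocks, filling by orbits uses at most e of them, so e zeros suffice, and with fewer
-- than e zeros there are more than pe = m - 1 nonzero blocks. Without an anchor the delicate
-- quantity is the length of the optional pieces, which must stay below m together with the optional
-- single terms.

+-right-comm : ∀ s u v → s ℤ.+ u ℤ.+ v ≡ s ℤ.+ v ℤ.+ u
+-right-comm = ℤ-solve

-- Linear arithmetic: a combination of the hypotheses is compared with the goal by a semiring identity.
≤-by : ∀ {a b u v} → a ≤ b → ∀ s → u + b + s ≡ v + a → u ≤ v
≤-by {a} {b} {u} {v} a≤b s eq = +-cancelʳ-≤ b u v (≤-trans (m≤m+n (u + b) s)
  (≤-trans (≤-reflexive eq) (+-monoʳ-≤ v a≤b)))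

⊥-by : ∀ {a b} → a ≤ b → ∀ s → suc (b + s) ≡ a → ⊥
⊥-by {a} {b} a≤b s eq = <-irrefl refl (≤-trans (s≤s (m≤m+n b s)) (≤-trans (≤-reflexive eq) a≤b))

infix 4 _≈_⟨_⟩

small-modulus : ∀ d {k} → (1 < d → d ≤ suc k) → d ≤ suc k
small-modulus 0             _ = z≤n
small-modulus 1             _ = s≤s z≤n
small-modulus (suc (suc _)) h = h (s≤s (s≤s z≤n))

-- A record rather than a synonym for divisibility of the difference, so that unification can
-- recover `a`, `b` and `m`.
record _≈_⟨_⟩ (a b : ℤ) (m : ℕ) : Set where
  constructor congruent
  field m∣a-b : + m ℤS.∣ a ℤ.- b

open _≈_⟨_⟩

module _ {m : ℕ} where

  by-quotient : ∀ {a b} k → a ≡ b ℤ.+ k ℤ.* + m → a ≈ b ⟨ m ⟩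
  by-quotient {b = b} k refl = congruent (divides k (lemma b (k ℤ.* + m)))
    where
    lemma : ∀ b x → b ℤ.+ x ℤ.- b ≡ x
    lemma = ℤ-solve

  mod-refl : ∀ {a} → a ≈ a ⟨ m ⟩
  mod-refl {a} = congruent (divides 0ℤ (ℤ.+-inverseʳ a))

  mod-≡ : ∀ {a b} → a ≡ b → a ≈ b ⟨ m ⟩
  mod-≡ refl = mod-refl

  mod-sym : ∀ {a b} → a ≈ b ⟨ m ⟩ → b ≈ a ⟨ m ⟩
  mod-sym {a} {b} (congruent d) = congruent (subst (+ m ℤS.∣_) (lemma a b) (ℤS.∣m⇒∣-m d))
    where
    lemma : ∀ a b → ℤ.- (a ℤ.- b) ≡ b ℤ.- a
    lemma = ℤ-solve

  mod-trans : ∀ {a b c} → a ≈ b ⟨ m ⟩ → b ≈ c ⟨ m ⟩ → a ≈ c ⟨ m ⟩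
  mod-trans {a} {b} {c} (congruent d) (congruent e) =
    congruent (subst (+ m ℤS.∣_) (lemma a b c) (ℤS.∣m∣n⇒∣m+n d e))
    where
    lemma : ∀ a b c → (a ℤ.- b) ℤ.+ (b ℤ.- c) ≡ a ℤ.- c
    lemma = ℤ-solve

  mod-+ : ∀ {a b c d} → a ≈ b ⟨ m ⟩ → c ≈ d ⟨ m ⟩ → a ℤ.+ c ≈ b ℤ.+ d ⟨ m ⟩
  mod-+ {a} {b} {c} {d} (congruent e) (congruent f) =
    congruent (subst (+ m ℤS.∣_) (lemma a b c d) (ℤS.∣m∣n⇒∣m+n e f))
    where
    lemma : ∀ a b c d → (a ℤ.- b) ℤ.+ (c ℤ.- d) ≡ (a ℤ.+ c) ℤ.- (b ℤ.+ d)
    lemma = ℤ-solve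

  mod-+ˡ : ∀ c {a b} → a ≈ b ⟨ m ⟩ → c ℤ.+ a ≈ c ℤ.+ b ⟨ m ⟩
  mod-+ˡ c = mod-+ (mod-refl {c})

  mod-+ʳ : ∀ c {a b} → a ≈ b ⟨ m ⟩ → a ℤ.+ c ≈ b ℤ.+ c ⟨ m ⟩
  mod-+ʳ c e = mod-+ e (mod-refl {c})

  mod-*ˡ : ∀ c {a b} → a ≈ b ⟨ m ⟩ → c ℤ.* a ≈ c ℤ.* b ⟨ m ⟩
  mod-*ˡ c {a} {b} (congruent e) =
    congruent (subst (+ m ℤS.∣_) (lemma a b c) (ℤS.∣n⇒∣m*n c e))
    where
    lemma : ∀ a b c → c ℤ.* (a ℤ.- b) ≡ c ℤ.* a ℤ.- c ℤ.* b
    lemma = ℤ-solve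

  mod-*ʳ : ∀ c {a b} → a ≈ b ⟨ m ⟩ → a ℤ.* c ≈ b ℤ.* c ⟨ m ⟩
  mod-*ʳ c {a} {b} e rewrite ℤ.*-comm a c | ℤ.*-comm b c = mod-*ˡ c e

  mod-* : ∀ {a b c d} → a ≈ b ⟨ m ⟩ → c ≈ d ⟨ m ⟩ → a ℤ.* c ≈ b ℤ.* d ⟨ m ⟩
  mod-* {b = b} {c} e f = mod-trans (mod-*ʳ c e) (mod-*ˡ b f)

  mod-neg : ∀ {a b} → a ≈ b ⟨ m ⟩ → ℤ.- a ≈ ℤ.- b ⟨ m ⟩
  mod-neg {a} {b} (congruent d) = congruent (subst (+ m ℤS.∣_) (lemma a b) (ℤS.∣m⇒∣-m d))
    where
    lemma : ∀ a b → ℤ.- (a ℤ.- b) ≡ ℤ.- a ℤ.- ℤ.- b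
    lemma = ℤ-solve

  mod-^ : ∀ {a b} n → a ≈ b ⟨ m ⟩ → a ℤ.^ n ≈ b ℤ.^ n ⟨ m ⟩
  mod-^ zero    e = mod-refl
  mod-^ (suc n) e = mod-* e (mod-^ n e)

  mod-≟ : ∀ a b → Dec (a ≈ b ⟨ m ⟩)
  mod-≟ a b = Dec.map′ congruent m∣a-b (+ m ℤS.∣? (a ℤ.- b))

  modulus≈0 : + m ≈ 0ℤ ⟨ m ⟩
  modulus≈0 = by-quotient 1ℤ (sym (trans (ℤ.+-identityˡ _) (ℤ.*-identityˡ _)))

  mod-+-cancelʳ : ∀ {a b} c → a ℤ.+ c ≈ b ℤ.+ c ⟨ m ⟩ → a ≈ b ⟨ m ⟩
  mod-+-cancelʳ {a} {b} c e =
    subst₂ (_≈_⟨ m ⟩) (lemma a c) (lemma b c) (mod-+ e (mod-refl { ℤ.- c}))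
    where
    lemma : ∀ a c → a ℤ.+ c ℤ.+ ℤ.- c ≡ a
    lemma = ℤ-solve

  mod-difference : ∀ {a b} → a ℤ.- b ≈ 0ℤ ⟨ m ⟩ → a ≈ b ⟨ m ⟩
  mod-difference {a} {b} e =
    subst₂ (_≈_⟨ m ⟩) (lemma a b) (ℤ.+-identityˡ b) (mod-+ e (mod-refl {b}))
    where
    lemma : ∀ a b → a ℤ.- b ℤ.+ b ≡ a
    lemma = ℤ-solve

  difference-mod : ∀ {a b} → a ≈ b ⟨ m ⟩ → a ℤ.- b ≈ 0ℤ ⟨ m ⟩
  difference-mod {a} {b} e = subst (a ℤ.- b ≈_⟨ m ⟩) (ℤ.+-inverseʳ b) (mod-+ e mod-refl)

mod-weaken : ∀ {d m a b} → d ∣ m → a ≈ b ⟨ m ⟩ → a ≈ b ⟨ d ⟩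
mod-weaken d∣m (congruent e) = congruent (ℤS.∣-trans (ℤS.∣ᵤ⇒∣ d∣m) e)

mod-one : ∀ {a b} → a ≈ b ⟨ 1 ⟩
mod-one {a} {b} = by-quotient (a ℤ.- b) (lemma a b)
  where
  lemma : ∀ a b → a ≡ b ℤ.+ (a ℤ.- b) ℤ.* + 1
  lemma = ℤ-solve

≈0⇒∣ : ∀ {m} {a} → a ≈ 0ℤ ⟨ m ⟩ → m ∣ ℤ.∣ a ∣
≈0⇒∣ {m} {a} (congruent e) = ℤS.∣⇒∣ᵤ (subst (+ m ℤS.∣_) (ℤ.+-identityʳ a) e)

∣⇒≈0 : ∀ {m} {a} → m ∣ ℤ.∣ a ∣ → a ≈ 0ℤ ⟨ m ⟩
∣⇒≈0 {m} {a} e = congruent (subst (+ m ℤS.∣_) (sym (ℤ.+-identityʳ a)) (ℤS.∣ᵤ⇒∣ e))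

modSetoid : ℕ → Setoid 0ℓ 0ℓ
modSetoid m = record
  { Carrier = ℤ ; _≈_ = _≈_⟨ m ⟩
  ; isEquivalence = record { refl = mod-refl ; sym = mod-sym ; trans = mod-trans } }

mod-% : ∀ m .{{_ : NonZero m}} a → a ≈ + (a ℤ.%ℕ m) ⟨ m ⟩
mod-% m a = by-quotient (a ℤ./ℕ m) (ℤ.a≡a%ℕn+[a/ℕn]*n a m)

IsUnit : ℕ → ℤ → Set
IsUnit m u = ∃[ v ] v ℤ.* u ≈ 1ℤ ⟨ m ⟩

unit-weaken : ∀ {d m u} → d ∣ m → IsUnit m u → IsUnit d u
unit-weaken d∣m (v , e) = v , mod-weaken d∣m e

unit-cancel : ∀ {m u c} → IsUnit m u → c ℤ.* u ≈ 0ℤ ⟨ m ⟩ → c ≈ 0ℤ ⟨ m ⟩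
unit-cancel {m} {u} {c} (v , e) h = begin
  c ≡⟨ ℤ.*-identityʳ c ⟨
  c ℤ.* 1ℤ ≈⟨ mod-*ˡ c e ⟨
  c ℤ.* (v ℤ.* u) ≡⟨ lemma c u v ⟩
  v ℤ.* (c ℤ.* u) ≈⟨ mod-*ˡ v h ⟩
  v ℤ.* 0ℤ ≡⟨ ℤ.*-zeroʳ v ⟩
  0ℤ ∎
  where
  open SetoidReasoning (modSetoid m)
  lemma : ∀ c u v → c ℤ.* (v ℤ.* u) ≡ v ℤ.* (c ℤ.* u)
  lemma = ℤ-solve

unit-* : ∀ {m u v} → IsUnit m u → IsUnit m v → IsUnit m (u ℤ.* v)
unit-* {m} {u} {v} (u′ , e) (v′ , f) = u′ ℤ.* v′ , (begin
  u′ ℤ.* v′ ℤ.* (u ℤ.* v) ≡⟨ lemma u v u′ v′ ⟩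
  (u′ ℤ.* u) ℤ.* (v′ ℤ.* v) ≈⟨ mod-* e f ⟩
  1ℤ ∎)
  where
  open SetoidReasoning (modSetoid m)
  lemma : ∀ u v u′ v′ → u′ ℤ.* v′ ℤ.* (u ℤ.* v) ≡ (u′ ℤ.* u) ℤ.* (v′ ℤ.* v)
  lemma = ℤ-solve

unit-neg : ∀ {m u} → IsUnit m u → IsUnit m (ℤ.- u)
unit-neg {m} {u} (v , e) = ℤ.- v , subst (_≈ 1ℤ ⟨ m ⟩) (lemma u v) e
  where
  lemma : ∀ u v → v ℤ.* u ≡ ℤ.- v ℤ.* ℤ.- u
  lemma = ℤ-solve

sign-cases : ∀ a → a ≡ + ℤ.∣ a ∣ ⊎ a ≡ ℤ.- + ℤ.∣ a ∣
sign-cases (+ n)    = inj₁ refl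
sign-cases -[1+ n ] = inj₂ refl

bézout : ∀ a b → ∃[ k ] ∃[ l ] + ℕ.gcd a b ≡ k ℤ.* + a ℤ.+ l ℤ.* + b
bézout a b with ℕ.Bézout.identity (ℕ.gcd-GCD a b)
... | ℕ.Bézout.+- x y e = + x , ℤ.- + y , combine x y a b e
  where
  move : ∀ g u v → g ≡ (g ℤ.+ u ℤ.* v) ℤ.+ ℤ.- u ℤ.* v
  move = ℤ-solve
  combine : ∀ {g} x y a b → g + y ℕ.* b ≡ x ℕ.* a → + g ≡ + x ℤ.* + a ℤ.+ ℤ.- + y ℤ.* + b
  combine {g} x y a b e = trans (move (+ g) (+ y) (+ b)) (cong (λ t → t ℤ.+ ℤ.- + y ℤ.* + b)
    (trans (cong (λ t → + g ℤ.+ t) (sym (ℤ.pos-* y b))) (trans (cong +_ e) (ℤ.pos-* x a))))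
... | ℕ.Bézout.-+ x y e = ℤ.- + x , + y , combine x y a b e
  where
  move : ∀ g u v → g ≡ ℤ.- u ℤ.* v ℤ.+ (g ℤ.+ u ℤ.* v)
  move = ℤ-solve
  combine : ∀ {g} x y a b → g + x ℕ.* a ≡ y ℕ.* b → + g ≡ ℤ.- + x ℤ.* + a ℤ.+ + y ℤ.* + b
  combine {g} x y a b e = trans (move (+ g) (+ x) (+ a)) (cong (λ t → ℤ.- + x ℤ.* + a ℤ.+ t)
    (trans (cong (λ t → + g ℤ.+ t) (sym (ℤ.pos-* x a))) (trans (cong +_ e) (ℤ.pos-* y b))))

coprime⇒unit : ∀ {m a} → ℕ.gcd ℤ.∣ a ∣ m ≡ 1 → IsUnit m a
coprime⇒unit {m} {a} eq = from-sign (sign-cases a) abs-unit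
  where
  abs-unit : IsUnit m (+ ℤ.∣ a ∣)
  abs-unit with bézout ℤ.∣ a ∣ m
  ... | k , l , e = k , mod-sym (by-quotient l (trans (cong +_ (sym eq)) e))
  from-sign : ∀ {b} → a ≡ b ⊎ a ≡ ℤ.- b → IsUnit m b → IsUnit m a
  from-sign (inj₁ refl) u = u
  from-sign (inj₂ refl) u = unit-neg u

-- Lists of pairwise incongruent integers

Distinct : ℕ → List ℤ → Set
Distinct m = AllPairs (λ a b → ¬ a ≈ b ⟨ m ⟩)

infix 4 _∈_⟨_⟩

_∈_⟨_⟩ : ℤ → List ℤ → ℕ → Set
t ∈ L ⟨ m ⟩ = Any (t ≈_⟨ m ⟩) L

module _ {m : ℕ} where

  mod-∈? : ∀ t L → Dec (t ∈ L ⟨ m ⟩)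
  mod-∈? t = Any.any? (mod-≟ t)

  ∈-resp-≈ : ∀ {s t L} → s ≈ t ⟨ m ⟩ → s ∈ L ⟨ m ⟩ → t ∈ L ⟨ m ⟩
  ∈-resp-≈ s≈t = Any.map (mod-trans (mod-sym s≈t))

  ∉⇒All≉ : ∀ {t} L → ¬ t ∈ L ⟨ m ⟩ → All (λ a → ¬ t ≈ a ⟨ m ⟩) L
  ∉⇒All≉ L = All.¬Any⇒All¬ L

  remove : ∀ {t L} → t ∈ L ⟨ m ⟩ →
    ∃[ L′ ] (length L ≡ suc (length L′) × (∀ {s} → ¬ t ≈ s ⟨ m ⟩ → s ∈ L ⟨ m ⟩ → s ∈ L′ ⟨ m ⟩))
  remove {t} {a ∷ L} (here t≈a) = L , refl ,
    λ { t≉s (here s≈a) → contradiction (mod-trans t≈a (mod-sym s≈a)) t≉s ; _ (there s∈L) → s∈L }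
  remove {t} {a ∷ L} (there t∈L) with remove t∈L
  ... | L′ , eq , f = a ∷ L′ , cong suc eq ,
    λ { _ (here s≈a) → here s≈a ; t≉s (there s∈L) → there (f t≉s s∈L) }

  pigeonhole : ∀ {N L} → Distinct m N → (∀ {t} → t ∈ N ⟨ m ⟩ → t ∈ L ⟨ m ⟩) → length N ≤ length L
  pigeonhole {[]} _ _ = z≤n
  pigeonhole {t ∷ N} (t∉N ∷ N!) N⊆L with remove (N⊆L (here mod-refl))
  ... | L′ , eq , f rewrite eq = s≤s (pigeonhole N! λ s∈N → f (λ t≈s → All.All¬⇒¬Any t∉N (∈-resp-≈ (mod-sym t≈s) s∈N)) (N⊆L (there s∈N)))

  insertAll : ∀ M L → Distinct m L → ∃[ L′ ] (Distinct m L′ ×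
    (∀ {t} → t ∈ L′ ⟨ m ⟩ → t ∈ M ⟨ m ⟩ ⊎ t ∈ L ⟨ m ⟩) ×
    (∀ {t} → t ∈ M ⟨ m ⟩ → t ∈ L′ ⟨ m ⟩) × (∀ {t} → t ∈ L ⟨ m ⟩ → t ∈ L′ ⟨ m ⟩))
  insertAll [] L L! = L , L! , inj₂ , (λ ()) , id
  insertAll (a ∷ M) L L! with insertAll M L L!
  ... | L′ , L′! , f , g , h with mod-∈? a L′
  ...   | yes a∈L′ = L′ , L′! , (λ t∈ → Sum.map₁ there (f t∈)) ,
          (λ { (here t≈a) → ∈-resp-≈ (mod-sym t≈a) a∈L′ ; (there t∈M) → g t∈M }) , h
  ...   | no a∉L′ = a ∷ L′ , ∉⇒All≉ L′ a∉L′ ∷ L′! ,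
          (λ { (here t≈a) → inj₁ (here t≈a) ; (there t∈) → Sum.map₁ there (f t∈) }) ,
          (λ { (here t≈a) → here t≈a ; (there t∈M) → there (g t∈M) }) , there ∘ h

  module _ .{{_ : NonZero m}} where

    residues : List ℤ
    residues = map +_ (upTo m)

    ∈-residues : ∀ t → t ∈ residues ⟨ m ⟩
    ∈-residues t = Any.map⁺ (Any.map (λ { refl → mod-% m t })
      (Membership.∈-upTo⁺ (ℤ.n%ℕd<d t m)))

    length-residues : length residues ≡ m
    length-residues = trans (length-map +_ (upTo m)) (length-upTo m)

    distinct-length≤ : ∀ {L} → Distinct m L → length L ≤ m
    distinct-length≤ {L} L! = subst (length L ≤_) length-residues (pigeonhole L! (λ {t} _ → ∈-residues t))

    distinct-full : ∀ {L} → Distinct m L → m ≤ length L → ∀ t → t ∈ L ⟨ m ⟩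
    distinct-full {L} L! m≤ t with mod-∈? t L
    ... | yes t∈L = t∈L
    ... | no t∉L = contradiction (≤-trans (s≤s m≤) (distinct-length≤ (∉⇒All≉ L t∉L ∷ L!))) (<-irrefl refl)

-- Chowla's theorem

module _ {a ℓ} {A : Set a} {P : A → Set ℓ} (P? : ∀ t → Dec (P t)) where

  filter-↭-split : ∀ xs → xs ↭ filter P? xs ++ filter (¬? ∘ P?) xs
  filter-↭-split [] = ↭-refl
  filter-↭-split (t ∷ xs) with P? t
  ... | yes _ = prep t (filter-↭-split xs)
  ... | no  _ = ↭-trans (prep t (filter-↭-split xs))
                  (↭-sym (shift t (filter P? xs) (filter (¬? ∘ P?) xs)))

  filter-length-split : ∀ xs → length xs ≡ length (filter P? xs) + length (filter (¬? ∘ P?) xs)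
  filter-length-split xs = trans (↭-length (filter-↭-split xs)) (length-++ (filter P? xs))

module _ {m : ℕ} .{{_ : NonZero m}} {ℓ} {X : ℤ → Set ℓ} (X-resp : ∀ {s t} → s ≈ t ⟨ m ⟩ → X s → X t) where

  -- Iteration only gives natural multiples; a negative `k` is replaced by its residue modulo m.
  closed-multiples : ∀ {a} → (∀ {t} → X t → X (t ℤ.+ a)) → ∀ k {t} → X t → X (t ℤ.+ k ℤ.* a)
  closed-multiples {a} closed k {t} Xt =
    X-resp (mod-+ˡ t (mod-*ʳ a (mod-sym (mod-% m k)))) (naturals (k ℤ.%ℕ m))
    where
    next : ∀ n t a → t ℤ.+ n ℤ.* a ℤ.+ a ≡ t ℤ.+ (1ℤ ℤ.+ n) ℤ.* a
    next = ℤ-solve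
    naturals : ∀ n → X (t ℤ.+ + n ℤ.* a)
    naturals zero = subst X (sym (trans (cong (λ z → t ℤ.+ z) (ℤ.*-zeroˡ a)) (ℤ.+-identityʳ t))) Xt
    naturals (suc n) = subst X (next (+ n) t a) (closed (naturals n))

module _ {m : ℕ} .{{_ : NonZero m}} where

  SumSet : List ℤ → List ℤ → ℤ → Set
  SumSet L B t = ∃[ s ] ∃[ b ] (s ∈ L ⟨ m ⟩ × b ∈ B ⟨ m ⟩ × t ≈ s ℤ.+ b ⟨ m ⟩)

  -- That is, c lies in the subgroup generated by b.
  Generates : ℤ → ℤ → Set
  Generates c b = ∃[ k ] c ≈ k ℤ.* b ⟨ m ⟩

  Grows : List ℤ → List ℤ → Set
  Grows L B = ∃[ N ] (Distinct m N × length N ≡ length L + length B × (∀ {t} → t ∈ N ⟨ m ⟩ → SumSet L (0ℤ ∷ B) t))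

  -- Only elements of `L` are asked to have their coset in the sumset. This weak form is inherited
  -- backwards along the transform, since `L` only grows there.
  Cosets : ℤ → List ℤ → List ℤ → Set
  Cosets c L B = ∀ k {t} → t ∈ L ⟨ m ⟩ → SumSet L (0ℤ ∷ B) (t ℤ.+ k ℤ.* c)

  -- Davenport's transform: replace L, {0} ∪ B by L ∪ (e + B₂), {0} ∪ B₁, where B₁ = {b ∈ B : e + b ∈ L}.
  chowla : ∀ {c} B → Distinct m (0ℤ ∷ B) → All (Generates c) B → ∀ L → Distinct m L →
    Grows L B ⊎ Cosets c L B
  chowla {c} B B! gens L L! = go (length B) B ≤-refl B! gens L L!
    where
    in-left : ∀ {L B t} → t ∈ L ⟨ m ⟩ → SumSet L (0ℤ ∷ B) t
    in-left {t = t} t∈L = t , 0ℤ , t∈L , here mod-refl , mod-≡ (sym (ℤ.+-identityʳ t))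
    go : ∀ n B → length B ≤ n → Distinct m (0ℤ ∷ B) → All (Generates c) B → ∀ L → Distinct m L →
      Grows L B ⊎ Cosets c L B
    go n [] _ _ _ L L! = inj₁ (L , L! , sym (+-identityʳ _) , in-left)
    go (suc n) B@(b₀ ∷ _) (s≤s B≤n) (0∉B ∷ B!) gens@((k₀ , c≈) ∷ _) L L!
      with All.all? (λ e → All.all? (λ b → mod-∈? (e ℤ.+ b) L) B) L
    -- `L` absorbs b₀, hence all its multiples, and c is one of them.
    ... | yes closed = inj₂ λ k t∈L → in-left (stable k t∈L)
      where
      closed₀ : ∀ {t} → t ∈ L ⟨ m ⟩ → (t ℤ.+ b₀) ∈ L ⟨ m ⟩
      closed₀ t∈L with Membership.find t∈L
      ... | e , e∈L , t≈e = ∈-resp-≈ (mod-+ʳ b₀ (mod-sym t≈e)) (All.head (All.lookup closed e∈L))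
      stable : ∀ k {t} → t ∈ L ⟨ m ⟩ → (t ℤ.+ k ℤ.* c) ∈ L ⟨ m ⟩
      stable k {t} t∈L = ∈-resp-≈
        (mod-+ˡ t (mod-trans (mod-≡ (ℤ.*-assoc k k₀ b₀)) (mod-*ˡ k (mod-sym c≈))))
        (closed-multiples ∈-resp-≈ closed₀ (k ℤ.* k₀) t∈L)
    ... | no ¬closed with Membership.find (All.¬All⇒Any¬ (λ e → All.all? (λ b → mod-∈? (e ℤ.+ b) L) B) L ¬closed)
    -- Some e + b lies outside `L`, so B₁ is strictly shorter than `B` and the recursion descends.
    ...   | e , e∈L , ¬e+B⊆L = Sum.map grow stick
              (go n B₁ (≤-pred (≤-trans B₁<B (s≤s B≤n))) (All.filter⁺ in? 0∉B ∷ AllPairs.filter⁺ in? B!)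
                (All.filter⁺ in? gens) L₂ L₂!)
      where
      in? : ∀ b → Dec ((e ℤ.+ b) ∈ L ⟨ m ⟩)
      in? b = mod-∈? (e ℤ.+ b) L
      B₁ B₂ L₂ : List ℤ
      B₁ = filter in? B
      B₂ = filter (¬? ∘ in?) B
      L₂ = map (λ b → e ℤ.+ b) B₂ ++ L
      B₁<B : length B₁ < length B
      B₁<B = filter-notAll in? B (All.¬All⇒Any¬ in? B ¬e+B⊆L)
      L₂! : Distinct m L₂
      L₂! = AllPairs.++⁺
        (AllPairs.map⁺ (AllPairs.map (λ ≉ ≈ → ≉ (cancel ≈)) (AllPairs.filter⁺ (¬? ∘ in?) B!))) L!
        (All.map⁺ (All.map (∉⇒All≉ L) (All.all-filter (¬? ∘ in?) B)))
        where
        cancel : ∀ {b b′} → e ℤ.+ b ≈ e ℤ.+ b′ ⟨ m ⟩ → b ≈ b′ ⟨ m ⟩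
        cancel {b} {b′} h = mod-+-cancelʳ e (subst₂ (_≈_⟨ m ⟩) (ℤ.+-comm e b) (ℤ.+-comm e b′) h)
      filter-⊆ : ∀ {P : ℤ → Set} (P? : ∀ t → Dec (P t)) {t} B → t ∈ filter P? B ⟨ m ⟩ → t ∈ B ⟨ m ⟩
      filter-⊆ P? B t∈ = Any.filter⁻ P? t∈
      L₂-sums : ∀ {s} → s ∈ L₂ ⟨ m ⟩ → s ∈ L ⟨ m ⟩ ⊎ ∃[ b ] (b ∈ B ⟨ m ⟩ × s ≈ e ℤ.+ b ⟨ m ⟩)
      L₂-sums s∈ with Any.++⁻ (map (λ b → e ℤ.+ b) B₂) s∈
      ... | inj₂ s∈L = inj₁ s∈L
      ... | inj₁ s∈ with Membership.find (Any.map⁻ s∈)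
      ...   | b , b∈ , s≈ = inj₂ (b , filter-⊆ (¬? ∘ in?) B (Any.map mod-≡ b∈) , s≈)
      sums⊆ : ∀ {t} → SumSet L₂ (0ℤ ∷ B₁) t → SumSet L (0ℤ ∷ B) t
      sums⊆ (s , b , s∈ , b∈ , t≈) with L₂-sums s∈
      sums⊆ (s , b , s∈ , here b≈0 , t≈) | inj₁ s∈L = s , b , s∈L , here b≈0 , t≈
      sums⊆ (s , b , s∈ , there b∈ , t≈) | inj₁ s∈L = s , b , s∈L , there (filter-⊆ in? B b∈) , t≈
      sums⊆ (s , b , s∈ , here b≈0 , t≈) | inj₂ (b′ , b′∈ , s≈) = e , b′ , Any.map mod-≡ e∈L , there b′∈ ,
        mod-trans t≈ (mod-trans (mod-+ s≈ b≈0) (mod-≡ (ℤ.+-identityʳ _)))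
      sums⊆ (s , b , s∈ , there b∈ , t≈) | inj₂ (b′ , b′∈ , s≈) = e ℤ.+ b , b′ , e+b∈L , there b′∈ ,
        mod-trans t≈ (mod-trans (mod-+ʳ b s≈) (mod-≡ (+-right-comm e b′ b)))
        where
        e+b∈L : (e ℤ.+ b) ∈ L ⟨ m ⟩
        e+b∈L with Membership.find b∈
        ... | b″ , b″∈ , b≈ = ∈-resp-≈ (mod-+ˡ e (mod-sym b≈)) (All.lookup (All.all-filter in? B) b″∈)
      lengths : length L₂ + length B₁ ≡ length L + length B
      lengths = begin
        length L₂ + length B₁ ≡⟨ cong (_+ length B₁) (trans (length-++ (map _ B₂)) (cong (_+ length L) (length-map _ B₂))) ⟩
        length B₂ + length L + length B₁ ≡⟨ rearrange (length B₂) (length L) (length B₁) ⟩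
        length L + (length B₁ + length B₂) ≡⟨ cong (λ n → length L + n) (filter-length-split in? B) ⟨
        length L + length B ∎
        where
        open ≡-Reasoning
        rearrange : ∀ a b c → a + b + c ≡ b + (c + a)
        rearrange = ℕ-solve
      grow : Grows L₂ B₁ → Grows L B
      grow (N , N! , len , f) = N , N! , trans len lengths , sums⊆ ∘ f
      stick : Cosets c L₂ B₁ → Cosets c L B
      stick f k t∈L = sums⊆ (f k (Any.++⁺ʳ (map (λ b → e ℤ.+ b) B₂) t∈L))

-- Filling ℤ/m with orbits

-- That r^i - 1 is a unit, not merely nonzero, makes multiplication by r act freely on the nonzero
-- residues, and this persists modulo every divisor of m.
record RootOfUnity (m : ℕ) (r : ℤ) (w : ℕ) : Set where
  field
    order>0 : 0 < w
    root    : r ℤ.^ w ≈ 1ℤ ⟨ m ⟩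
    units   : ∀ {i} → 0 < i → i < w → IsUnit m (r ℤ.^ i ℤ.- 1ℤ)

  power-unit : ∀ {i} → i ≤ w → IsUnit m (r ℤ.^ i)
  power-unit {i} i≤w = r ℤ.^ (w ∸ i) , mod-trans
    (mod-≡ (trans (sym (ℤ.^-distribˡ-+-* r (w ∸ i) i)) (cong (r ℤ.^_) (m∸n+n≡m i≤w)))) root

  orbit : ℤ → List ℤ
  orbit c = applyUpTo (λ j → c ℤ.* r ℤ.^ j) w

  -- If two members agree, c r^i (r^(j-i) - 1) ≡ 0, and cancelling the two unit factors leaves c ≡
  -- 0.
  orbit-distinct : ∀ {c} → ¬ c ≈ 0ℤ ⟨ m ⟩ → Distinct m (orbit c)
  orbit-distinct {c} c≉0 = AllPairs.applyUpTo⁺₁ (λ j → c ℤ.* r ℤ.^ j) w λ {i} {j} i<j j<w eq →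
    c≉0 (unit-cancel (power-unit (<⇒≤ (<-trans i<j j<w)))
      (unit-cancel (units (m<n⇒0<n∸m i<j) (≤-<-trans (m∸n≤m j i) j<w))
        (mod-trans (mod-≡ (factor i<j)) (difference-mod (mod-sym eq)))))
    where
    expand : ∀ c u v → c ℤ.* u ℤ.* (v ℤ.- 1ℤ) ≡ c ℤ.* (u ℤ.* v) ℤ.- c ℤ.* u
    expand = ℤ-solve
    factor : ∀ {i j} → i < j → c ℤ.* r ℤ.^ i ℤ.* (r ℤ.^ (j ∸ i) ℤ.- 1ℤ) ≡ c ℤ.* r ℤ.^ j ℤ.- c ℤ.* r ℤ.^ i
    factor {i} {j} i<j = trans (expand c (r ℤ.^ i) (r ℤ.^ (j ∸ i)))
      (cong (λ z → c ℤ.* z ℤ.- c ℤ.* r ℤ.^ i)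
        (trans (sym (ℤ.^-distribˡ-+-* r i (j ∸ i))) (cong (r ℤ.^_) (m+[n∸m]≡n (<⇒≤ i<j)))))

  module _ {ℓ} {X : ℤ → Set ℓ} (X-resp : ∀ {s t} → s ≈ t ⟨ m ⟩ → X s → X t) (stable : ∀ {t} → X t → X (t ℤ.* r)) where

    stable-^ : ∀ j {t} → X t → X (t ℤ.* r ℤ.^ j)
    stable-^ zero    {t} Xt = subst X (sym (ℤ.*-identityʳ t)) Xt
    stable-^ (suc j) {t} Xt = subst X (ℤ.*-assoc t r (r ℤ.^ j)) (stable-^ j (stable Xt))

    -- Multiplying by r a further w - j times leads back to c. Hence an orbit that starts outside a
    -- stable set never meets it.
    orbit-avoids : ∀ {c j} → j < w → X (c ℤ.* r ℤ.^ j) → X c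
    orbit-avoids {c} {j} j<w h = X-resp (begin
      c ℤ.* r ℤ.^ j ℤ.* r ℤ.^ (w ∸ j) ≡⟨ ℤ.*-assoc c _ _ ⟩
      c ℤ.* (r ℤ.^ j ℤ.* r ℤ.^ (w ∸ j)) ≡⟨ cong (λ z → c ℤ.* z) (sym (ℤ.^-distribˡ-+-* r j (w ∸ j))) ⟩
      c ℤ.* r ℤ.^ (j + (w ∸ j)) ≡⟨ cong (λ k → c ℤ.* r ℤ.^ k) (m+[n∸m]≡n (<⇒≤ j<w)) ⟩
      c ℤ.* r ℤ.^ w ≈⟨ mod-*ˡ c root ⟩
      c ℤ.* 1ℤ ≡⟨ ℤ.*-identityʳ c ⟩
      c ∎) (stable-^ (w ∸ j) h)
      where open SetoidReasoning (modSetoid m)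

  orbit-extends : ∀ {L c} → Distinct m L → 0ℤ ∈ L ⟨ m ⟩ → (∀ {t} → t ∈ L ⟨ m ⟩ → (t ℤ.* r) ∈ L ⟨ m ⟩) →
    ¬ c ∈ L ⟨ m ⟩ → Distinct m (orbit c ++ L) × length (orbit c ++ L) ≡ w + length L
  orbit-extends {L} {c} L! 0∈L stable c∉L =
    AllPairs.++⁺ (orbit-distinct (λ c≈0 → c∉L (∈-resp-≈ (mod-sym c≈0) 0∈L))) L!
      (All.applyUpTo⁺₁ (λ j → c ℤ.* r ℤ.^ j) w (λ j<w → ∉⇒All≉ L (λ h → c∉L (orbit-avoids ∈-resp-≈ stable j<w h)))) ,
    trans (length-++ (orbit c)) (cong (_+ length L) (length-applyUpTo (λ j → c ℤ.* r ℤ.^ j) w))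

root-weaken : ∀ {d m r w} → d ∣ m → RootOfUnity m r w → RootOfUnity d r w
root-weaken d∣m ρ = record
  { order>0 = order>0
  ; root    = mod-weaken d∣m root
  ; units   = λ 0<i i<w → unit-weaken d∣m (units 0<i i<w) }
  where open RootOfUnity ρ

module _ {A : Set} (f : A → ℤ) where

  nonzero? : ∀ d a → Dec (¬ f a ≈ 0ℤ ⟨ d ⟩)
  nonzero? d a = ¬? (mod-≟ (f a) 0ℤ)

  nonzeros : ℕ → List A → ℕ
  nonzeros d as = length (filter (nonzero? d) as)

  nonzeros-↭ : ∀ d {as bs} → as ↭ bs → nonzeros d as ≡ nonzeros d bs
  nonzeros-↭ d as↭bs = ↭-length (Perm.filter-↭ (nonzero? d) as↭bs)

  nonzeros-++ : ∀ d as bs → nonzeros d (as ++ bs) ≡ nonzeros d as + nonzeros d bs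
  nonzeros-++ d as bs = trans (cong length (filter-++ (nonzero? d) as bs)) (length-++ (filter (nonzero? d) as))

  nonzeros-none : ∀ {d as} → All (λ a → f a ≈ 0ℤ ⟨ d ⟩) as → nonzeros d as ≡ 0
  nonzeros-none {d} zs = cong length (filter-none (nonzero? d) (All.map (λ z nz → nz z) zs))

  nonzeros≤length : ∀ d as → nonzeros d as ≤ length as
  nonzeros≤length d as = length-filter (nonzero? d) as

module Filling {A : Set} (f : A → ℤ) (r : ℤ) (w : ℕ) where

  -- A derivation records which items are used and with which multiplier, so that a value found by
  -- counting can later be turned into an actual product.
  data Reach (m : ℕ) (X : List ℤ) : List A → ℤ → Set where
    base : ∀ {t} → t ∈ X ⟨ m ⟩ → Reach m X [] t
    skip : ∀ {a G t} → Reach m X G t → Reach m X (a ∷ G) t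
    use  : ∀ {a G s t} j → j < w → Reach m X G s → t ≈ s ℤ.+ f a ℤ.* r ℤ.^ j ⟨ m ⟩ → Reach m X (a ∷ G) t

  module _ {m : ℕ} {X : List ℤ} where

    reach-resp : ∀ {G s t} → s ≈ t ⟨ m ⟩ → Reach m X G s → Reach m X G t
    reach-resp s≈t (base s∈X)       = base (∈-resp-≈ s≈t s∈X)
    reach-resp s≈t (skip ρ)         = skip (reach-resp s≈t ρ)
    reach-resp s≈t (use j j<w ρ eq) = use j j<w ρ (mod-trans (mod-sym s≈t) eq)

    step-*r : ∀ s c u → (s ℤ.+ c ℤ.* u) ℤ.* r ≡ s ℤ.* r ℤ.+ c ℤ.* (r ℤ.* u)
    step-*r s c u = lemma s c u r
      where
      lemma : ∀ s c u r → (s ℤ.+ c ℤ.* u) ℤ.* r ≡ s ℤ.* r ℤ.+ c ℤ.* (r ℤ.* u)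
      lemma = ℤ-solve

    -- Each multiplier r^j moves on to r^(j+1), and the last one wraps around because r^w ≡ 1.
    reach-stable : RootOfUnity m r w → (∀ {t} → t ∈ X ⟨ m ⟩ → (t ℤ.* r) ∈ X ⟨ m ⟩) →
      ∀ {G t} → Reach m X G t → Reach m X G (t ℤ.* r)
    reach-stable μ X-stable (base t∈X) = base (X-stable t∈X)
    reach-stable μ X-stable (skip ρ) = skip (reach-stable μ X-stable ρ)
    reach-stable μ X-stable (use {a} {s = s} {t} j j<w ρ eq) with m≤n⇒m<n∨m≡n j<w
    ... | inj₁ j+1<w = use (suc j) j+1<w (reach-stable μ X-stable ρ)
            (mod-trans (mod-*ʳ r eq) (mod-≡ (step-*r s (f a) (r ℤ.^ j))))
    ... | inj₂ refl = use 0 (RootOfUnity.order>0 μ) (reach-stable μ X-stable ρ)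
            (mod-trans (mod-*ʳ r eq) (mod-trans (mod-≡ (step-*r s (f a) (r ℤ.^ j)))
              (mod-+ˡ (s ℤ.* r) (mod-*ˡ (f a) (RootOfUnity.root μ)))))

    reach-skip-++ : ∀ {G t} R → Reach m X G t → Reach m X (R ++ G) t
    reach-skip-++ []      ρ = ρ
    reach-skip-++ (_ ∷ R) ρ = skip (reach-skip-++ R ρ)

    reach-↭ : ∀ {G H t} → G ↭ H → Reach m X G t → Reach m X H t
    reach-↭ Perm.refl ρ = ρ
    reach-↭ (Perm.prep a σ) (skip ρ) = skip (reach-↭ σ ρ)
    reach-↭ (Perm.prep a σ) (use j j<w ρ eq) = use j j<w (reach-↭ σ ρ) eq
    reach-↭ (Perm.swap a b σ) (skip (skip ρ)) = skip (skip (reach-↭ σ ρ))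
    reach-↭ (Perm.swap a b σ) (skip (use j j<w ρ eq)) = use j j<w (skip (reach-↭ σ ρ)) eq
    reach-↭ (Perm.swap a b σ) (use j j<w (skip ρ) eq) = skip (use j j<w (reach-↭ σ ρ) eq)
    reach-↭ (Perm.swap a b σ) (use i i<w (use {s = s} j j<w ρ eq) eq′) =
      use j j<w (use i i<w (reach-↭ σ ρ) mod-refl)
        (mod-trans eq′ (mod-trans (mod-+ʳ _ eq) (mod-≡ (+-right-comm s _ _))))
    reach-↭ (Perm.trans σ τ) ρ = reach-↭ τ (reach-↭ σ ρ)

    reach-closed : ∀ {c a G} → (∀ {t} → Reach m X G t → Reach m X G (t ℤ.+ c)) →
      ∀ {t} → Reach m X (a ∷ G) t → Reach m X (a ∷ G) (t ℤ.+ c)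
    reach-closed cl (skip ρ) = skip (cl ρ)
    reach-closed {c} cl (use {s = s} j j<w ρ eq) = use j j<w (cl ρ)
      (mod-trans (mod-+ʳ c eq) (mod-≡ (+-right-comm s _ c)))

  -- The same items and multipliers are evaluated modulo m; the result is controlled only modulo d.
  reach-lift : ∀ {d m X G t} → 0ℤ ∈ X ⟨ m ⟩ → Reach d (0ℤ ∷ []) G t → ∃[ s ] (Reach m X G s × t ≈ s ⟨ d ⟩)
  reach-lift 0∈X (base (here t≈0)) = 0ℤ , base 0∈X , t≈0
  reach-lift 0∈X (skip ρ) with reach-lift 0∈X ρ
  ... | s , ρ′ , eq = s , skip ρ′ , eq
  reach-lift 0∈X (use {a} j j<w ρ eq) with reach-lift 0∈X ρ
  ... | s , ρ′ , eq′ = s ℤ.+ f a ℤ.* r ℤ.^ j , use j j<w ρ′ mod-refl , mod-trans eq (mod-+ʳ _ eq′)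

  module Greedy {m : ℕ} .{{_ : NonZero m}} (μ : RootOfUnity m r w) (X : List ℤ) (X! : Distinct m X)
    (0∈X : 0ℤ ∈ X ⟨ m ⟩) (X-stable : ∀ {t} → t ∈ X ⟨ m ⟩ → (t ℤ.* r) ∈ X ⟨ m ⟩) where

    open RootOfUnity μ

    -- L enumerates the values reached with the items G, and R are the skipped items.
    record State (as : List A) : Set where
      field
        G R      : List A
        L        : List ℤ
        d        : ℕ
        perm     : as ↭ G ++ R
        L!       : Distinct m L
        sound    : ∀ {t} → t ∈ L ⟨ m ⟩ → Reach m X G t
        complete : ∀ {t} → Reach m X G t → t ∈ L ⟨ m ⟩
        size     : length X + w * length G ≤ length L
        d∣m      : d ∣ m
        closed   : ∀ {t} → Reach m X G t → Reach m X G (t ℤ.+ + d)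
        vanish   : All (λ a → f a ≈ 0ℤ ⟨ d ⟩) R

    initial : State []
    initial = record
      { G = [] ; R = [] ; L = X ; d = m ; perm = ↭-refl ; L! = X! ; sound = base
      ; complete = λ { (base t∈X) → t∈X }
      ; size = ≤-reflexive (trans (cong (λ z → length X + z) (*-zeroʳ w)) (+-identityʳ _))
      ; d∣m = ∣-refl
      ; closed = λ {t} → reach-resp (mod-sym (mod-trans (mod-+ˡ t modulus≈0) (mod-≡ (ℤ.+-identityʳ t))))
      ; vanish = [] }

    -- The reached set is closed under adding d and under adding f a, hence by Bézout under their
    -- gcd, which becomes the new d.
    skipStep : ∀ {as} a (S : State as) → (∀ {t} → Reach m X (State.G S) t → Reach m X (State.G S) (t ℤ.+ f a)) → State (a ∷ as)
    skipStep a S cl = record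
      { G = G ; R = a ∷ R ; L = L ; d = g
      ; perm = ↭-trans (prep a perm) (↭-sym (shift a G R))
      ; L! = L! ; sound = sound ; complete = complete ; size = size
      ; d∣m = ∣-trans (ℕ.gcd[m,n]∣m d ℤ.∣ f a ∣) d∣m
      ; closed = closed′
      ; vanish = ∣⇒≈0 (ℕ.gcd[m,n]∣n d ℤ.∣ f a ∣) ∷ All.map (mod-weaken (ℕ.gcd[m,n]∣m d ℤ.∣ f a ∣)) vanish }
      where
      open State S
      g = ℕ.gcd d ℤ.∣ f a ∣
      add = closed-multiples {X = Reach m X G} reach-resp
      sign : ∃[ k ] + ℤ.∣ f a ∣ ≡ k ℤ.* f a
      sign with sign-cases (f a)
      ... | inj₁ e = 1ℤ , trans (sym e) (sym (ℤ.*-identityˡ (f a)))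
      ... | inj₂ e = ℤ.- 1ℤ , trans (lemma (+ ℤ.∣ f a ∣)) (cong (λ z → ℤ.- 1ℤ ℤ.* z) (sym e))
        where
        lemma : ∀ x → x ≡ ℤ.- 1ℤ ℤ.* ℤ.- x
        lemma = ℤ-solve
      closed′ : ∀ {t} → Reach m X G t → Reach m X G (t ℤ.+ + g)
      closed′ {t} ρ with bézout d ℤ.∣ f a ∣ | sign
      ... | k , l , e | n , e′ = subst (Reach m X G)
        (trans (lemma t (k ℤ.* + d) l n (f a)) (cong (λ z → t ℤ.+ z) (sym (trans e (cong (λ z → k ℤ.* + d ℤ.+ l ℤ.* z) e′)))))
        (add cl (l ℤ.* n) (add closed k ρ))
        where
        lemma : ∀ t u l n c → t ℤ.+ u ℤ.+ (l ℤ.* n) ℤ.* c ≡ t ℤ.+ (u ℤ.+ l ℤ.* (n ℤ.* c))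
        lemma = ℤ-solve

    -- The whole orbit of e + f a is new, and it is reached because (e + f a) r^j = e r^j + f a r^j
    -- with e r^j again in `L`.
    useStep : ∀ {as} a (S : State as) {e} → e ∈ State.L S ⟨ m ⟩ → ¬ (e ℤ.+ f a) ∈ State.L S ⟨ m ⟩ → State (a ∷ as)
    useStep a S {e} e∈L e+a∉L with insertAll (concatMap (λ s → applyUpTo (λ j → s ℤ.+ f a ℤ.* r ℤ.^ j) w) (State.L S)) (State.L S) (State.L! S)
    ... | L′ , L′! , cases , new⊆ , old⊆ = record
      { G = a ∷ G ; R = R ; L = L′ ; d = d
      ; perm = prep a perm ; L! = L′!
      ; sound = λ t∈ → sound′ (cases t∈)
      ; complete = complete′
      ; size = begin
          length X + w * suc (length G) ≡⟨ shuffle (length X) w (length G) ⟩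
          w + (length X + w * length G) ≤⟨ +-monoʳ-≤ w size ⟩
          w + length L ≡⟨ proj₂ extended ⟨
          length (orbit c ++ L) ≤⟨ pigeonhole (proj₁ extended) orbit⊆ ⟩
          length L′ ∎
      ; d∣m = d∣m ; closed = reach-closed closed ; vanish = vanish }
      where
      open ℕ.≤-Reasoning
      open State S
      c = e ℤ.+ f a
      moves : ℤ → List ℤ
      moves s = applyUpTo (λ j → s ℤ.+ f a ℤ.* r ℤ.^ j) w
      shuffle : ∀ x w g → x + w * suc g ≡ w + (x + w * g)
      shuffle = ℕ-solve
      L-stable : ∀ {t} → t ∈ L ⟨ m ⟩ → (t ℤ.* r) ∈ L ⟨ m ⟩
      L-stable t∈L = complete (reach-stable μ X-stable (sound t∈L))
      0∈L : 0ℤ ∈ L ⟨ m ⟩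
      0∈L = complete (reach-↭ (↭-reflexive (++-identityʳ G)) (reach-skip-++ G (base 0∈X)))
      extended = orbit-extends L! 0∈L L-stable e+a∉L
      move-∈ : ∀ {s t j} → s ∈ L ⟨ m ⟩ → j < w → t ≈ s ℤ.+ f a ℤ.* r ℤ.^ j ⟨ m ⟩ → t ∈ concatMap moves L ⟨ m ⟩
      move-∈ {j = j} s∈L j<w eq = Any.concat⁺ (Any.map⁺ (Any.map (λ {b} s≈b →
        Any.applyUpTo⁺ (λ j → b ℤ.+ f a ℤ.* r ℤ.^ j) (mod-trans eq (mod-+ʳ (f a ℤ.* r ℤ.^ j) s≈b)) j<w) s∈L))
      sound′ : ∀ {t} → t ∈ concatMap moves L ⟨ m ⟩ ⊎ t ∈ L ⟨ m ⟩ → Reach m X (a ∷ G) t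
      sound′ (inj₂ t∈L) = skip (sound t∈L)
      sound′ (inj₁ t∈) with Membership.find (Any.map⁻ (Any.concat⁻ (map moves L) t∈))
      ... | s , s∈L , t∈′ with Any.applyUpTo⁻ (λ j → s ℤ.+ f a ℤ.* r ℤ.^ j) t∈′
      ...   | j , j<w , t≈ = use j j<w (sound (Any.map mod-≡ s∈L)) t≈
      complete′ : ∀ {t} → Reach m X (a ∷ G) t → t ∈ L′ ⟨ m ⟩
      complete′ (skip ρ) = old⊆ (complete ρ)
      complete′ (use j j<w ρ eq) = new⊆ (move-∈ (complete ρ) j<w eq)
      orbit⊆ : ∀ {t} → t ∈ orbit c ++ L ⟨ m ⟩ → t ∈ L′ ⟨ m ⟩
      orbit⊆ t∈ with Any.++⁻ (orbit c) t∈
      ... | inj₂ t∈L = old⊆ t∈L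
      ... | inj₁ t∈ with Any.applyUpTo⁻ (λ j → c ℤ.* r ℤ.^ j) t∈
      ...   | j , j<w , t≈ = new⊆ (move-∈ (stable-^ ∈-resp-≈ L-stable j e∈L) j<w
                (mod-trans t≈ (mod-≡ (ℤ.*-distribʳ-+ (r ℤ.^ j) e (f a)))))

    greedy : ∀ as → State as
    greedy [] = initial
    greedy (a ∷ as) with greedy as
    ... | S with All.all? (λ e → mod-∈? (e ℤ.+ f a) (State.L S)) (State.L S)
    ...   | yes cl = skipStep a S λ ρ → State.sound S (closed₀ (State.complete S ρ))
      where
      closed₀ : ∀ {t} → t ∈ State.L S ⟨ m ⟩ → (t ℤ.+ f a) ∈ State.L S ⟨ m ⟩
      closed₀ t∈L with Membership.find t∈L
      ... | e , e∈L , t≈e = ∈-resp-≈ (mod-+ʳ (f a) (mod-sym t≈e)) (All.lookup cl e∈L)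
    ...   | no ¬cl with Membership.find (All.¬All⇒Any¬ (λ e → mod-∈? (e ℤ.+ f a) (State.L S)) (State.L S) ¬cl)
    ...     | e , e∈L , e+a∉L = useStep a S (Any.map mod-≡ e∈L) e+a∉L

  -- The bound on `length G` limits how many items are optional, and so how many replacements of
  -- value 0 will be needed.
  Filled : ℕ → List ℤ → List A → Set
  Filled m X as = ∃[ G ] ∃[ R ] (as ↭ G ++ R × length X + w * length G ≤ m × (∀ t → Reach m X G t))

  -- Each useful item gains w elements. Modulo m the start is `X`; modulo a proper divisor d it is
  -- only the class of 0, and d < 1 + w (1 + nonzeros) is the bound stated for d.
  Fills : ℕ → Set
  Fills m = RootOfUnity m r w → ∀ X → Distinct m X → 0ℤ ∈ X ⟨ m ⟩ →
    (∀ {t} → t ∈ X ⟨ m ⟩ → (t ℤ.* r) ∈ X ⟨ m ⟩) → ∀ as →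
    (∀ {d} → d ∣ m → 1 < d → d < m → d ≤ w * suc (nonzeros f d as)) →
    m < length X + w * suc (nonzeros f m as) → Filled m X as

  fill : ∀ {m} .{{_ : NonZero m}} → Fills m
  fill {m} = go m ≤-refl
    where
    go : ∀ n {m} .{{_ : NonZero m}} → m ≤ n → Fills m
    go zero {suc _} () _ _ _ _ _ _ _ _
    go (suc n) {m} m≤n μ X X! 0∈X X-stable as many many-m =
      G , R , perm , ≤-trans size (distinct-length≤ L!) , full
      where
      open Greedy μ X X! 0∈X X-stable
      open State (greedy as)
      open RootOfUnity μ
      0-reach : Reach m X G 0ℤ
      0-reach = reach-↭ (↭-reflexive (++-identityʳ G)) (reach-skip-++ G (base 0∈X))
      used : ∀ {d′} → d′ ∣ d → nonzeros f d′ as ≡ nonzeros f d′ G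
      used {d′} d′∣d = begin
        nonzeros f d′ as ≡⟨ nonzeros-↭ f d′ perm ⟩
        nonzeros f d′ (G ++ R) ≡⟨ nonzeros-++ f d′ G R ⟩
        nonzeros f d′ G + nonzeros f d′ R ≡⟨ cong (λ z → nonzeros f d′ G + z) (nonzeros-none f (All.map (mod-weaken d′∣d) vanish)) ⟩
        nonzeros f d′ G + 0 ≡⟨ +-identityʳ _ ⟩
        nonzeros f d′ G ∎
        where open ≡-Reasoning
      shift-by : ∀ {s t} → t ≈ s ⟨ d ⟩ → Reach m X G s → Reach m X G t
      shift-by {s} {t} (congruent (divides k eq)) ρ = subst (Reach m X G) (trans (cong (λ z → s ℤ.+ z) (sym eq)) (lemma s t))
        (closed-multiples reach-resp closed k ρ)
        where
        lemma : ∀ s t → s ℤ.+ (t ℤ.- s) ≡ t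
        lemma = ℤ-solve
      full : ∀ t → Reach m X G t
      full t with <-cmp d 1
      ... | tri≈ _ d≡1 _ = shift-by (subst (t ≈ 0ℤ ⟨_⟩) (sym d≡1) mod-one) 0-reach
      ... | tri< d<1 _ _ = contradiction (0∣⇒≡0 (subst (_∣ m) (n<1⇒n≡0 d<1) d∣m)) (ℕ.≢-nonZero⁻¹ m)
      ... | tri> _ _ 1<d with m≤n⇒m<n∨m≡n (∣⇒≤ d∣m)
      -- The reached set is a union of cosets of dℤ, so it suffices to reach all classes modulo d
      -- from 0. Skipped items vanish modulo d, so `G` inherits the hypotheses.
      ...   | inj₁ d<m = subgroup
        where
        instance d≢0 : NonZero d
        d≢0 = ℕ.>-nonZero (<-trans (s≤s z≤n) 1<d)
        rec = go n {d} (≤-pred (≤-trans d<m m≤n)) (root-weaken d∣m μ) (0ℤ ∷ []) ([] ∷ []) (here mod-refl)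
          (λ { (here t≈0) → here (mod-*ʳ r t≈0) }) G
          (λ {d′} d′∣d 1<d′ d′<d → subst (λ k → d′ ≤ w * suc k) (used d′∣d) (many (∣-trans d′∣d d∣m) 1<d′ (<-trans d′<d d<m)))
          (s≤s (subst (λ k → d ≤ w * suc k) (used ∣-refl) (many d∣m 1<d d<m)))
        subgroup : Reach m X G t
        subgroup with rec
        ... | G′ , R′ , σ , _ , full′ with reach-lift 0∈X (full′ t)
        ...   | s , ρ , t≈s = shift-by t≈s (reach-↭ (↭-trans (++-comm R′ G′) (↭-sym σ)) (reach-skip-++ R′ ρ))
      -- No item that is nonzero modulo m was skipped, so the orbit of a missing t would bring the
      -- count above m.
      ...   | inj₂ d≡m with mod-∈? t L
      ...     | yes t∈L = sound t∈L
      ...     | no t∉L = contradiction (begin-strict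
        m <⟨ many-m ⟩
        length X + w * suc (nonzeros f m as) ≤⟨ +-monoʳ-≤ (length X) (*-monoʳ-≤ w (s≤s nonzeros≤)) ⟩
        length X + w * suc (length G) ≡⟨ shuffle (length X) w (length G) ⟩
        w + (length X + w * length G) ≤⟨ +-monoʳ-≤ w size ⟩
        w + length L ≡⟨ proj₂ extended ⟨
        length (orbit t ++ L) ≤⟨ distinct-length≤ (proj₁ extended) ⟩
        m ∎) (<-irrefl refl)
        where
        open ℕ.≤-Reasoning
        extended = orbit-extends L! (complete 0-reach) (λ s∈L → complete (reach-stable μ X-stable (sound s∈L))) t∉L
        nonzeros≤ : nonzeros f m as ≤ length G
        nonzeros≤ = subst (_≤ length G) (trans (sym (used ∣-refl)) (cong (λ k → nonzeros f k as) d≡m)) (nonzeros≤length f d G)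
        shuffle : ∀ x w g → x + w * suc g ≡ w + (x + w * g)
        shuffle = ℕ-solve

  fill-zero : ∀ {m} .{{_ : NonZero m}} → RootOfUnity m r w → ∀ as →
    (∀ {d} → d ∣ m → 1 < d → d < m → d ≤ w * suc (nonzeros f d as)) → m ≤ w * suc (nonzeros f m as) → Filled m (0ℤ ∷ []) as
  fill-zero μ as many many-m = fill μ (0ℤ ∷ []) ([] ∷ []) (here mod-refl) (λ { (here t≈0) → here (mod-*ʳ r t≈0) }) as many (s≤s many-m)

-- The Erdős–Ginzburg–Ziv theorem

-- With r = 1 and w = 1 orbits are single elements and filling is about ordinary subset sums.
trivial-root : ∀ {m} → RootOfUnity m 1ℤ 1
trivial-root = record { order>0 = s≤s z≤n ; root = mod-refl ; units = λ { (s≤s _) (s≤s ()) } }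

total : {A : Set} → (A → ℤ) → List A → ℤ
total f []       = 0ℤ
total f (a ∷ as) = f a ℤ.+ total f as

module _ {A : Set} (f : A → ℤ) where

  total-++ : ∀ as bs → total f (as ++ bs) ≡ total f as ℤ.+ total f bs
  total-++ []       bs = sym (ℤ.+-identityˡ _)
  total-++ (a ∷ as) bs = trans (cong (λ z → f a ℤ.+ z) (total-++ as bs)) (sym (ℤ.+-assoc (f a) _ _))

  total-const : ∀ {m v as} → All (λ a → f a ≈ v ⟨ m ⟩) as → total f as ≈ + length as ℤ.* v ⟨ m ⟩
  total-const {v = v} [] = mod-≡ (sym (ℤ.*-zeroˡ v))
  total-const {v = v} {a ∷ as} (e ∷ es) = mod-trans (mod-+ e (total-const es)) (mod-≡ (lemma v (+ length as)))
    where
    lemma : ∀ v n → v ℤ.+ n ℤ.* v ≡ (1ℤ ℤ.+ n) ℤ.* v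
    lemma = ℤ-solve

take-↭ : {A : Set} → ∀ n (as : List A) → n ≤ length as → ∃[ bs ] ∃[ cs ] (as ≡ bs ++ cs × length bs ≡ n)
take-↭ zero    as       _         = [] , as , refl , refl
take-↭ (suc n) (a ∷ as) (s≤s n≤) with take-↭ n as n≤
... | bs , cs , refl , refl = a ∷ bs , cs , refl , refl

unpair : {A : Set} → List (A × A) → List A
unpair []             = []
unpair ((a , b) ∷ ps) = a ∷ b ∷ unpair ps

length-unpair : {A : Set} (ps : List (A × A)) → length (unpair ps) ≡ length ps + length ps
length-unpair []       = refl
length-unpair ((_ , _) ∷ ps) = cong suc (trans (cong suc (length-unpair ps)) (sym (+-suc (length ps) (length ps))))

ZeroSum : {A : Set} → (A → ℤ) → ℕ → ℕ → List A → Set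
ZeroSum f m n as = ∃[ bs ] ∃[ cs ] (as ↭ bs ++ cs × length bs ≡ n × total f bs ≈ 0ℤ ⟨ m ⟩)

EGZ : ℕ → Set₁
EGZ n = ∀ {A : Set} (f : A → ℤ) as → n + n ≤ suc (length as) → ZeroSum f n n as

-- The prime case follows the Cauchy-Davenport argument: n - 1 pairs of incongruent elements have
-- nonzero gaps, whose subset sums are all residues, unless some residue occurs n times.
module Pairing {A : Set} (f : A → ℤ) (m : ℕ) where

  Unequal : A × A → Set
  Unequal (a , b) = ¬ f a ≈ f b ⟨ m ⟩

  record Pairing (as : List A) : Set where
    field
      pairs    : List (A × A)
      rest     : List A
      v        : ℤ
      perm     : as ↭ unpair pairs ++ rest
      unequal  : All Unequal pairs
      constant : All (λ a → f a ≈ v ⟨ m ⟩) rest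

  pairing : ∀ as → Pairing as
  pairing [] = record { pairs = [] ; rest = [] ; v = 0ℤ ; perm = ↭-refl ; unequal = [] ; constant = [] }
  pairing (a ∷ as) = insert (pairing as)
    where
    insert : Pairing as → Pairing (a ∷ as)
    insert record { pairs = ps ; rest = [] ; perm = σ ; unequal = us } = record
      { pairs = ps ; rest = a ∷ [] ; v = f a
      ; perm = ↭-trans (prep a σ) (↭-sym (shift a (unpair ps) []))
      ; unequal = us ; constant = mod-refl ∷ [] }
    insert record { pairs = ps ; rest = b ∷ bs ; v = v ; perm = σ ; unequal = us ; constant = c ∷ cs } with mod-≟ (f a) v
    ... | yes a≈v = record
      { pairs = ps ; rest = a ∷ b ∷ bs ; v = v
      ; perm = ↭-trans (prep a σ) (↭-sym (shift a (unpair ps) (b ∷ bs)))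
      ; unequal = us ; constant = a≈v ∷ c ∷ cs }
    ... | no a≉v = record
      { pairs = (a , b) ∷ ps ; rest = bs ; v = v
      ; perm = prep a (↭-trans σ (shift b (unpair ps) bs))
      ; unequal = (λ a≈b → a≉v (mod-trans a≈b c)) ∷ us ; constant = cs }

  Avoids : ℤ → A × A → Set
  Avoids v (a , b) = ¬ f a ≈ v ⟨ m ⟩ × ¬ f b ≈ v ⟨ m ⟩

  avoids? : ∀ v p → Dec (Avoids v p)
  avoids? v (a , b) = ¬? (mod-≟ (f a) v) Dec.×-dec ¬? (mod-≟ (f b) v)

  meeting : ∀ v ps → All (λ p → ¬ Avoids v p) ps →
    ∃[ bs ] ∃[ cs ] (unpair ps ↭ bs ++ cs × length bs ≡ length ps × All (λ a → f a ≈ v ⟨ m ⟩) bs)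
  meeting v [] [] = [] , [] , ↭-refl , refl , []
  meeting v ((a , b) ∷ ps) (¬av ∷ ¬avs) with meeting v ps ¬avs | mod-≟ (f a) v | mod-≟ (f b) v
  ... | bs , cs , σ , len , eqs | yes a≈v | _ = a ∷ bs , b ∷ cs ,
    prep a (↭-trans (prep b σ) (↭-sym (shift b bs cs))) , cong suc len , a≈v ∷ eqs
  ... | bs , cs , σ , len , eqs | no _ | yes b≈v = b ∷ bs , a ∷ cs ,
    ↭-trans (swap a b σ) (prep b (↭-sym (shift a bs cs))) , cong suc len , b≈v ∷ eqs
  ... | _ | no a≉v | no b≉v = contradiction (a≉v , b≉v) ¬av

  ManyPairs ManyEqual : ℕ → List A → Set
  ManyPairs n as = ∃[ ps ] ∃[ e ] ∃[ cs ] (as ↭ unpair ps ++ e ∷ cs × suc (length ps) ≡ n × All Unequal ps)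
  ManyEqual n as = ∃[ v ] ∃[ bs ] ∃[ cs ] (as ↭ bs ++ cs × length bs ≡ n × All (λ a → f a ≈ v ⟨ m ⟩) bs)

  unpair-split : ∀ (qs qs′ : List (A × A)) cs → unpair (qs ++ qs′) ++ cs ≡ unpair qs ++ (unpair qs′ ++ cs)
  unpair-split []             qs′ cs = refl
  unpair-split ((a , b) ∷ qs) qs′ cs = cong (λ ds → a ∷ b ∷ ds) (unpair-split qs qs′ cs)

  length-pairing : ∀ {as : List A} ps cs → as ↭ unpair ps ++ cs → length as ≡ length ps + length ps + length cs
  length-pairing ps cs σ = trans (↭-length σ) (trans (length-++ (unpair ps)) (cong (_+ length cs) (length-unpair ps)))

  enough-pairs : ∀ {n as} ps cs → as ↭ unpair ps ++ cs → All Unequal ps → suc n + suc n ≤ suc (length as) →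
    n ≤ length ps → ManyPairs (suc n) as
  enough-pairs {n} {as} ps cs σ us len n≤ with take-↭ n ps n≤
  ... | qs , qs′ , refl , refl = finish (unpair qs′ ++ cs) (subst (as ↭_) (unpair-split qs qs′ cs) σ)
    where
    finish : ∀ ds → as ↭ unpair qs ++ ds → ManyPairs (suc (length qs)) as
    finish [] τ = ⊥-elim (⊥-by len 0 (lemma (length-pairing qs [] τ)))
      where
      lemma : ∀ {l n} → l ≡ n + n + 0 → suc (suc l + 0) ≡ suc n + suc n
      lemma {n = n} refl = eq n
        where
        eq : ∀ n → suc (suc (n + n + 0) + 0) ≡ suc n + suc n
        eq = ℕ-solve
    finish (e ∷ es) τ = qs , e , es , τ , refl , All.++⁻ˡ qs us

  -- Two leftover copies of v split a pair of elements different from v into two new pairs.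
  split-pair : ∀ ps c c′ {v cs as} → as ↭ unpair ps ++ c ∷ c′ ∷ cs → All Unequal ps → Any (Avoids v) ps →
    f c ≈ v ⟨ m ⟩ → f c′ ≈ v ⟨ m ⟩ →
    ∃[ qs ] (as ↭ unpair qs ++ cs × All Unequal qs × length qs ≡ suc (length ps))
  split-pair ((a , b) ∷ ps) c c′ {cs = cs} σ (_ ∷ us) (here (a≉v , b≉v)) c≈v c′≈v =
    (a , c) ∷ (b , c′) ∷ ps ,
    ↭-trans σ (prep a (↭-trans (prep b (shifts (unpair ps) (c ∷ c′ ∷ []))) (swap b c ↭-refl))) ,
    (λ a≈c → a≉v (mod-trans a≈c c≈v)) ∷ (λ b≈c′ → b≉v (mod-trans b≈c′ c′≈v)) ∷ us , refl
  split-pair ((a , b) ∷ ps) c c′ {cs = cs} σ (u ∷ us) (there av) c≈v c′≈v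
    with split-pair ps c c′ {cs = cs} ↭-refl us av c≈v c′≈v
  ... | qs , τ , us′ , len = (a , b) ∷ qs , ↭-trans σ (prep a (prep b τ)) , u ∷ us′ , cong suc len

  halve : ∀ {n l p c} → l ≡ p + p + c → c ≤ 1 → suc n + suc n ≤ suc l → n ≤ p
  halve {n} {_} {p} {c} refl c≤1 h = ≮⇒≥ λ lt → ⊥-by (+-mono-≤ (+-mono-≤ h (+-mono-≤ lt lt)) c≤1) 1 (eq n p c)
    where
    eq : ∀ n p c → suc (suc (p + p + c) + (n + n) + 1 + 1) ≡ suc n + suc n + (suc p + suc p) + c
    eq = ℕ-solve

  -- While two copies of v are left over, a pair avoiding v can be split, which shortens the rest by
  -- two. If no pair avoids v, each contributes a copy of v, and together with the rest there are
  -- enough of them.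
  rebalance : ∀ k {n as} (P : Pairing as) → length (Pairing.rest P) ≤ k → suc n + suc n ≤ suc (length as) →
    ManyPairs (suc n) as ⊎ ManyEqual (suc n) as
  rebalance k record { pairs = ps ; rest = [] ; perm = σ ; unequal = us } _ len =
    inj₁ (enough-pairs ps [] σ us len (halve (length-pairing ps [] σ) z≤n len))
  rebalance k record { pairs = ps ; rest = c ∷ [] ; perm = σ ; unequal = us } _ len =
    inj₁ (enough-pairs ps (c ∷ []) σ us len (halve (length-pairing ps (c ∷ []) σ) ≤-refl len))
  rebalance (suc (suc k)) {n} {as} record { pairs = ps ; rest = rest@(c ∷ c′ ∷ cs) ; v = v ; perm = σ ; unequal = us ; constant = e ∷ e′ ∷ es } (s≤s (s≤s ≤k)) len
    with Any.any? (avoids? v) ps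
  ... | yes av with split-pair ps c c′ σ us av e e′
  ...   | qs , τ , us′ , _ = rebalance k record { pairs = qs ; rest = cs ; v = v ; perm = τ ; unequal = us′ ; constant = es } ≤k len
  rebalance (suc (suc k)) {n} {as} record { pairs = ps ; rest = rest@(c ∷ c′ ∷ cs) ; v = v ; perm = σ ; unequal = us ; constant = es } _ len
      | no none with meeting v ps (All.¬Any⇒All¬ ps none)
  ... | bs , ds , τ , len-bs , eqs with take-↭ (suc n) (bs ++ rest)
          (subst (suc n ≤_) (sym (length-++ bs)) (count len (length-pairing ps rest σ) len-bs))
    where
    count : ∀ {n l p b k} → suc n + suc n ≤ suc l → l ≡ p + p + suc k → b ≡ p → suc n ≤ b + suc k
    count {n} {p = p} {k = k} h refl refl = ≮⇒≥ λ lt → ⊥-by (+-mono-≤ h (+-mono-≤ lt lt)) (suc k) (eq n p k)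
      where
      eq : ∀ n p k → suc (suc (p + p + suc k) + (suc n + suc n) + suc k) ≡ suc n + suc n + (suc (p + suc k) + suc (p + suc k))
      eq = ℕ-solve
  ...   | qs , qs′ , eq , len-qs = inj₂ (v , qs , qs′ ++ ds , perm , len-qs , All.++⁻ˡ qs (subst (All _) eq (All.++⁺ eqs es)))
    where
    open Perm.PermutationReasoning
    perm : as ↭ qs ++ qs′ ++ ds
    perm = begin
      as ↭⟨ σ ⟩
      unpair ps ++ rest ↭⟨ ++⁺ʳ rest τ ⟩
      (bs ++ ds) ++ rest ≡⟨ ++-assoc bs ds rest ⟩
      bs ++ ds ++ rest ↭⟨ ++⁺ˡ bs (++-comm ds rest) ⟩
      bs ++ rest ++ ds ≡⟨ ++-assoc bs rest ds ⟨
      (bs ++ rest) ++ ds ≡⟨ cong (_++ ds) eq ⟩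
      (qs ++ qs′) ++ ds ≡⟨ ++-assoc qs qs′ ds ⟩
      qs ++ qs′ ++ ds ∎

  gap : A × A → ℤ
  gap (a , b) = f b ℤ.- f a

  open Filling gap 1ℤ 1

  -- Choosing the second member of a pair instead of the first adds the gap of the pair.
  choose : ∀ {ps t} → Reach m (0ℤ ∷ []) ps t →
    ∃[ bs ] ∃[ cs ] (unpair ps ↭ bs ++ cs × length bs ≡ length ps × total f bs ≈ total (λ p → f (proj₁ p)) ps ℤ.+ t ⟨ m ⟩)
  choose (base (here t≈0)) = [] , [] , ↭-refl , refl , mod-sym (mod-trans (mod-+ˡ 0ℤ t≈0) mod-refl)
  choose (skip {(a , b)} {ps} {t} ρ) with choose ρ
  ... | bs , cs , σ , len , eq = a ∷ bs , b ∷ cs , prep a (↭-trans (prep b σ) (↭-sym (shift b bs cs))) , cong suc len ,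
    mod-trans (mod-+ˡ (f a) eq) (mod-≡ (sym (ℤ.+-assoc (f a) _ t)))
  choose (use {(a , b)} {ps} {s} {t} zero _ ρ eq′) with choose ρ
  ... | bs , cs , σ , len , eq = b ∷ bs , a ∷ cs , ↭-trans (swap a b σ) (prep b (↭-sym (shift a bs cs))) , cong suc len ,
    mod-trans (mod-+ˡ (f b) eq) (mod-trans (mod-≡ (lemma (f a) (f b) s (total (λ p → f (proj₁ p)) ps))) (mod-+ˡ (f a ℤ.+ total (λ p → f (proj₁ p)) ps) (mod-sym eq′)))
    where
    lemma : ∀ a b s u → b ℤ.+ (u ℤ.+ s) ≡ (a ℤ.+ u) ℤ.+ (s ℤ.+ (b ℤ.- a) ℤ.* 1ℤ)
    lemma = ℤ-solve
  choose (use (suc j) (s≤s ()) ρ eq′)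

egz-prime : ∀ {n} → Prime n → EGZ n
egz-prime {suc n} n-prime {A} f as len with rebalance _ (pairing as) ≤-refl len
  where open Pairing f (suc n)
... | inj₂ (v , bs , cs , σ , len-bs , eqs) = bs , cs , σ , len-bs , mod-trans (total-const f eqs)
  (subst (λ k → + k ℤ.* v ≈ 0ℤ ⟨ suc n ⟩) (sym len-bs) (mod-trans (mod-*ʳ v modulus≈0) (mod-≡ (ℤ.*-zeroˡ v))))
... | inj₁ (ps , e , es , σ , len-ps , us) = finish
    (fill-zero trivial-root ps
      (λ d∣n 1<d d<n → contradiction (ℕ.hasNonTrivialDivisor {{ℕ.n>1⇒nonTrivial 1<d}} d<n d∣n) (Prime.notComposite n-prime))
      (≤-reflexive (sym (trans (*-identityˡ _) (trans (cong suc all-nonzero) len-ps)))))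
  where
  open Pairing f (suc n)
  open Filling gap 1ℤ 1
  all-nonzero : nonzeros gap (suc n) ps ≡ length ps
  all-nonzero = cong length (filter-all (nonzero? gap (suc n)) (All.map (λ u z → u (mod-sym (mod-difference z))) us))
  -- The gaps have to cancel the extra element `e` together with the first members of all pairs.
  t₀ = ℤ.- (f e ℤ.+ total (λ p → f (proj₁ p)) ps)
  finish : Filled (suc n) (0ℤ ∷ []) ps → ZeroSum f (suc n) (suc n) as
  finish (G , R , τ , _ , full) with choose (reach-↭ (↭-trans (++-comm R G) (↭-sym τ)) (reach-skip-++ R (full t₀)))
  ... | bs , cs , υ , len-bs , eq = e ∷ bs , cs ++ es , perm , trans (cong suc len-bs) len-ps ,
    mod-trans (mod-+ˡ (f e) eq) (mod-≡ (lemma (f e) (total (λ p → f (proj₁ p)) ps)))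
    where
    lemma : ∀ e u → e ℤ.+ (u ℤ.+ ℤ.- (e ℤ.+ u)) ≡ 0ℤ
    lemma = ℤ-solve
    open Perm.PermutationReasoning
    perm : as ↭ e ∷ bs ++ cs ++ es
    perm = begin
      as ↭⟨ σ ⟩
      unpair ps ++ e ∷ es ↭⟨ shift e (unpair ps) es ⟩
      e ∷ unpair ps ++ es ↭⟨ prep e (++⁺ʳ es υ) ⟩
      e ∷ (bs ++ cs) ++ es ≡⟨ cong (e ∷_) (++-assoc bs cs es) ⟩
      e ∷ bs ++ cs ++ es ∎

-- The sum is an exact integer multiple of n, not a congruence: the quotient `members-weight` is the
-- value to which the theorem is applied at the next level.
record Block {A : Set} (f : A → ℤ) (n : ℕ) : Set where
  field
    members  : List A
    members-size   : length members ≡ n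
    members-weight : ℤ
    members-sum   : total f members ≡ members-weight ℤ.* + n

open Block

total-blocks : ∀ {A : Set} {f : A → ℤ} {n} (bs : List (Block f n)) → total f (concatMap members bs) ≡ total members-weight bs ℤ.* + n
total-blocks {n = n} [] = sym (ℤ.*-zeroˡ (+ n))
total-blocks {f = f} {n} (b ∷ bs) = trans (total-++ f (members b) _)
  (trans (cong₂ ℤ._+_ (members-sum b) (total-blocks bs)) (sym (ℤ.*-distribʳ-+ (+ n) (members-weight b) _)))

concatMap-↭ : ∀ {A B : Set} (g : A → List B) {as bs} → as ↭ bs → concatMap g as ↭ concatMap g bs
concatMap-↭ g Perm.refl = ↭-refl
concatMap-↭ g (Perm.prep a σ) = ++⁺ˡ (g a) (concatMap-↭ g σ)
concatMap-↭ g (Perm.swap {xs} {ys} a b σ) = ↭-trans (shifts (g a) (g b)) (++⁺ˡ (g b) (++⁺ˡ (g a) (concatMap-↭ g σ)))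
concatMap-↭ g (Perm.trans σ τ) = ↭-trans (concatMap-↭ g σ) (concatMap-↭ g τ)

length-concatMap : ∀ {A B : Set} (g : A → List B) {n} → (∀ a → length (g a) ≡ n) → ∀ as → length (concatMap g as) ≡ length as * n
length-concatMap g len [] = refl
length-concatMap g len (a ∷ as) = trans (length-++ (g a)) (cong₂ _+_ (len a) (length-concatMap g len as))

blocks : ∀ {n} → EGZ n → ∀ {A : Set} (f : A → ℤ) k as → k * n + n ≤ suc (length as) →
  ∃[ bs ] ∃[ cs ] (as ↭ concatMap (members {f = f} {n}) bs ++ cs × length bs ≡ k)
blocks egz f zero as _ = [] , as , ↭-refl , refl
blocks {n} egz f (suc k) as len with egz f as (≤-by len (k * n) (eq n (k * n) (suc (length as))))
  where
  eq : ∀ n u l → n + n + l + u ≡ l + (n + u + n)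
  eq = ℕ-solve
... | bs , cs , σ , len-bs , congruent (divides q sum-eq)
  with blocks egz f k cs (+-cancelˡ-≤ n _ _ (≤-trans (≤-reflexive (sym (+-assoc n (k * n) n)))
         (≤-trans len (≤-reflexive (trans (cong suc (trans (↭-length σ) (trans (length-++ bs) (cong (_+ length cs) len-bs)))) (sym (+-suc n (length cs))))))))
...   | bss , ds , τ , len-bss =
  record { members = bs ; members-size = len-bs ; members-weight = q ; members-sum = trans (sym (ℤ.+-identityʳ (total f bs))) sum-eq } ∷ bss , ds ,
  ↭-trans σ (↭-trans (++⁺ˡ bs τ) (↭-reflexive (sym (++-assoc bs _ ds)))) , cong suc len-bss

egz-multiple : ∀ {n} → EGZ n → ∀ {A : Set} (f : A → ℤ) k as → k * n + n ≤ suc (length as) → ZeroSum f n (k * n) as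
egz-multiple {n} egz f k as len with blocks egz f k as len
... | bs , cs , σ , refl = concatMap members bs , cs , σ , length-concatMap members members-size bs ,
  by-quotient (total members-weight bs) (trans (total-blocks bs) (sym (ℤ.+-identityˡ _)))

suc-pred-double : ∀ b .{{_ : NonZero b}} → suc (ℕ.pred (b + b)) ≡ b + b
suc-pred-double b = suc-pred (b + b) {{ℕ.>-nonZero (≤-trans (ℕ.>-nonZero⁻¹ b) (m≤m+n b b))}}

-- From 2ab - 1 terms one extracts 2b - 1 blocks of a terms; the quotients of their sums by a
-- contain b with sum divisible by b.
egz-* : ∀ {a b} .{{_ : NonZero b}} → EGZ a → EGZ b → EGZ (b * a)
egz-* {a} {b} egz-a egz-b f as len with blocks egz-a f (ℕ.pred (b + b)) as (≤-trans (≤-reflexive eq) len)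
  where
  eq : ℕ.pred (b + b) * a + a ≡ b * a + b * a
  eq = trans (+-comm _ a) (trans (cong (_* a) (suc-pred-double b)) (*-distribʳ-+ a b b))
... | bs , cs , σ , len-bs with egz-b members-weight bs (≤-reflexive (trans (sym (suc-pred-double b)) (cong suc (sym len-bs))))
...   | bs′ , cs′ , τ , len-bs′ , congruent (divides q eq) =
  concatMap members bs′ , concatMap members cs′ ++ cs ,
  ↭-trans σ (↭-trans (++⁺ʳ cs (concatMap-↭ members τ)) (↭-reflexive (trans (cong (_++ cs) (concatMap-++ members bs′ cs′)) (++-assoc (concatMap members bs′) _ cs)))) ,
  trans (length-concatMap members members-size bs′) (cong (_* a) len-bs′) ,
  by-quotient q (begin
    total f (concatMap members bs′) ≡⟨ total-blocks bs′ ⟩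
    total members-weight bs′ ℤ.* + a ≡⟨ cong (ℤ._* + a) (trans (sym (ℤ.+-identityʳ (total members-weight bs′))) eq) ⟩
    q ℤ.* + b ℤ.* + a ≡⟨ ℤ.*-assoc q (+ b) (+ a) ⟩
    q ℤ.* (+ b ℤ.* + a) ≡⟨ cong (λ z → q ℤ.* z) (ℤ.pos-* b a) ⟨
    q ℤ.* + (b * a) ≡⟨ ℤ.+-identityˡ _ ⟨
    0ℤ ℤ.+ q ℤ.* + (b * a) ∎)
  where open ≡-Reasoning

egz-one : EGZ 1
egz-one f (a ∷ as) _ = a ∷ [] , as , ↭-refl , refl , mod-one
egz-one f [] (s≤s ())

egz : ∀ n .{{_ : NonZero n}} → EGZ n
egz n = go n n ≤-refl
  where
  go : ∀ k n .{{_ : NonZero n}} → n ≤ k → EGZ n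
  go _ 1 _ = egz-one
  go (suc k) n@(suc (suc _)) n≤k with prime? n
  ... | yes n-prime = egz-prime n-prime
  ... | no ¬prime with ¬prime⇒composite ¬prime
  ...   | ℕ.hasNonTrivialDivisor {d} d<n d∣n = subst EGZ (sym (ℕ._∣_.equality d∣n))
    (egz-* {d} {ℕ._∣_.quotient d∣n} {{q≢0}} (go k d {{d≢0}} (≤-pred (≤-trans d<n n≤k)))
      (go k _ {{q≢0}} (≤-pred (≤-trans (quotient-< d∣n) n≤k))))
    where
    d≢0 : NonZero d
    d≢0 = ℕ.nonTrivial⇒nonZero d
    q≢0 : NonZero (ℕ._∣_.quotient d∣n)
    q≢0 = ℕ.>-nonZero (<-trans (s≤s z≤n) (quotient>1 d∣n d<n))

subtype : ∀ {A : Set} {P : A → Set} {as} → All P as → ∃[ ss ] map (proj₁ {B = P}) ss ≡ as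
subtype [] = [] , refl
subtype (p ∷ ps) with subtype ps
... | ss , eq = (_ , p) ∷ ss , cong (_ ∷_) eq

-- After division by d only the theorem modulo n is needed, so fewer terms suffice than for the
-- modulus n d.
egz-divisible : ∀ {A : Set} (f : A → ℤ) d n .{{_ : NonZero n}} k as → All (λ a → f a ≈ 0ℤ ⟨ d ⟩) as →
  k * n + n ≤ suc (length as) → ZeroSum f (n * d) (k * n) as
egz-divisible {A} f d n k as zs len with subtype zs
... | ss , refl with egz-multiple (egz n) q k ss (subst (λ l → k * n + n ≤ suc l) (length-map proj₁ ss) len)
  where
  q : (∃[ a ] f a ≈ 0ℤ ⟨ d ⟩) → ℤ
  q (_ , congruent (divides k _)) = k
...   | bs , cs , σ , len-bs , congruent (divides k′ eq) = map proj₁ bs , map proj₁ cs ,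
  ↭-trans (Perm.map⁺ proj₁ σ) (↭-reflexive (map-++ proj₁ bs cs)) , trans (length-map proj₁ bs) len-bs ,
  by-quotient k′ (begin
    total f (map proj₁ bs) ≡⟨ total-q bs ⟩
    total q bs ℤ.* + d ≡⟨ cong (ℤ._* + d) (trans (sym (ℤ.+-identityʳ (total q bs))) eq) ⟩
    k′ ℤ.* + n ℤ.* + d ≡⟨ ℤ.*-assoc k′ (+ n) (+ d) ⟩
    k′ ℤ.* (+ n ℤ.* + d) ≡⟨ cong (λ z → k′ ℤ.* z) (ℤ.pos-* n d) ⟨
    k′ ℤ.* + (n * d) ≡⟨ ℤ.+-identityˡ _ ⟨
    0ℤ ℤ.+ k′ ℤ.* + (n * d) ∎)
  where
  open ≡-Reasoning
  q : (∃[ a ] f a ≈ 0ℤ ⟨ d ⟩) → ℤ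
  q (_ , congruent (divides k _)) = k
  total-q : ∀ bs → total f (map proj₁ bs) ≡ total q bs ℤ.* + d
  total-q [] = sym (ℤ.*-zeroˡ (+ d))
  total-q ((a , congruent (divides k e)) ∷ bs) = trans (cong₂ ℤ._+_ (trans (sym (ℤ.+-identityʳ (f a))) e) (total-q bs))
    (sym (ℤ.*-distribʳ-+ (+ d) k _))

-- Ordered products and insertion

++-compare : ∀ {A : Set} (as bs cs ds : List A) → as ++ bs ≡ cs ++ ds →
  (∃[ es ] (as ≡ cs ++ es × ds ≡ es ++ bs)) ⊎ (∃[ es ] (cs ≡ as ++ es × bs ≡ es ++ ds))
++-compare []       bs cs       ds eq = inj₂ (cs , refl , eq)
++-compare (a ∷ as) bs []       ds eq = inj₁ (a ∷ as , refl , sym eq)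
++-compare (a ∷ as) bs (c ∷ cs) ds eq with ∷-injective eq
... | refl , eq′ with ++-compare as bs cs ds eq′
...   | inj₁ (es , refl , e) = inj₁ (es , refl , e)
...   | inj₂ (es , refl , e) = inj₂ (es , refl , e)

-- An element a stands for x^(α a) y^(β a).
module Metacyclic (p m : ℕ) (r : ℤ) .{{_ : NonZero m}} (rᵖ≈1 : r ℤ.^ p ≈ 1ℤ ⟨ m ⟩)
  (r-units : ∀ {n} → ¬ p ∣ n → IsUnit m (r ℤ.^ n ℤ.- 1ℤ)) {A : Set} (α : A → ℕ) (β : A → ℤ) where

  αsum : List A → ℕ
  αsum []      = 0
  αsum (a ∷ T) = α a + αsum T

  -- The exponent of y in the ordered product: moving y^b to the right past x^c turns it into y^(b
  -- r^c), so each β is multiplied by r to the power of all that follows it.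
  βval : List A → ℤ
  βval []      = 0ℤ
  βval (a ∷ T) = β a ℤ.* r ℤ.^ αsum T ℤ.+ βval T

  αsum-++ : ∀ S T → αsum (S ++ T) ≡ αsum S + αsum T
  αsum-++ []      T = refl
  αsum-++ (a ∷ S) T = trans (cong (λ z → α a + z) (αsum-++ S T)) (sym (+-assoc (α a) _ _))

  βval-++ : ∀ S T → βval (S ++ T) ≡ βval S ℤ.* r ℤ.^ αsum T ℤ.+ βval T
  βval-++ [] T = sym (trans (cong (ℤ._+ βval T) (ℤ.*-zeroˡ (r ℤ.^ αsum T))) (ℤ.+-identityˡ (βval T)))
  βval-++ (a ∷ S) T = begin
    β a ℤ.* r ℤ.^ αsum (S ++ T) ℤ.+ βval (S ++ T)
      ≡⟨ cong₂ (λ k z → β a ℤ.* k ℤ.+ z) (trans (cong (r ℤ.^_) (αsum-++ S T)) (ℤ.^-distribˡ-+-* r (αsum S) (αsum T))) (βval-++ S T) ⟩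
    β a ℤ.* (r ℤ.^ αsum S ℤ.* r ℤ.^ αsum T) ℤ.+ (βval S ℤ.* r ℤ.^ αsum T ℤ.+ βval T)
      ≡⟨ lemma (β a) (r ℤ.^ αsum S) (r ℤ.^ αsum T) (βval S) (βval T) ⟩
    (β a ℤ.* r ℤ.^ αsum S ℤ.+ βval S) ℤ.* r ℤ.^ αsum T ℤ.+ βval T ∎
    where
    open ≡-Reasoning
    lemma : ∀ b u v s t → b ℤ.* (u ℤ.* v) ℤ.+ (s ℤ.* v ℤ.+ t) ≡ (b ℤ.* u ℤ.+ s) ℤ.* v ℤ.+ t
    lemma = ℤ-solve

  αsum-↭ : ∀ {S T} → S ↭ T → αsum S ≡ αsum T
  αsum-↭ Perm.refl = refl
  αsum-↭ (Perm.prep a σ) = cong (λ z → α a + z) (αsum-↭ σ)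
  αsum-↭ (Perm.swap {xs} {ys} a b σ) = trans (cong (λ z → α a + (α b + z)) (αsum-↭ σ)) (lemma (α a) (α b) (αsum ys))
    where
    lemma : ∀ a b c → a + (b + c) ≡ b + (a + c)
    lemma = ℕ-solve
  αsum-↭ (Perm.trans σ τ) = trans (αsum-↭ σ) (αsum-↭ τ)

  r-periodic : ∀ {n} → p ∣ n → r ℤ.^ n ≈ 1ℤ ⟨ m ⟩
  r-periodic (ℕ.divides q refl) = mod-trans (mod-≡ (trans (cong (r ℤ.^_) (*-comm q p)) (sym (ℤ.^-*-assoc r p q))))
    (mod-trans (mod-^ q rᵖ≈1) (mod-≡ (ℤ.^-zeroˡ q)))

  r-absorb : ∀ {n} k → p ∣ n → r ℤ.^ (n + k) ≈ r ℤ.^ k ⟨ m ⟩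
  r-absorb {n} k p∣n = mod-trans (mod-≡ (ℤ.^-distribˡ-+-* r n k))
    (mod-trans (mod-*ʳ (r ℤ.^ k) (r-periodic p∣n)) (mod-≡ (ℤ.*-identityˡ (r ℤ.^ k))))

  Split : List A → ℤ → Set
  Split Q u = ∃[ Q₁ ] ∃[ Q₂ ] (Q ≡ Q₁ ++ Q₂ × r ℤ.^ αsum Q₂ ≈ u ⟨ m ⟩)

  -- n terms of P have an ordered product y^t which, for every u in J, is cut at some point
  -- where an inserted y^c contributes c u to the exponent.
  record Realises (J : ℤ → Set) (P : List A) (n : ℕ) (t : ℤ) : Set where
    constructor realise
    field
      {chosen others} : List A
      pool   : P ↭ chosen ++ others
      size   : length chosen ≡ n
      p∣α    : p ∣ αsum chosen
      value  : βval chosen ≈ t ⟨ m ⟩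
      splits : ∀ {u} → J u → Split chosen u

  NoSplit : ℤ → Set
  NoSplit _ = ⊥

  realises-resp : ∀ {J P n s t} → s ≈ t ⟨ m ⟩ → Realises J P n s → Realises J P n t
  realises-resp s≈t (realise σ len p∣ eq spl) = realise σ len p∣ (mod-trans eq s≈t) spl

  realises-↭ : ∀ {J P P′ n t} → P′ ↭ P → Realises J P n t → Realises J P′ n t
  realises-↭ τ (realise σ len p∣ eq spl) = realise (↭-trans τ σ) len p∣ eq spl

  realises-size : ∀ {J P n n′ t} → n ≡ n′ → Realises J P n t → Realises J P n′ t
  realises-size refl R = R

  use-all : ∀ T → p ∣ αsum T → Realises NoSplit T (length T) (βval T)
  use-all T p∣ = realise {chosen = T} {others = []} (↭-reflexive (sym (++-identityʳ T))) refl p∣ mod-refl (λ ())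

  use-none : ∀ P → Realises NoSplit P 0 0ℤ
  use-none P = realise {chosen = []} ↭-refl refl (p ℕ.∣0) mod-refl (λ ())

  -- The inserted block has α-sum divisible by p, so r to that power is 1: neither the contributions
  -- of the terms before it nor the multiplier of any older cut changes. An older cut lies on one
  -- side of the insertion and survives.
  insert-at : ∀ {J P n s P′ n′ t u} (R : Realises J P n s) → Split (Realises.chosen R) u → Realises NoSplit P′ n′ t →
    Realises J (P ++ P′) (n + n′) (s ℤ.+ t ℤ.* u)
  insert-at {J} {P} {s = s} {P′} {t = t} {u} (realise {_} {Q′} σ refl p∣Q eq spl) (Q₁ , Q₂ , refl , u≈)
    (realise {C} {C′} τ refl p∣C eq′ _) =
    realise {chosen = Q₁ ++ C ++ Q₂} {others = Q′ ++ C′} perm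
      (trans (↭-length move) (length-++ (Q₁ ++ Q₂)))
      (subst (p ∣_) (sym (trans (αsum-↭ move) (αsum-++ (Q₁ ++ Q₂) C))) (∣m∣n⇒∣m+n p∣Q p∣C))
      val splits′
    where
    move : Q₁ ++ C ++ Q₂ ↭ (Q₁ ++ Q₂) ++ C
    move = ↭-trans (++⁺ˡ Q₁ (++-comm C Q₂)) (↭-reflexive (sym (++-assoc Q₁ Q₂ C)))
    perm : P ++ P′ ↭ (Q₁ ++ C ++ Q₂) ++ Q′ ++ C′
    perm = begin
      P ++ P′ ↭⟨ ++⁺ σ τ ⟩
      ((Q₁ ++ Q₂) ++ Q′) ++ C ++ C′ ≡⟨ ++-assoc (Q₁ ++ Q₂) Q′ (C ++ C′) ⟩
      (Q₁ ++ Q₂) ++ Q′ ++ C ++ C′ ↭⟨ ++⁺ˡ (Q₁ ++ Q₂) (shifts Q′ C) ⟩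
      (Q₁ ++ Q₂) ++ C ++ Q′ ++ C′ ≡⟨ ++-assoc (Q₁ ++ Q₂) C (Q′ ++ C′) ⟨
      ((Q₁ ++ Q₂) ++ C) ++ Q′ ++ C′ ↭⟨ ++⁺ʳ (Q′ ++ C′) (↭-sym move) ⟩
      (Q₁ ++ C ++ Q₂) ++ Q′ ++ C′ ∎
      where open Perm.PermutationReasoning
    val : βval (Q₁ ++ C ++ Q₂) ≈ s ℤ.+ t ℤ.* u ⟨ m ⟩
    val = begin
      βval (Q₁ ++ C ++ Q₂)
        ≡⟨ trans (βval-++ Q₁ (C ++ Q₂)) (cong₂ (λ k z → βval Q₁ ℤ.* r ℤ.^ k ℤ.+ z) (αsum-++ C Q₂) (βval-++ C Q₂)) ⟩
      βval Q₁ ℤ.* r ℤ.^ (αsum C + αsum Q₂) ℤ.+ (βval C ℤ.* r ℤ.^ αsum Q₂ ℤ.+ βval Q₂)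
        ≈⟨ mod-+ʳ _ (mod-*ˡ (βval Q₁) (r-absorb (αsum Q₂) p∣C)) ⟩
      βval Q₁ ℤ.* r ℤ.^ αsum Q₂ ℤ.+ (βval C ℤ.* r ℤ.^ αsum Q₂ ℤ.+ βval Q₂)
        ≡⟨ lemma (βval Q₁ ℤ.* r ℤ.^ αsum Q₂) (βval C ℤ.* r ℤ.^ αsum Q₂) (βval Q₂) ⟩
      (βval Q₁ ℤ.* r ℤ.^ αsum Q₂ ℤ.+ βval Q₂) ℤ.+ βval C ℤ.* r ℤ.^ αsum Q₂
        ≡⟨ cong (ℤ._+ βval C ℤ.* r ℤ.^ αsum Q₂) (βval-++ Q₁ Q₂) ⟨
      βval (Q₁ ++ Q₂) ℤ.+ βval C ℤ.* r ℤ.^ αsum Q₂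
        ≈⟨ mod-+ eq (mod-* eq′ u≈) ⟩
      s ℤ.+ t ℤ.* u ∎
      where
      open SetoidReasoning (modSetoid m)
      lemma : ∀ a b c → a ℤ.+ (b ℤ.+ c) ≡ (a ℤ.+ c) ℤ.+ b
      lemma = ℤ-solve
    splits′ : ∀ {v} → J v → Split (Q₁ ++ C ++ Q₂) v
    splits′ Jv with spl Jv
    ... | S₁ , S₂ , e , v≈ with ++-compare Q₁ Q₂ S₁ S₂ e
    ...   | inj₁ (E , refl , refl) = S₁ , E ++ C ++ Q₂ , ++-assoc S₁ E (C ++ Q₂) ,
      mod-trans (mod-trans (mod-≡ (cong (r ℤ.^_) shifted)) (r-absorb (αsum (E ++ Q₂)) p∣C)) v≈
      where
      shifted : αsum (E ++ C ++ Q₂) ≡ αsum C + αsum (E ++ Q₂)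
      shifted = trans (αsum-↭ (shifts E C)) (αsum-++ C (E ++ Q₂))
    ...   | inj₂ (E , refl , refl) = Q₁ ++ C ++ E , S₂ ,
      trans (cong (Q₁ ++_) (sym (++-assoc C E S₂))) (sym (++-assoc Q₁ (C ++ E) S₂)) , v≈

  append : ∀ {J P n s P′ n′ t} → Realises J P n s → Realises NoSplit P′ n′ t → Realises J (P ++ P′) (n + n′) (s ℤ.+ t)
  append {s = s} {t = t} R R′ = realises-resp (mod-≡ (cong (λ z → s ℤ.+ z) (ℤ.*-identityʳ t)))
    (insert-at R (Realises.chosen R , [] , sym (++-identityʳ _) , mod-refl) R′)

  insert-split : ∀ {J P n s P′ n′ t u} → J u → Realises J P n s → Realises NoSplit P′ n′ t →
    Realises J (P ++ P′) (n + n′) (s ℤ.+ t ℤ.* u)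
  insert-split Ju R = insert-at R (Realises.splits R Ju)

  ignore : ∀ {J P n s} P′ → Realises J P n s → Realises J (P ++ P′) n s
  ignore {n = n} {s} P′ R = realises-size (+-identityʳ n) (realises-resp (mod-≡ (ℤ.+-identityʳ s)) (append R (use-none P′)))

  realises-weaken : ∀ {J J′ P n t} → (∀ {u} → J′ u → J u) → Realises J P n t → Realises J′ P n t
  realises-weaken J′⊆J (realise σ len p∣ eq spl) = realise σ len p∣ eq (spl ∘ J′⊆J)

  AtEnd : ℤ → Set
  AtEnd u = u ≈ 1ℤ ⟨ m ⟩

  at-end : ∀ {P n t} → Realises NoSplit P n t → Realises AtEnd P n t
  at-end (realise {Q} σ len p∣ eq _) = realise σ len p∣ eq λ u≈1 → Q , [] , sym (++-identityʳ Q) , mod-sym u≈1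

  -- Terms with product in ⟨y⟩, treated as a single exponent: ℓ = 1 for single terms, ℓ = p for the
  -- blocks beside an anchor.
  record Item (ℓ : ℕ) : Set where
    constructor item
    field
      elems : List A
      size  : length elems ≡ ℓ
      p∣α   : p ∣ αsum elems

  open Item public using (elems)

  val : ∀ {ℓ} → Item ℓ → ℤ
  val = βval ∘ elems

  pool : ∀ {ℓ} → List (Item ℓ) → List A
  pool = concatMap elems

  pool-↭ : ∀ {ℓ} {as bs : List (Item ℓ)} → as ↭ bs → pool as ↭ pool bs
  pool-↭ = concatMap-↭ elems

  pool-++ : ∀ {ℓ} (as bs : List (Item ℓ)) → pool (as ++ bs) ≡ pool as ++ pool bs
  pool-++ as bs = concatMap-++ elems as bs

  use-item : ∀ {ℓ} (a : Item ℓ) → Realises NoSplit (elems a) ℓ (val a)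
  use-item (item T refl p∣) = use-all T p∣

  use-items : ∀ {ℓ} (as : List (Item ℓ)) → Realises NoSplit (pool as) (length as * ℓ) (total val as)
  use-items [] = use-none []
  use-items {ℓ} (a ∷ as) = append (use-item a) (use-items as)

  use-some : ∀ {ℓ} k (as : List (Item ℓ)) → k ≤ length as → ∃[ t ] Realises NoSplit (pool as) (k * ℓ) t
  use-some k as k≤ with take-↭ k as k≤
  ... | bs , cs , refl , refl = total val bs , realises-↭ (↭-reflexive (pool-++ bs cs)) (ignore (pool cs) (use-items bs))

  use-zeros : ∀ {ℓ} k (as : List (Item ℓ)) → k ≤ length as → All (λ a → val a ≈ 0ℤ ⟨ m ⟩) as → Realises NoSplit (pool as) (k * ℓ) 0ℤ
  use-zeros k as k≤ zs with take-↭ k as k≤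
  ... | bs , cs , refl , refl = realises-↭ (↭-reflexive (pool-++ bs cs)) (ignore (pool cs)
    (realises-resp (mod-trans (total-const val (All.++⁻ˡ bs zs)) (mod-≡ (ℤ.*-zeroʳ (+ length bs)))) (use-items bs)))

  from-zero-sum : ∀ {ℓ k} {as : List (Item ℓ)} → ZeroSum val m k as → Realises NoSplit (pool as) (k * ℓ) 0ℤ
  from-zero-sum (bs , cs , σ , refl , eq) = realises-↭ (↭-trans (pool-↭ σ) (↭-reflexive (pool-++ bs cs)))
    (ignore (pool cs) (realises-resp eq (use-items bs)))

  -- Many values divisible by d: the Erdős–Ginzburg–Ziv theorem in the subgroup d ℤ / m ℤ.
  divisible-case : ∀ {ℓ} d n .{{_ : NonZero n}} → n * d ≡ m → ∀ k (as : List (Item ℓ)) →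
    k * n + n + nonzeros val d as ≤ suc (length as) → Realises NoSplit (pool as) (k * n * ℓ) 0ℤ
  divisible-case {ℓ} d n refl k as many = realises-↭
      (↭-trans (pool-↭ (↭-trans (filter-↭-split (nonzero? val d) as) (++-comm nz z))) (↭-reflexive (pool-++ z nz)))
      (ignore (pool nz) (from-zero-sum (egz-divisible val d n k z (All.map (λ {a} → decided a) (All.all-filter (¬? ∘ nonzero? val d) as)) enough)))
    where
    nz z : List (Item ℓ)
    nz = filter (nonzero? val d) as
    z  = filter (¬? ∘ nonzero? val d) as
    decided : ∀ a → ¬ ¬ val a ≈ 0ℤ ⟨ d ⟩ → val a ≈ 0ℤ ⟨ d ⟩
    decided a = Dec.decidable-stable (mod-≟ (val a) 0ℤ)
    enough : k * n + n ≤ suc (length z)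
    enough = +-cancelʳ-≤ (length nz) _ _ (≤-trans many (≤-reflexive (cong suc
      (trans (filter-length-split (nonzero? val d) as) (+-comm (length nz) (length z))))))

  module _ {ℓ : ℕ} {J : ℤ → Set} {P : List A} where

    snoc-item : ∀ a (G : List (Item ℓ)) n k {t} → Realises J ((P ++ pool G) ++ elems a) (n + k + ℓ) t →
      Realises J (P ++ pool (a ∷ G)) (n + (ℓ + k)) t
    snoc-item a G n k R = realises-↭ (↭-trans (++⁺ˡ P (++-comm (elems a) (pool G))) (↭-reflexive (sym (++-assoc P (pool G) (elems a)))))
      (realises-size (lemma n k ℓ) R)
      where
      lemma : ∀ n k ℓ → n + k + ℓ ≡ n + (ℓ + k)
      lemma = ℕ-solve

    -- Each item c is inserted with multiplier 1 or u, and c u = c + c (u − 1).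
    module _ {u : ℤ} (Ju : J u) where

      twist : Item ℓ → ℤ
      twist a = val a ℤ.* (u ℤ.- 1ℤ)

      open Filling twist 1ℤ 1

      insert-items : ∀ {n s G t} → Realises J P n s → Reach m (0ℤ ∷ []) G t →
        Realises J (P ++ pool G) (n + length G * ℓ) (s ℤ.+ total val G ℤ.+ t)
      insert-items {n} {s} R (base (here t≈0)) = realises-↭ (↭-reflexive (++-identityʳ P)) (realises-size (sym (+-identityʳ n))
        (realises-resp (mod-trans (mod-≡ (lemma s)) (mod-+ˡ (s ℤ.+ 0ℤ) (mod-sym t≈0))) R))
        where
        lemma : ∀ s → s ≡ s ℤ.+ 0ℤ ℤ.+ 0ℤ
        lemma = ℤ-solve
      insert-items {n} {s} R (skip {a} {G} {t} ρ) = snoc-item a G n (length G * ℓ)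
        (realises-resp (mod-≡ (lemma s (val a) (total val G) t)) (append (insert-items R ρ) (use-item a)))
        where
        lemma : ∀ s c v t → s ℤ.+ v ℤ.+ t ℤ.+ c ≡ s ℤ.+ (c ℤ.+ v) ℤ.+ t
        lemma = ℤ-solve
      insert-items {n} {s} R (use {a} {G} {t′} {t} zero _ ρ eq) = snoc-item a G n (length G * ℓ)
        (realises-resp (mod-trans (mod-≡ (lemma s (val a) (total val G) t′ u)) (mod-+ˡ (s ℤ.+ (val a ℤ.+ total val G)) (mod-sym eq)))
            (insert-split Ju (insert-items R ρ) (use-item a)))
        where
        lemma : ∀ s c v t u → s ℤ.+ v ℤ.+ t ℤ.+ c ℤ.* u ≡ s ℤ.+ (c ℤ.+ v) ℤ.+ (t ℤ.+ c ℤ.* (u ℤ.- 1ℤ) ℤ.* 1ℤ)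
        lemma = ℤ-solve
      insert-items R (use (suc j) (s≤s ()) ρ eq)

      nonzeros-twist : IsUnit m (u ℤ.- 1ℤ) → ∀ {d} → d ∣ m → ∀ as → nonzeros twist d as ≡ nonzeros val d as
      nonzeros-twist unit {d} d∣m as = cong length (filter-≐ (nonzero? twist d) (nonzero? val d)
        ((λ nz z → nz (mod-trans (mod-*ʳ (u ℤ.- 1ℤ) z) (mod-≡ (ℤ.*-zeroˡ (u ℤ.- 1ℤ))))) ,
         (λ nz z → nz (unit-cancel (unit-weaken d∣m unit) z))) as)

      -- All of `G` is used whatever t is, since only positions vary; so the length does not depend
      -- on t and no zeros are needed. As at most m - 1 ≤ k items lie in `G`, the others can make up
      -- the number k, and their sum is absorbed into the target.
      twisted-case : ∀ {n s} → IsUnit m (u ℤ.- 1ℤ) → Realises J P n s → ∀ k as → m ≤ suc k → k ≤ length as →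
        (∀ {d} → d ∣ m → 1 < d → d ≤ suc (nonzeros val d as)) → ∀ t → Realises J (P ++ pool as) (n + k * ℓ) t
      twisted-case {n} {s} unit R k as m≤ k≤ many t = finish
        (fill-zero trivial-root as many′
          (subst (m ≤_) (sym (*-identityˡ _)) (small-modulus m (many-twist ∣-refl))))
        where
        many-twist : ∀ {d} → d ∣ m → 1 < d → d ≤ suc (nonzeros twist d as)
        many-twist {d} d∣m 1<d = subst (λ z → d ≤ suc z) (sym (nonzeros-twist unit d∣m as)) (many d∣m 1<d)
        many′ : ∀ {d} → d ∣ m → 1 < d → d < m → d ≤ 1 * suc (nonzeros twist d as)
        many′ {d} d∣m 1<d _ = subst (d ≤_) (sym (*-identityˡ _)) (many-twist d∣m 1<d)
        lemma : ∀ s v t t′ → s ℤ.+ v ℤ.+ (t ℤ.- s ℤ.- v ℤ.- t′) ℤ.+ t′ ≡ t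
        lemma = ℤ-solve
        finish : Filled m (0ℤ ∷ []) as → Realises J (P ++ pool as) (n + k * ℓ) t
        finish (G , F , σ , small , full) = build (use-some (k ∸ length G) F
            (m≤n+o⇒m∸n≤o _ _ (≤-trans k≤ (≤-reflexive (trans (↭-length σ) (length-++ G))))))
          where
          G≤k : length G ≤ k
          G≤k = ≤-pred (≤-trans (subst (λ z → suc z ≤ m) (*-identityˡ (length G)) small) m≤)
          sizes : n + length G * ℓ + (k ∸ length G) * ℓ ≡ n + k * ℓ
          sizes = trans (+-assoc n _ _) (cong (λ z → n + z) (trans (sym (*-distribʳ-+ ℓ (length G) (k ∸ length G))) (cong (_* ℓ) (m+[n∸m]≡n G≤k))))
          build : ∃[ t ] Realises NoSplit (pool F) ((k ∸ length G) * ℓ) t → Realises J (P ++ pool as) (n + k * ℓ) t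
          build (t′ , R′) = realises-↭ (++⁺ˡ P (↭-trans (pool-↭ σ) (↭-reflexive (pool-++ G F))))
            (realises-↭ (↭-reflexive (sym (++-assoc P (pool G) (pool F)))) (realises-size sizes
              (realises-resp (mod-≡ (lemma s (total val G) t t′))
                (append (insert-items R (full (t ℤ.- s ℤ.- total val G ℤ.- t′))) R′))))

    module _ {r′ : ℤ} {w : ℕ} (Jr′ : ∀ {j} → j < w → J (r′ ℤ.^ j)) {X : List ℤ} {n D : ℕ} {o : ℤ} where

      open Filling (val {ℓ}) r′ w

      -- Here skipped items are left out of the product. The numbers i and k tell how much was used,
      -- so that the shortfall can be made up with terms of value 0.
      drop-items : (∀ {t} → t ∈ X ⟨ m ⟩ → ∃[ i ] (i ≤ D × Realises J P (n + i) (o ℤ.+ t))) → ∀ {G t} → Reach m X G t →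
        ∃[ i ] ∃[ k ] (i ≤ D × k ≤ length G × Realises J (P ++ pool G) (n + i + k * ℓ) (o ℤ.+ t))
      drop-items start (base t∈X) with start t∈X
      ... | i , i≤ , R = i , 0 , i≤ , z≤n , realises-↭ (↭-reflexive (++-identityʳ P)) (realises-size (sym (+-identityʳ (n + i))) R)
      drop-items start (skip {a} {G} ρ) with drop-items start ρ
      ... | i , k , i≤ , k≤ , R = i , k , i≤ , m≤n⇒m≤1+n k≤ , realises-↭ (++⁺ˡ P (++-comm (elems a) (pool G)))
        (realises-↭ (↭-reflexive (sym (++-assoc P (pool G) (elems a)))) (ignore (elems a) R))
      drop-items start (use {a} {G} {s} j j<w ρ eq) with drop-items start ρ
      ... | i , k , i≤ , k≤ , R = i , suc k , i≤ , s≤s k≤ , snoc-item a G (n + i) (k * ℓ)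
        (realises-resp (mod-trans (mod-≡ (ℤ.+-assoc o s _)) (mod-+ˡ o (mod-sym eq))) (insert-split (Jr′ j<w) R (use-item a)))

-- Zero-sum pieces and their rotations

module Pieces (p m : ℕ) (r : ℤ) .{{_ : NonZero p}} .{{_ : NonZero m}} (rᵖ≈1 : r ℤ.^ p ≈ 1ℤ ⟨ m ⟩)
  (r-units : ∀ {n} → ¬ p ∣ n → IsUnit m (r ℤ.^ n ℤ.- 1ℤ)) {A : Set} (α : A → ℕ) (β : A → ℤ) where

  open Metacyclic p m r rᵖ≈1 r-units α β

  -- Only consecutive segments are tested. This suffices, since differences of suffix sums, like
  -- those between cut points, are sums of consecutive segments.
  data ZeroFree : List A → Set where
    []  : ZeroFree []
    _∷_ : ∀ {a T} → (∀ T₁ T₂ → T ≡ T₁ ++ T₂ → ¬ p ∣ α a + αsum T₁) → ZeroFree T → ZeroFree (a ∷ T)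

  zeroFree-++ˡ : ∀ T₁ {T₂} → ZeroFree (T₁ ++ T₂) → ZeroFree T₁
  zeroFree-++ˡ []       _        = []
  zeroFree-++ˡ (a ∷ T₁) {T₂} (h ∷ z) = (λ S₁ S₂ eq → h S₁ (S₂ ++ T₂) (trans (cong (_++ T₂) eq) (++-assoc S₁ S₂ T₂))) ∷ zeroFree-++ˡ T₁ z

  zeroFree-++ʳ : ∀ T₁ {T₂} → ZeroFree (T₁ ++ T₂) → ZeroFree T₂
  zeroFree-++ʳ []       z       = z
  zeroFree-++ʳ (_ ∷ T₁) (_ ∷ z) = zeroFree-++ʳ T₁ z

  -- With l terms in all, `rest` has l cut points, and no two of them differ by a multiple of p in
  -- α. These give the l rotations.
  record Piece : Set where
    field
      first    : A
      rest     : List A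
      zeroFree : ZeroFree rest
      p∣α      : p ∣ α first + αsum rest

    terms : List A
    terms = first ∷ rest

  open Piece public

  zero-prefix : ∀ k T → (∃[ T₁ ] ∃[ T₂ ] (T ≡ T₁ ++ T₂ × p ∣ k + αsum T₁)) ⊎
    (∀ T₁ T₂ → T ≡ T₁ ++ T₂ → ¬ p ∣ k + αsum T₁)
  zero-prefix k T with p ∣? k + 0
  ... | yes p∣k = inj₁ ([] , T , refl , p∣k)
  zero-prefix k [] | no p∤k = inj₂ λ { [] _ _ → p∤k }
  zero-prefix k (a ∷ T) | no p∤k with zero-prefix (k + α a) T
  ... | inj₁ (T₁ , T₂ , refl , p∣) = inj₁ (a ∷ T₁ , T₂ , refl , subst (p ∣_) (+-assoc k (α a) _) p∣)
  ... | inj₂ none = inj₂ λ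
    { []       _  _    → p∤k
    ; (_ ∷ T₁) T₂ refl → λ p∣ → none T₁ T₂ refl (subst (p ∣_) (sym (+-assoc k (α a) _)) p∣) }

  -- When a new term closes a segment of sum 0 modulo p with an initial part of the zero-free list,
  -- that segment is split off as a piece; the parts of a zero-free list are zero-free.
  extract : ∀ W → ∃[ Ts ] ∃[ W′ ] (W ↭ concatMap terms Ts ++ W′ × ZeroFree W′)
  extract [] = [] , [] , ↭-refl , []
  extract (a ∷ W) with extract W
  ... | Ts , W′ , σ , z with zero-prefix (α a) W′
  ...   | inj₂ none = Ts , a ∷ W′ , ↭-trans (prep a σ) (↭-sym (shift a (concatMap terms Ts) W′)) , none ∷ z
  ...   | inj₁ (T₁ , T₂ , refl , p∣) = record { first = a ; rest = T₁ ; zeroFree = zeroFree-++ˡ T₁ z ; p∣α = p∣ } ∷ Ts , T₂ ,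
    prep a (↭-trans σ (↭-trans (shifts (concatMap terms Ts) T₁) (↭-reflexive (sym (++-assoc T₁ _ T₂))))) ,
    zeroFree-++ʳ T₁ z

  suffixSums : List A → List ℤ
  suffixSums []      = 0ℤ ∷ []
  suffixSums (a ∷ T) = + αsum (a ∷ T) ∷ suffixSums T

  suffixSums-all : ∀ {Q : ℤ → Set} T → (∀ T₁ T₂ → T ≡ T₁ ++ T₂ → Q (+ αsum T₂)) → All Q (suffixSums T)
  suffixSums-all []      h = h [] [] refl ∷ []
  suffixSums-all (a ∷ T) h = h [] (a ∷ T) refl ∷ suffixSums-all T λ T₁ T₂ eq → h (a ∷ T₁) T₂ (cong (a ∷_) eq)

  suffixSums-distinct : ∀ {T} → ZeroFree T → Distinct p (suffixSums T)
  suffixSums-distinct [] = [] ∷ []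
  suffixSums-distinct {a ∷ T} (h ∷ z) = suffixSums-all T (λ { T₁ T₂ refl eq → h T₁ T₂ refl
      (≈0⇒∣ (subst (_≈ 0ℤ ⟨ p ⟩) (difference (α a) (αsum T₁) (αsum T₂) (αsum-++ T₁ T₂)) (difference-mod eq))) })
    ∷ suffixSums-distinct z
    where
    difference : ∀ a s t {n} → n ≡ s + t → + (a + n) ℤ.- + t ≡ + (a + s)
    difference a s t refl = lemma (+ a) (+ s) (+ t)
      where
      lemma : ∀ a s t → (a ℤ.+ (s ℤ.+ t)) ℤ.- t ≡ a ℤ.+ s
      lemma = ℤ-solve

  -- The suffix sums, including the empty one, are pairwise incongruent modulo p.
  zeroFree-length : ∀ {T} → ZeroFree T → length T < p
  zeroFree-length {T} z = ≤-trans (≤-reflexive (sym (lengths T))) (distinct-length≤ (suffixSums-distinct z))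
    where
    lengths : ∀ T → length (suffixSums T) ≡ suc (length T)
    lengths []      = refl
    lengths (_ ∷ T) = cong suc (lengths T)

  -- Rotating is conjugating by the product of `S₁`, which multiplies the exponent of y by r^(αsum
  -- S₁).
  rotate : ∀ S₁ S₂ → p ∣ αsum (S₁ ++ S₂) →
    Realises NoSplit (S₁ ++ S₂) (length (S₁ ++ S₂)) (βval (S₁ ++ S₂) ℤ.* r ℤ.^ αsum S₁)
  rotate S₁ S₂ p∣ = realise {chosen = S₂ ++ S₁} {others = []} (↭-trans σ (↭-reflexive (sym (++-identityʳ (S₂ ++ S₁)))))
    (sym (↭-length σ)) (subst (p ∣_) (αsum-↭ σ) p∣) value (λ ())
    where
    σ = ++-comm S₁ S₂
    open SetoidReasoning (modSetoid m)
    lemma : ∀ b u c v → (b ℤ.* u ℤ.+ c) ℤ.* v ≡ b ℤ.* (u ℤ.* v) ℤ.+ c ℤ.* v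
    lemma = ℤ-solve
    p∣′ : p ∣ αsum S₂ + αsum S₁
    p∣′ = subst (p ∣_) (trans (αsum-↭ σ) (αsum-++ S₂ S₁)) p∣
    value : βval (S₂ ++ S₁) ≈ βval (S₁ ++ S₂) ℤ.* r ℤ.^ αsum S₁ ⟨ m ⟩
    value = begin
      βval (S₂ ++ S₁) ≡⟨ βval-++ S₂ S₁ ⟩
      βval S₂ ℤ.* r ℤ.^ αsum S₁ ℤ.+ βval S₁ ≡⟨ ℤ.+-comm _ (βval S₁) ⟩
      βval S₁ ℤ.+ βval S₂ ℤ.* r ℤ.^ αsum S₁ ≡⟨ cong (ℤ._+ βval S₂ ℤ.* r ℤ.^ αsum S₁) (ℤ.*-identityʳ (βval S₁)) ⟨
      βval S₁ ℤ.* 1ℤ ℤ.+ βval S₂ ℤ.* r ℤ.^ αsum S₁ ≈⟨ mod-+ʳ _ (mod-*ˡ (βval S₁) (r-periodic p∣′)) ⟨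
      βval S₁ ℤ.* r ℤ.^ (αsum S₂ + αsum S₁) ℤ.+ βval S₂ ℤ.* r ℤ.^ αsum S₁
        ≡⟨ cong (λ z → βval S₁ ℤ.* z ℤ.+ βval S₂ ℤ.* r ℤ.^ αsum S₁) (ℤ.^-distribˡ-+-* r (αsum S₂) (αsum S₁)) ⟩
      βval S₁ ℤ.* (r ℤ.^ αsum S₂ ℤ.* r ℤ.^ αsum S₁) ℤ.+ βval S₂ ℤ.* r ℤ.^ αsum S₁
        ≡⟨ lemma (βval S₁) (r ℤ.^ αsum S₂) (βval S₂) (r ℤ.^ αsum S₁) ⟨
      (βval S₁ ℤ.* r ℤ.^ αsum S₂ ℤ.+ βval S₂) ℤ.* r ℤ.^ αsum S₁ ≡⟨ cong (ℤ._* r ℤ.^ αsum S₁) (βval-++ S₁ S₂) ⟨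
      βval (S₁ ++ S₂) ℤ.* r ℤ.^ αsum S₁ ∎

  r^-unit : ∀ k → IsUnit m (r ℤ.^ k)
  r^-unit k = r ℤ.^ (k * ℕ.pred p) , mod-trans (mod-≡ (sym (ℤ.^-distribˡ-+-* r (k * ℕ.pred p) k)))
    (r-periodic (ℕ.divides k (trans (+-comm (k * ℕ.pred p) k) (trans (sym (*-suc k (ℕ.pred p))) (cong (k *_) (suc-pred p))))))

  Associate : ℤ → ℤ → Set
  Associate c v = ∃[ u ] (IsUnit m u × v ≈ c ℤ.* u ⟨ m ⟩)

  associate-generates : ∀ {c v} → Associate c v → Generates {m} c v
  associate-generates {c} {v} (u , (w , wu≈1) , v≈) = w , (begin
    c ≡⟨ ℤ.*-identityʳ c ⟨
    c ℤ.* 1ℤ ≈⟨ mod-*ˡ c wu≈1 ⟨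
    c ℤ.* (w ℤ.* u) ≡⟨ lemma c w u ⟩
    w ℤ.* (c ℤ.* u) ≈⟨ mod-*ˡ w v≈ ⟨
    w ℤ.* v ∎)
    where
    open SetoidReasoning (modSetoid m)
    lemma : ∀ c w u → c ℤ.* (w ℤ.* u) ≡ w ℤ.* (c ℤ.* u)
    lemma = ℤ-solve

  associate-nonzero : ∀ {c v} → ¬ c ≈ 0ℤ ⟨ m ⟩ → Associate c v → ¬ v ≈ 0ℤ ⟨ m ⟩
  associate-nonzero c≉0 (u , unit , v≈) v≈0 = c≉0 (unit-cancel unit (mod-trans (mod-sym v≈) v≈0))

  module _ (c : ℤ) where

    rotations : ℕ → List A → List ℤ
    rotations k []      = c ℤ.* r ℤ.^ k ∷ []
    rotations k (a ∷ T) = c ℤ.* r ℤ.^ k ∷ rotations (k + α a) T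

    rotations-all : ∀ {Q : ℤ → Set} k T → (∀ T₁ T₂ → T ≡ T₁ ++ T₂ → Q (c ℤ.* r ℤ.^ (k + αsum T₁))) → All Q (rotations k T)
    rotations-all {Q} k [] h = subst (λ j → Q (c ℤ.* r ℤ.^ j)) (+-identityʳ k) (h [] [] refl) ∷ []
    rotations-all {Q} k (a ∷ T) h = subst (λ j → Q (c ℤ.* r ℤ.^ j)) (+-identityʳ k) (h [] (a ∷ T) refl) ∷
      rotations-all (k + α a) T λ T₁ T₂ eq → subst (λ j → Q (c ℤ.* r ℤ.^ j)) (sym (+-assoc k (α a) (αsum T₁))) (h (a ∷ T₁) T₂ (cong (a ∷_) eq))

    rotations-associate : ∀ k T → All (Associate c) (rotations k T)
    rotations-associate k T = rotations-all k T λ T₁ _ _ → r ℤ.^ (k + αsum T₁) , r^-unit (k + αsum T₁) , mod-refl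

    -- The difference is c r^k (r^n - 1), where n is the sum of a segment and so not divisible by p.
    -- Thus Chowla's theorem also applies to the rotations translated so that the first becomes 0.
    rotations-differences : ∀ k {a T} → ZeroFree (a ∷ T) → All (λ v → Associate c (v ℤ.- c ℤ.* r ℤ.^ k)) (rotations (k + α a) T)
    rotations-differences k {a} {T} (h ∷ _) = rotations-all (k + α a) T λ T₁ T₂ eq →
      r ℤ.^ k ℤ.* (r ℤ.^ (α a + αsum T₁) ℤ.- 1ℤ) , unit-* (r^-unit k) (r-units (h T₁ T₂ eq)) ,
      mod-≡ (trans (cong (λ z → c ℤ.* z ℤ.- c ℤ.* r ℤ.^ k)
        (trans (cong (r ℤ.^_) (+-assoc k (α a) (αsum T₁))) (ℤ.^-distribˡ-+-* r k (α a + αsum T₁))))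
        (lemma c (r ℤ.^ k) (r ℤ.^ (α a + αsum T₁))))
      where
      lemma : ∀ c u v → c ℤ.* (u ℤ.* v) ℤ.- c ℤ.* u ≡ c ℤ.* (u ℤ.* (v ℤ.- 1ℤ))
      lemma = ℤ-solve

    rotations-distinct : ¬ c ≈ 0ℤ ⟨ m ⟩ → ∀ k {T} → ZeroFree T → Distinct m (rotations k T)
    rotations-distinct c≉0 k [] = [] ∷ []
    rotations-distinct c≉0 k {a ∷ T} z@(_ ∷ z′) =
      All.map (λ assoc-diff eq → associate-nonzero c≉0 assoc-diff (difference-mod (mod-sym eq))) (rotations-differences k z)
      ∷ rotations-distinct c≉0 (k + α a) z′

    length-rotations : ∀ k T → length (rotations k T) ≡ suc (length T)
    length-rotations k []      = refl
    length-rotations k (a ∷ T) = cong suc (length-rotations (k + α a) T)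

  value : Piece → ℤ
  value T = βval (terms T)

  -- The cut runs from just behind the first term to the end of the piece; the last cut gives back
  -- the unrotated product, up to congruence.
  values : Piece → List ℤ
  values T = rotations (value T) (α (first T)) (rest T)

  values-realised : ∀ T {v} → v ∈ values T ⟨ m ⟩ → Realises NoSplit (terms T) (length (terms T)) v
  values-realised T {v} v∈ with Membership.find v∈
  ... | v′ , v′∈ , v≈v′ = realises-resp (mod-sym v≈v′) (All.lookup all v′∈)
    where
    all : All (Realises NoSplit (terms T) (length (terms T))) (values T)
    all = rotations-all (value T) (α (first T)) (rest T) λ { T₁ T₂ eq → realisation T₁ T₂ eq }
      where
      realisation : ∀ T₁ T₂ → rest T ≡ T₁ ++ T₂ →
        Realises NoSplit (terms T) (length (terms T)) (value T ℤ.* r ℤ.^ (α (first T) + αsum T₁))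
      realisation T₁ T₂ eq = subst (λ S → p ∣ αsum S → Realises NoSplit S (length S) (βval S ℤ.* r ℤ.^ (α (first T) + αsum T₁)))
        (cong (first T ∷_) (sym eq)) (rotate (first T ∷ T₁) T₂) (p∣α T)

  Within : ℕ → ℕ → List A → ℤ → Set
  Within D n P t = ∃[ i ] (i ≤ D × Realises NoSplit P (n + i) t)

  within-resp : ∀ {D n P s t} → s ≈ t ⟨ m ⟩ → Within D n P s → Within D n P t
  within-resp s≈t (i , i≤ , R) = i , i≤ , realises-resp s≈t R

  -- In the second case some pieces are always used; n₀ is their total length, D that of the optional ones.
  data Outcome (P : List A) (n : ℕ) : Set where
    large  : ∀ L → Distinct m L → 0ℤ ∈ L ⟨ m ⟩ → n < length L →
      (∀ {t} → t ∈ L ⟨ m ⟩ → Within n 0 P t) → Outcome P n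
    stable : ∀ c s n₀ D → ¬ c ≈ 0ℤ ⟨ m ⟩ → n₀ + D ≡ n → D < m →
      (∀ k → Within D n₀ P (s ℤ.+ k ℤ.* c)) → Outcome P n

  -- In the `large` case the set must gain the length l of the new piece to stay ahead of the number
  -- of terms. Once `stable` holds, further pieces are always used, so the optional length D does
  -- not increase.
  outcome-add : ∀ T {P n} → ¬ value T ≈ 0ℤ ⟨ m ⟩ → Outcome P n → Outcome (terms T ++ P) (length (terms T) + n)
  outcome-add T {P} {n} _ (stable c s n₀ D c≉0 refl D<m f) = stable c (s ℤ.+ value T) (length (terms T) + n₀) D c≉0
    (+-assoc (length (terms T)) n₀ D) D<m λ k → add k (f k)
    where
    sizes : ∀ l n i → n + i + l ≡ l + n + i
    sizes = ℕ-solve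
    add : ∀ k → Within D n₀ P (s ℤ.+ k ℤ.* c) →
      ∃[ i ] (i ≤ D × Realises NoSplit (terms T ++ P) (length (terms T) + n₀ + i) (s ℤ.+ value T ℤ.+ k ℤ.* c))
    add k (i , i≤ , R) = i , i≤ , realises-↭ (++-comm (terms T) P) (realises-size (sizes (length (terms T)) n₀ i)
      (realises-resp (mod-≡ (+-right-comm s (k ℤ.* c) (value T))) (append R (use-all (terms T) (p∣α T)))))
  outcome-add T {P} {n} c≉0 (large L L! 0∈L n<L f) = by-chowla
    (chowla V (zero∉V ∷ V!) (All.map associate-generates (rotations-associate c (α (first T)) (rest T))) L L!)
    where
    c = value T
    l = length (terms T)
    V = values T
    V! : Distinct m V
    V! = rotations-distinct c c≉0 (α (first T)) (zeroFree T)
    zero∉V : All (λ v → ¬ 0ℤ ≈ v ⟨ m ⟩) V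
    zero∉V = All.map (λ ass 0≈v → associate-nonzero c≉0 ass (mod-sym 0≈v)) (rotations-associate c (α (first T)) (rest T))
    length-V : length V ≡ l
    length-V = length-rotations c (α (first T)) (rest T)
    n<m : n < m
    n<m = ≤-trans n<L (distinct-length≤ L!)

    forced : ∀ {s v} → s ∈ L ⟨ m ⟩ → v ∈ V ⟨ m ⟩ → Within n l (terms T ++ P) (s ℤ.+ v)
    forced s∈L v∈V with f s∈L
    ... | i , i≤ , R = i , i≤ , realises-↭ (++-comm (terms T) P) (realises-size (+-comm i l) (append R (values-realised T v∈V)))

    optional : ∀ {t} → SumSet {m} L (0ℤ ∷ V) t → Within (l + n) 0 (terms T ++ P) t
    optional {t} (s , v , s∈L , there v∈V , t≈) = used (forced {s} {v} s∈L v∈V)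
      where
      used : Within n l (terms T ++ P) (s ℤ.+ v) → Within (l + n) 0 (terms T ++ P) t
      used (i , i≤ , R) = l + i , +-monoʳ-≤ l i≤ , realises-resp (mod-sym t≈) R
    optional {t} (s , v , s∈L , here v≈0 , t≈) = unused (f s∈L)
      where
      s≈t : s ≈ t ⟨ m ⟩
      s≈t = mod-sym (mod-trans t≈ (mod-trans (mod-+ˡ s v≈0) (mod-≡ (ℤ.+-identityʳ s))))
      unused : Within n 0 P s → Within (l + n) 0 (terms T ++ P) t
      unused (i , i≤ , R) = i , m≤n⇒m≤o+n l i≤ , realises-↭ (++-comm (terms T) P) (ignore (terms T) (realises-resp s≈t R))

    grown : ∀ N → Distinct m N → l + n < length N → (∀ {t} → t ∈ N ⟨ m ⟩ → SumSet {m} L (0ℤ ∷ V) t) → Outcome (terms T ++ P) (l + n)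
    grown N N! len N⊆ with mod-∈? 0ℤ N
    ... | yes 0∈N = large N N! 0∈N len (optional ∘ N⊆)
    ... | no 0∉N = large (0ℤ ∷ N) (∉⇒All≉ N 0∉N ∷ N!) (here mod-refl) (m≤n⇒m≤1+n len)
      λ { (here t≈0) → optional (0ℤ , 0ℤ , 0∈L , here mod-refl , t≈0) ; (there t∈) → optional (N⊆ t∈) }

    Forced : ℤ → Set
    Forced t = ∃[ s ] ∃[ v ] (s ∈ L ⟨ m ⟩ × v ∈ V ⟨ m ⟩ × t ≈ s ℤ.+ v ⟨ m ⟩)

    -- Using the new piece always keeps the optional length at n, which is below m because `L` has
    -- more than n elements. Were the piece optional, the length would be l + n, which need not be
    -- below m.
    stuck : ∀ s → (∀ k → Forced (s ℤ.+ k ℤ.* c)) → Outcome (terms T ++ P) (l + n)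
    stuck s h = stable c s l n c≉0 refl n<m λ k → realised (h k)
      where
      realised : ∀ {t} → Forced t → Within n l (terms T ++ P) t
      realised (s , v , s∈ , v∈ , t≈) = within-resp (mod-sym t≈) (forced {s} {v} s∈ v∈)

    -- When L + ({0} ∪ V) is a union of cosets, compare it with L + V.
    sticky : Cosets {m} c L V →
      ∀ v₀ V′ → V ≡ v₀ ∷ V′ → All (λ v → Associate c (v ℤ.- v₀)) V′ → Outcome (terms T ++ P) (l + n)
    sticky cosets v₀ V′ V≡ diffs = compare (chowla B B! (All.map⁺ (All.map associate-generates diffs)) L L!)
      where
      B = map (λ v → v ℤ.- v₀) V′
      v₀∈V : v₀ ∈ V ⟨ m ⟩
      v₀∈V = subst (v₀ ∈_⟨ m ⟩) (sym V≡) (here mod-refl)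
      V′⊆V : ∀ {v} → v ∈ V′ ⟨ m ⟩ → v ∈ V ⟨ m ⟩
      V′⊆V {v} v∈ = subst (v ∈_⟨ m ⟩) (sym V≡) (there v∈)
      B! : Distinct m (0ℤ ∷ B)
      B! = All.map⁺ (All.map (λ ass 0≈ → associate-nonzero c≉0 ass (mod-sym 0≈)) diffs) ∷
        AllPairs.map⁺ (AllPairs.map (λ ≉ ≈ → ≉ (mod-+-cancelʳ (ℤ.- v₀) ≈)) (AllPairs.tail (subst (Distinct m) V≡ V!)))
      translate : ∀ {t} → SumSet {m} L (0ℤ ∷ B) t → Forced (t ℤ.+ v₀)
      translate (s , b , s∈L , here b≈0 , t≈) = s , v₀ , s∈L , v₀∈V , mod-+ʳ v₀ (mod-trans t≈ (mod-trans (mod-+ˡ s b≈0) (mod-≡ (ℤ.+-identityʳ s))))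
      translate {t} (s , b , s∈L , there b∈ , t≈) with Membership.find (Any.map⁻ b∈)
      ... | v , v∈ , b≈ = s , v , s∈L , V′⊆V (Any.map mod-≡ v∈) , mod-trans (mod-+ʳ v₀ (mod-trans t≈ (mod-+ˡ s b≈))) (mod-≡ (lemma s v v₀))
        where
        lemma : ∀ s v w → s ℤ.+ (v ℤ.- w) ℤ.+ w ≡ s ℤ.+ v
        lemma = ℤ-solve
      forced⊆ : ∀ {t} → Forced t → SumSet {m} L (0ℤ ∷ V) t
      forced⊆ (s , v , s∈ , v∈ , t≈) = s , v , s∈ , there v∈ , t≈
      length-V′ : suc (length V′) ≡ l
      length-V′ = trans (sym (cong length V≡)) length-V
      compare : Grows {m} L B ⊎ Cosets {m} c L B → Outcome (terms T ++ P) (l + n)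
      compare (inj₂ cosets′) = stuck (0ℤ ℤ.+ v₀) λ k → subst Forced (lemma (k ℤ.* c) v₀) (translate (cosets′ k 0∈L))
        where
        lemma : ∀ u v → 0ℤ ℤ.+ u ℤ.+ v ≡ 0ℤ ℤ.+ v ℤ.+ u
        lemma = ℤ-solve
      compare (inj₁ (N , N! , len-N , N⊆)) = decide (All.all? (λ s → All.all? (λ v → mod-∈? (s ℤ.+ v) N′) (0ℤ ∷ V)) L)
        where
        N′ = map (ℤ._+ v₀) N
        N′! : Distinct m N′
        N′! = AllPairs.map⁺ (AllPairs.map (λ ≉ ≈ → ≉ (mod-+-cancelʳ v₀ ≈)) N!)
        N′⊆ : ∀ {t} → t ∈ N′ ⟨ m ⟩ → Forced t
        N′⊆ t∈ with Membership.find (Any.map⁻ t∈)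
        ... | t′ , t′∈ , t≈ with translate (N⊆ (Any.map mod-≡ t′∈))
        ...   | s , v , s∈ , v∈ , e = s , v , s∈ , v∈ , mod-trans t≈ e
        len-N′ : suc (length N′) ≡ l + length L
        len-N′ = trans (cong suc (trans (length-map (ℤ._+ v₀) N) (trans len-N (trans (cong (λ z → length L + z) (length-map _ V′)) (+-comm (length L) _)))))
          (cong (_+ length L) length-V′)
        decide : Dec (All (λ s → All (λ v → (s ℤ.+ v) ∈ N′ ⟨ m ⟩) (0ℤ ∷ V)) L) → Outcome (terms T ++ P) (l + n)
        -- All of L + ({0} ∪ V) lies in N′, hence in L + V, so the cosets consist of values that use
        -- the piece.
        decide (yes inside) = stuck 0ℤ λ k → covered (cosets k 0∈L)
          where
          covered : ∀ {t} → SumSet {m} L (0ℤ ∷ V) t → Forced t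
          covered (s , v , s∈ , v∈ , t≈) with Membership.find s∈ | Membership.find v∈
          ... | s′ , s′∈ , s≈ | v′ , v′∈ , v≈ = N′⊆ (∈-resp-≈ (mod-sym (mod-trans t≈ (mod-+ s≈ v≈))) (All.lookup (All.lookup inside s′∈) v′∈))
        -- Leaving out 0 cost one element in the count of N′; an element of the larger sumset
        -- outside N′ makes up for it.
        decide (no outside) with Membership.find (All.¬All⇒Any¬ (λ s → All.all? (λ v → mod-∈? (s ℤ.+ v) N′) (0ℤ ∷ V)) L outside)
        ... | s , s∈ , ¬all with Membership.find (All.¬All⇒Any¬ (λ v → mod-∈? (s ℤ.+ v) N′) (0ℤ ∷ V) ¬all)
        ...   | v , v∈ , ∉N′ = grown (s ℤ.+ v ∷ N′) (∉⇒All≉ N′ ∉N′ ∷ N′!)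
          (≤-trans (≤-reflexive (sym (+-suc l n))) (≤-trans (+-monoʳ-≤ l n<L) (≤-reflexive (sym len-N′))))
          λ { (here t≈) → s , v , Any.map mod-≡ s∈ , Any.map mod-≡ v∈ , t≈ ; (there t∈) → forced⊆ (N′⊆ t∈) }

    by-chowla : Grows {m} L V ⊎ Cosets {m} c L V → Outcome (terms T ++ P) (l + n)
    by-chowla (inj₁ (N , N! , len-N , N⊆)) = grown N N! (≤-trans (≤-reflexive (sym (+-suc l n)))
      (≤-trans (+-monoʳ-≤ l n<L) (≤-reflexive (trans (cong (_+ length L) (sym length-V)) (trans (+-comm (length V) (length L)) (sym len-N)))))) N⊆
    by-chowla (inj₂ cosets) = split (rest T) refl
      where
      split : ∀ S → rest T ≡ S → Outcome (terms T ++ P) (l + n)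
      split [] eq = sticky cosets _ [] (cong (rotations c (α (first T))) eq) []
      split (a ∷ S) eq = sticky cosets _ (rotations c (α (first T) + α a) S) (cong (rotations c (α (first T))) eq)
        (rotations-differences c (α (first T)) (subst ZeroFree eq (zeroFree T)))

  outcome : ∀ Ts → All (λ T → ¬ value T ≈ 0ℤ ⟨ m ⟩) Ts → Outcome (concatMap terms Ts) (length (concatMap terms Ts))
  outcome [] [] = large (0ℤ ∷ []) ([] ∷ []) (here mod-refl) (s≤s z≤n)
    λ { (here t≈0) → 0 , z≤n , realises-resp (mod-sym t≈0) (use-none []) }
  outcome (T ∷ Ts) (nz ∷ nzs) = subst (Outcome _) (sym (length-++ (terms T) {concatMap terms Ts})) (outcome-add T nz (outcome Ts nzs))

  module _ {X : List ℤ} {P : List A} {n D : ℕ} {o : ℤ} where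

    open Filling (val {1}) 1ℤ 1

    add-singles : (∀ {t} → t ∈ X ⟨ m ⟩ → Within D n P (o ℤ.+ t)) → ∀ {G t} → Reach m X G t → Within (D + length G) n (P ++ pool G) (o ℤ.+ t)
    add-singles start {G} {t} ρ = collect (drop-items {J = AtEnd} {r′ = 1ℤ} {w = 1} (λ {j} _ → mod-≡ (ℤ.^-zeroˡ j)) {o = o} (at-end′ ∘ start) ρ)
      where
      at-end′ : ∀ {t} → Within D n P t → ∃[ i ] (i ≤ D × Realises AtEnd P (n + i) t)
      at-end′ (i , i≤ , R) = i , i≤ , at-end R
      collect : ∃[ i ] ∃[ k ] (i ≤ D × k ≤ length G × Realises AtEnd (P ++ pool G) (n + i + k * 1) (o ℤ.+ t)) →
        Within (D + length G) n (P ++ pool G) (o ℤ.+ t)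
      collect (i , k , i≤ , k≤ , R) = i + k , +-mono-≤ i≤ k≤ , realises-weaken (λ ())
        (realises-size (trans (cong (λ z → n + i + z) (*-identityʳ k)) (+-assoc n i k)) R)

  -- In the `stable` case multiples of d = gcd(c, m) come for free, so the single terms need only
  -- fill ℤ/d. They number at most d - 1, and n + d ≤ m keeps the optional total below m; if d = 1,
  -- none is used.
  outcome-fill : ∀ {P n} → Outcome P n → (as : List (Item 1)) →
    (∀ {d} → d ∣ m → 1 < d → d < m → d ≤ suc (nonzeros val d as) × n + d ≤ m) → m ≤ n + nonzeros val m as →
    ∃[ n₀ ] ∃[ D ] ∃[ G ] ∃[ R ] (as ↭ G ++ R × n₀ + D ≡ n × D + length G < m ×
      (∀ t → Within (D + length G) n₀ (P ++ pool G) t))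
  outcome-fill {P} {n} (large L L! 0∈L n<L f) as proper many = finish
    (fill trivial-root L L! 0∈L (λ {t} t∈L → subst (_∈ L ⟨ m ⟩) (sym (ℤ.*-identityʳ t)) t∈L) as
      (λ {d} d∣m 1<d d<m → subst (d ≤_) (sym (*-identityˡ _)) (proj₁ (proper d∣m 1<d d<m)))
      (≤-trans (s≤s many) (≤-trans (+-mono-≤ n<L (n≤1+n _)) (≤-reflexive (cong (λ z → length L + z) (sym (*-identityˡ _)))))))
    where
    open Filling (val {1}) 1ℤ 1
    finish : Filled m L as → _
    finish (G , R , σ , small , full) = 0 , n , G , R , σ , refl ,
      ≤-trans (+-monoˡ-≤ (length G) n<L) (subst (λ z → length L + z ≤ m) (*-identityˡ _) small) ,
      λ t → within-resp (mod-≡ (ℤ.+-identityˡ t)) (add-singles {o = 0ℤ} (λ {t} t∈L → within-resp (mod-≡ (sym (ℤ.+-identityˡ t))) (f t∈L)) (full t))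
  outcome-fill {P} {n} (stable c s n₀ D c≉0 n₀+D≡n D<m f) as proper many = finish
    (fill-zero {m = d} trivial-root as
      (λ {d′} d′∣d 1<d′ d′<d → subst (d′ ≤_) (sym (*-identityˡ _)) (proj₁ (proper (∣-trans d′∣d d∣m) 1<d′ (<-trans d′<d d<m))))
      (subst (d ≤_) (sym (*-identityˡ _)) (small-modulus d (λ 1<d → proj₁ (proper d∣m 1<d d<m)))))
    where
    open Filling (val {1}) 1ℤ 1
    d = ℕ.gcd ℤ.∣ c ∣ m
    d∣m : d ∣ m
    d∣m = ℕ.gcd[m,n]∣n ℤ.∣ c ∣ m
    d<m : d < m
    d<m = ≤∧≢⇒< (∣⇒≤ d∣m) λ d≡m → c≉0 (∣⇒≈0 (subst (_∣ ℤ.∣ c ∣) d≡m (ℕ.gcd[m,n]∣m ℤ.∣ c ∣ m)))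
    instance d≢0 : NonZero d
    d≢0 = ℕ.≢-nonZero λ d≡0 → ℕ.≢-nonZero⁻¹ m (ℕ.gcd[m,n]≡0⇒n≡0 ℤ.∣ c ∣ d≡0)
    multiple : ∃[ k ] + d ≈ k ℤ.* c ⟨ m ⟩
    multiple with bézout ℤ.∣ c ∣ m | sign-cases c
    ... | k , l , e | inj₁ c≡ = k , by-quotient l (trans e (cong (λ z → k ℤ.* z ℤ.+ l ℤ.* + m) (sym c≡)))
    ... | k , l , e | inj₂ c≡ = ℤ.- k , by-quotient l (trans e (cong (λ z → z ℤ.+ l ℤ.* + m) (trans (neg-neg k (+ ℤ.∣ c ∣)) (cong (λ z → ℤ.- k ℤ.* z) (sym c≡)))))
      where
      neg-neg : ∀ k x → k ℤ.* x ≡ ℤ.- k ℤ.* ℤ.- x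
      neg-neg = ℤ-solve
    finish : Filled d (0ℤ ∷ []) as → _
    finish (G , R , σ , small , full) = n₀ , D , G , R , σ , n₀+D≡n , bound (<-cmp d 1) , reached
      where
      small′ : length G < d
      small′ = subst (λ z → suc z ≤ d) (*-identityˡ _) small
      bound : _ → D + length G < m
      bound (tri< d<1 _ _) = contradiction (n<1⇒n≡0 d<1) (ℕ.≢-nonZero⁻¹ d)
      bound (tri≈ _ d≡1 _) = subst (_< m) (sym (trans (cong (λ z → D + z) (n<1⇒n≡0 (subst (length G <_) d≡1 small′))) (+-identityʳ D))) D<m
      bound (tri> _ _ 1<d) = ≤-trans (≤-trans (≤-reflexive (sym (+-suc D (length G)))) (+-mono-≤ (subst (D ≤_) n₀+D≡n (m≤n+m D n₀)) small′)) (proj₂ (proper d∣m 1<d d<m))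
      reached : ∀ t → Within (D + length G) n₀ (P ++ pool G) t
      reached t = lifted (reach-lift {m = m} (here mod-refl) (full (t ℤ.- s)))
        where
        lifted : ∃[ x ] (Reach m (0ℤ ∷ []) G x × t ℤ.- s ≈ x ⟨ d ⟩) → _
        -- The error t - s - x left by working modulo d equals q d, and d ≡ k c, so the coset of c
        -- is entered at the multiple q k.
        lifted (x , ρ , congruent (divides q e)) = within-resp back (add-singles {X = 0ℤ ∷ []} {o = s ℤ.+ (q ℤ.* k) ℤ.* c}
            (λ { (here u≈0) → within-resp (mod-sym (mod-trans (mod-+ˡ (s ℤ.+ (q ℤ.* k) ℤ.* c) u≈0) (mod-≡ (ℤ.+-identityʳ _)))) (f (q ℤ.* k)) }) ρ)
          where
          k = proj₁ multiple
          back : s ℤ.+ (q ℤ.* k) ℤ.* c ℤ.+ x ≈ t ⟨ m ⟩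
          back = begin
            s ℤ.+ (q ℤ.* k) ℤ.* c ℤ.+ x ≡⟨ cong (λ z → s ℤ.+ z ℤ.+ x) (ℤ.*-assoc q k c) ⟩
            s ℤ.+ q ℤ.* (k ℤ.* c) ℤ.+ x ≈⟨ mod-+ʳ x (mod-+ˡ s (mod-*ˡ q (proj₂ multiple))) ⟨
            s ℤ.+ q ℤ.* + d ℤ.+ x ≡⟨ cong (λ z → s ℤ.+ z ℤ.+ x) e ⟨
            s ℤ.+ (t ℤ.- s ℤ.- x) ℤ.+ x ≡⟨ lemma s t x ⟩
            t ∎
            where
            open SetoidReasoning (modSetoid m)
            lemma : ∀ s t x → s ℤ.+ (t ℤ.- s ℤ.- x) ℤ.+ x ≡ t
            lemma = ℤ-solve

-- Sequences with an anchor

-- In the following inequalities p = q + 1, and n and d are complementary divisors of m.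
few-outside : ∀ {p m h k} → p * m + m + p ≤ 2 + (h + k) → k < p → p * m + m + 0 ≤ suc h
few-outside {p} {m} {h} {k} S k<p = ≤-by (+-mono-≤ S k<p) 0 (eq p m h k)
  where
  eq : ∀ p m h k → p * m + m + 0 + (2 + (h + k) + p) + 0 ≡ suc h + (p * m + m + p + suc k)
  eq = ℕ-solve

-- At the threshold this is an equality: besides the anchor there are pm + m - 2 = (pe + e) p + p -
-- 1 terms.
blocks-bound : ∀ {p m e s} → m ≡ suc (p * e) → p * m + m + p ≤ 2 + (p + s) → (p * e + e) * p + p ≤ suc s
blocks-bound {p} {_} {e} {s} refl S = ≤-by S 0 (eq p e s)
  where
  eq : ∀ p e s → (p * e + e) * p + p + (2 + (p + s)) + 0 ≡ suc s + (p * suc (p * e) + suc (p * e) + p)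
  eq = ℕ-solve

many-blocks : ∀ {p m e b n z} → m ≡ suc (p * e) → b ≡ p * e + e → suc b < 1 * m + n + z → suc e ≤ n + z
many-blocks {p} {_} {e} {_} {n} {z} refl refl H = ≤-by H 0 (eq p e n z)
  where
  eq : ∀ p e n z → suc e + (1 * suc (p * e) + n + z) + 0 ≡ n + z + (suc (suc (p * e + e)))
  eq = ℕ-solve

weighted-bound : ∀ {q m e n d z} → m ≡ suc (suc q * e) → n * d ≡ m → suc q ≤ d → 1 ≤ n → suc e ≤ n + z → d ≤ suc q * suc z
weighted-bound {q} {_} {e} {suc ν} {d} {z} refl nd p≤d _ H with m≤n⇒∃[o]m+o≡n p≤d
... | δ , refl = ≤-by (+-mono-≤ (*-monoʳ-≤ (suc q) H) (≤-reflexive nd)) (q + ν * δ) (eq q e ν δ z)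
  where
  eq : ∀ q e ν δ z → suc q + δ + (suc q * (suc ν + z) + suc (suc q * e)) + (q + ν * δ) ≡ suc q * suc z + (suc q * suc e + suc ν * (suc q + δ))
  eq = ℕ-solve

-- It suffices that (n - p)(d - p) ≥ (p - 1)², and both factors are at least p - 1. This is why
-- divisors must be at least 2p - 1.
unweighted-bound : ∀ {q m e n d z} → m ≡ suc (suc q * e) → n * d ≡ m → suc q + suc q ≤ suc d → suc q + suc q ≤ suc n →
  suc e ≤ n + z → d ≤ suc z
unweighted-bound {q} {_} {e} {n} {d} {z} refl nd 2p≤d 2p≤n H with m≤n⇒∃[o]m+o≡n 2p≤d | m≤n⇒∃[o]m+o≡n 2p≤n
... | δ , refl | ν , refl = *-cancelˡ-≤ (suc q) (≤-by (+-mono-≤ (*-monoʳ-≤ (suc q) H) (≤-reflexive nd)) (q * δ + q * ν + ν * δ) (eq q e ν δ z))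
  where
  eq : ∀ q e ν δ z → suc q * (q + suc q + δ) + (suc q * (q + suc q + ν + z) + suc (suc q * e)) + (q * δ + q * ν + ν * δ)
    ≡ suc q * suc z + (suc q * suc e + (q + suc q + ν) * (q + suc q + δ))
  eq = ℕ-solve

pieces-and-singles : ∀ {p m h k τ w} → p * m + m + p ≤ 2 + (h + k) → k ≡ τ + w → w < p → p * m + m ≤ suc (h + τ)
pieces-and-singles {p} {m} {h} {_} {τ} {w} S refl w<p = ≤-by (+-mono-≤ S w<p) 0 (eq p m h τ w)
  where
  eq : ∀ p m h τ w → p * m + m + (2 + (h + (τ + w)) + p) + 0 ≡ suc (h + τ) + (p * m + m + p + suc w)
  eq = ℕ-solve

-- The slack m - n - d = (n - 1)(d - 1) - 1 is at least p² - 1, which absorbs the at most (p - 1)²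
-- terms outside ⟨y⟩.
many-singles : ∀ {q m h k n d z} → suc q * m + m + suc q ≤ 2 + (h + k) → k ≤ q * q → suc h < suc q * m + n + z →
  n * d ≡ m → suc q < n → suc q < d → d ≤ suc z
many-singles {q} {_} {h} {k} {n} {d} {z} S k≤ H refl p<n p<d with m≤n⇒∃[o]m+o≡n p<n | m≤n⇒∃[o]m+o≡n p<d
... | ν , refl | δ , refl = ≤-by (+-mono-≤ (+-mono-≤ S k≤) H) (q + q + q + 2 + (q + 1) * (ν + δ) + ν * δ) (eq q h k ν δ z)
  where
  eq : ∀ q h k ν δ z → let n = suc (suc q) + ν ; d = suc (suc q) + δ ; m = n * d in
    d + (2 + (h + k) + q * q + (suc q * m + n + z)) + (q + q + q + 2 + (q + 1) * (ν + δ) + ν * δ) ≡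
    suc z + (suc q * m + m + suc q + k + suc (suc h))
  eq = ℕ-solve

τ+m≤ : ∀ {q m τ} → τ ≤ q * q → suc q < m → τ + m ≤ suc q * m
τ+m≤ {q} {m} {τ} τ≤ p<m = ≤-trans (+-monoˡ-≤ m (≤-trans τ≤ (*-monoʳ-≤ q (≤-trans (n≤1+n q) (<⇒≤ p<m)))))
  (≤-reflexive (+-comm (q * m) m))

nonzero-length : ∀ {P m h τ ζ τ′ z ν} → P + m ≤ suc (h + τ) → τ ≡ ζ + τ′ → h ≡ ν + z → ζ + z < P → m ≤ τ′ + ν
nonzero-length {P} {m} {ζ = ζ} {τ′} {z} {ν} H refl refl lt = ≤-by (+-mono-≤ H lt) 0 (eq P m ζ τ′ z ν)
  where
  eq : ∀ P m ζ τ′ z ν → m + (suc (ν + z + (ζ + τ′)) + P) + 0 ≡ τ′ + ν + (P + m + suc (ζ + z))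
  eq = ℕ-solve

τ+d≤ : ∀ {q m n d τ} → τ ≤ q * q → n * d ≡ m → suc q < n → suc q < d → τ + d ≤ m
τ+d≤ {q} {_} {n} {d} {τ} τ≤ refl p<n p<d with m≤n⇒∃[o]m+o≡n p<n | m≤n⇒∃[o]m+o≡n p<d
... | ν , refl | δ , refl = ≤-by τ≤ (q + q + q + 2 + q * δ + δ + ν * (2 + q + δ)) (eq q τ ν δ)
  where
  eq : ∀ q τ ν δ → τ + (suc (suc q) + δ) + q * q + (q + q + q + 2 + q * δ + δ + ν * (2 + q + δ)) ≡ (suc (suc q) + ν) * (suc (suc q) + δ) + τ
  eq = ℕ-solve

many-zeros : ∀ {q m h k z ν x} → suc q * m + m + suc q ≤ 2 + (h + k) → h ≡ ν + z → k ≤ q * q → suc (suc ν) ≤ m → x < m →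
  suc q < m → x ≤ z
many-zeros {q} {m} {_} {k} {z} {ν} {x} S refl k≤ ν≤ x< p<m with m≤n⇒∃[o]m+o≡n p<m
... | μ , refl = ≤-by (+-mono-≤ (+-mono-≤ S k≤) (+-mono-≤ ν≤ x<)) (q + q + q + 2 + q * μ) (eq q k z ν x μ)
  where
  eq : ∀ q k z ν x μ → let m = suc (suc q) + μ in
    x + (2 + (ν + z + k) + q * q + (m + m)) + (q + q + q + 2 + q * μ) ≡
    z + (suc q * m + m + suc q + k + (suc (suc ν) + suc x))
  eq = ℕ-solve

forced-singles : ∀ {P m h τ ν z D g R Z} → P + m ≤ suc (h + τ) → h ≡ ν + z → ν ≡ g + R → z ≡ D + g + Z → D + g < m →
  P ≤ τ + g + (R + Z)
forced-singles {P} {m} {τ = τ} {D = D} {g} {R} {Z} H refl refl refl lt = ≤-by (+-mono-≤ H lt) 0 (eq P m τ D g R Z)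
  where
  eq : ∀ P m τ D g R Z → P + (suc (g + R + (D + g + Z) + τ) + m) + 0 ≡ τ + g + (R + Z) + (P + m + suc (D + g))
  eq = ℕ-solve

forced-blocks : ∀ {P e g R Z ν z} → P + e ≡ ν + z → ν ≡ g + R → z ≡ g + Z → g ≤ e → P ≤ g + (R + Z)
forced-blocks {P} {e} {g} {R} {Z} b refl refl g≤ = ≤-by (+-mono-≤ (≤-reflexive b) g≤) 0 (eq P e g R Z)
  where
  eq : ∀ P e g R Z → P + (g + R + (g + Z) + e) + 0 ≡ g + (R + Z) + (P + e + g)
  eq = ℕ-solve

-- Here e counts the orbits of r on the nonzero residues modulo m.
record Group-data (q m e : ℕ) (r : ℤ) : Set where
  p : ℕ
  p = suc q
  field
    p-prime : Prime p
    rᵖ≈1    : r ℤ.^ p ≈ 1ℤ ⟨ m ⟩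
    r-units : ∀ {n} → ¬ p ∣ n → IsUnit m (r ℤ.^ n ℤ.- 1ℤ)
    m≡      : m ≡ suc (p * e)
    p<      : ∀ {d} → d ∣ m → 1 < d → p < d
    2p≤     : ∀ {d} → d ∣ m → 1 < d → p + p ≤ suc d

module Main {q m e : ℕ} {r : ℤ} (𝔾 : Group-data q m e r) .{{_ : NonZero m}} {A : Set} (α : A → ℕ) (β : A → ℤ) where

  open Group-data 𝔾
  open Metacyclic p m r rᵖ≈1 r-units α β
  open Pieces p m r rᵖ≈1 r-units α β

  Central : List A → Set
  Central S = Realises NoSplit S (p * m) 0ℤ

  cofactor : ∀ {d n} → n * d ≡ m → d < m → 1 < n × n ∣ m
  cofactor {d} {zero} refl ()
  cofactor {d} {suc zero} nd d<m = contradiction (trans (sym (*-identityˡ d)) nd) (<⇒≢ d<m)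
  cofactor {d} {suc (suc n)} nd _ = s≤s (s≤s z≤n) , ℕ.divides d (trans (sym nd) (*-comm (suc (suc n)) d))

  -- The failure of the length condition in `divisible-case`, for every d > 1 at once.
  Scattered : ∀ {ℓ} → ℕ → List (Item ℓ) → Set
  Scattered κ as = ∀ {d n : ℕ} → n * d ≡ m → 1 < d → suc (length as) < κ * m + n + nonzeros val d as

  exit-or-many : ∀ {ℓ} κ (as : List (Item ℓ)) → Realises NoSplit (pool as) (κ * m * ℓ) 0ℤ ⊎ Scattered κ as
  exit-or-many {ℓ} κ as = decide (anyUpTo? bad? (suc m))
    where
    Bad : ℕ → Set
    -- The length condition of `divisible-case` multiplied by d, so that n d = m removes the
    -- cofactor n and the search runs over d alone.
    Bad d = 1 < d × d ∣ m × κ * m * d + m + nonzeros val d as * d ≤ suc (length as) * d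
    bad? : ∀ d → Dec (Bad d)
    bad? d = (1 ℕ.<? d) Dec.×-dec ((d ∣? m) Dec.×-dec (κ * m * d + m + nonzeros val d as * d ℕ.≤? suc (length as) * d))
    distrib : ∀ κ m n z d → n * d ≡ m → κ * m * d + m + z * d ≡ (κ * m + n + z) * d
    distrib κ m n z d refl = eq κ n z d
      where
      eq : ∀ κ n z d → κ * (n * d) * d + n * d + z * d ≡ (κ * (n * d) + n + z) * d
      eq = ℕ-solve
    decide : Dec (∃[ d ] (d < suc m × Bad d)) → _
    decide (yes (d , _ , 1<d , ℕ.divides n m≡nd , bad)) = inj₁ (realises-size (cong (_* ℓ) (regroup κ d n (sym m≡nd)))
      (divisible-case d n {{n≢0}} (sym m≡nd) (κ * d) as
        (*-cancelʳ-≤ _ _ d {{ℕ.>-nonZero (<-trans (s≤s z≤n) 1<d)}}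
          (subst (_≤ suc (length as) * d) (trans (distrib κ m n (nonzeros val d as) d (sym m≡nd)) (cong (λ z → (z + n + nonzeros val d as) * d) (sym (regroup κ d n (sym m≡nd))))) bad))))
      where
      n≢0 : NonZero n
      n≢0 = ℕ.≢-nonZero λ { refl → ℕ.≢-nonZero⁻¹ m m≡nd }
      regroup : ∀ κ d n {m} → n * d ≡ m → κ * d * n ≡ κ * m
      regroup κ d n refl = trans (*-assoc κ d n) (cong (κ *_) (*-comm d n))
    decide (no none) = inj₂ λ {d} {n} nd 1<d → ≰⇒> λ le → none (d , s≤s (∣⇒≤ (ℕ.divides n (sym nd))) , 1<d , ℕ.divides n (sym nd) ,
      subst (_≤ suc (length as) * d) (sym (distrib κ m n (nonzeros val d as) d nd)) (*-monoˡ-≤ d le))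

  module _ {ℓ : ℕ} (as : List (Item ℓ)) where

    zeros nz : List (Item ℓ)
    nz    = filter (nonzero? val m) as
    zeros = filter (¬? ∘ nonzero? val m) as

    zeros-vanish : All (λ a → val a ≈ 0ℤ ⟨ m ⟩) zeros
    zeros-vanish = All.map (λ {a} → Dec.decidable-stable (mod-≟ (val a) 0ℤ)) (All.all-filter (¬? ∘ nonzero? val m) as)

    nz-zeros : as ↭ nz ++ zeros
    nz-zeros = filter-↭-split (nonzero? val m) as

    length-nz-zeros : length as ≡ length nz + length zeros
    length-nz-zeros = filter-length-split (nonzero? val m) as

    nonzeros-nz : ∀ {d} → d ∣ m → nonzeros val d nz ≡ nonzeros val d as
    nonzeros-nz {d} d∣m = sym (begin
      nonzeros val d as ≡⟨ nonzeros-↭ val d nz-zeros ⟩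
      nonzeros val d (nz ++ zeros) ≡⟨ nonzeros-++ val d nz zeros ⟩
      nonzeros val d nz + nonzeros val d zeros ≡⟨ cong (λ z → nonzeros val d nz + z) (nonzeros-none val (All.map (mod-weaken d∣m) zeros-vanish)) ⟩
      nonzeros val d nz + 0 ≡⟨ +-identityʳ _ ⟩
      nonzeros val d nz ∎)
      where open ≡-Reasoning

    -- The optional items G are replaced by zeros Z₁ when they are not used, the rest is filled up arbitrarily.
    Exchange : List (Item ℓ) → List (Item ℓ) → ℕ → Set
    Exchange G F g = ∃[ Z₁ ] ∃[ Z₂ ] (as ↭ G ++ Z₁ ++ F ++ Z₂ × length Z₁ ≡ g × length zeros ≡ g + length Z₂ ×
      All (λ a → val a ≈ 0ℤ ⟨ m ⟩) Z₁)

    exchange : ∀ {G F g} → nz ↭ G ++ F → g ≤ length zeros → Exchange G F g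
    exchange {G} {F} {g} σ g≤ with take-↭ g zeros g≤
    ... | Z₁ , Z₂ , eq , refl = Z₁ , Z₂ , perm , refl , trans (cong length eq) (length-++ Z₁) ,
      All.++⁻ˡ Z₁ (subst (All _) eq zeros-vanish)
      where
      open Perm.PermutationReasoning
      perm : as ↭ G ++ Z₁ ++ F ++ Z₂
      perm = begin
        as ↭⟨ nz-zeros ⟩
        nz ++ zeros ≡⟨ cong (nz ++_) eq ⟩
        nz ++ Z₁ ++ Z₂ ↭⟨ ++⁺ʳ (Z₁ ++ Z₂) σ ⟩
        (G ++ F) ++ Z₁ ++ Z₂ ≡⟨ ++-assoc G F (Z₁ ++ Z₂) ⟩
        G ++ F ++ Z₁ ++ Z₂ ↭⟨ ++⁺ˡ G (shifts F Z₁) ⟩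
        G ++ Z₁ ++ F ++ Z₂ ∎

    pool-exchange : ∀ {G Z₁ F Z₂ : List (Item ℓ)} P → as ↭ G ++ Z₁ ++ F ++ Z₂ →
      P ++ pool as ↭ ((P ++ pool G) ++ pool Z₁) ++ pool (F ++ Z₂)
    pool-exchange {G} {Z₁} {F} {Z₂} P σ = begin
      P ++ pool as ↭⟨ ++⁺ˡ P (pool-↭ σ) ⟩
      P ++ pool (G ++ Z₁ ++ F ++ Z₂) ≡⟨ cong (P ++_) (trans (pool-++ G _) (cong (pool G ++_) (pool-++ Z₁ (F ++ Z₂)))) ⟩
      P ++ pool G ++ pool Z₁ ++ pool (F ++ Z₂) ≡⟨ ++-assoc P (pool G) _ ⟨
      (P ++ pool G) ++ pool Z₁ ++ pool (F ++ Z₂) ≡⟨ ++-assoc (P ++ pool G) (pool Z₁) _ ⟨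
      ((P ++ pool G) ++ pool Z₁) ++ pool (F ++ Z₂) ∎
      where open Perm.PermutationReasoning

  module Anchored (c : ℕ) (p∤c : ¬ p ∣ c) (Q : List A) (Q-size : length Q ≡ p) (Q-class : All (λ a → ∃[ k ] α a ≡ k * p + c) Q)
    (as : List (Item p)) (as-size : length as ≡ p * e + e) where

    s : ℤ
    s = r ℤ.^ c

    s-root : RootOfUnity m s p
    s-root = record
      { order>0 = s≤s z≤n
      ; root    = mod-trans (mod-≡ (ℤ.^-*-assoc r c p)) (r-periodic (n∣m*n c))
      ; units   = λ {i} 0<i i<p → subst (λ z → IsUnit m (z ℤ.- 1ℤ)) (sym (ℤ.^-*-assoc r c i)) (r-units (p∤c*i 0<i i<p)) }
      where
      p∤c*i : ∀ {i} → 0 < i → i < p → ¬ p ∣ c * i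
      p∤c*i {i} 0<i i<p p∣ with euclidsLemma c i p-prime p∣
      ... | inj₁ p∣c = p∤c p∣c
      ... | inj₂ p∣i = <⇒≱ i<p (∣⇒≤ {{ℕ.>-nonZero 0<i}} p∣i)

    class-power : ∀ {T} → All (λ a → ∃[ k ] α a ≡ k * p + c) T → r ℤ.^ αsum T ≈ s ℤ.^ length T ⟨ m ⟩
    class-power [] = mod-refl
    class-power {a ∷ T} ((k , eq) ∷ cs) = mod-trans (mod-≡ (ℤ.^-distribˡ-+-* r (α a) (αsum T)))
      (mod-* (mod-trans (mod-≡ (cong (r ℤ.^_) eq)) (r-absorb c (n∣m*n k))) (class-power cs))

    class-sum : ∀ {T} → All (λ a → ∃[ k ] α a ≡ k * p + c) T → ∃[ k ] αsum T ≡ k * p + length T * c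
    class-sum [] = 0 , refl
    class-sum {_ ∷ T} ((k , eq) ∷ cs) with class-sum cs
    ... | k′ , eq′ = k + k′ , trans (cong₂ _+_ eq eq′) (lemma k k′ p c (length T))
      where
      lemma : ∀ k k′ p c n → k * p + c + (k′ * p + n * c) ≡ (k + k′) * p + (c + n * c)
      lemma = ℕ-solve

    J : ℤ → Set
    J u = ∃[ j ] (j < p × u ≡ s ℤ.^ j)

    p∣Q : p ∣ αsum Q
    p∣Q with class-sum Q-class
    ... | k , eq = ℕ.divides (k + c) (trans eq (trans (cong (λ n → k * p + n * c) Q-size) (lemma k p c)))
      where
      lemma : ∀ k p c → k * p + p * c ≡ (k + c) * p
      lemma = ℕ-solve

    -- A cut before the last j terms has multiplier r^(j c) = s^j up to congruence, so all p powers
    -- of s are available.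
    anchor : Realises J Q p (βval Q)
    anchor = realise {chosen = Q} {others = []} (↭-reflexive (sym (++-identityʳ Q))) Q-size p∣Q mod-refl
      λ { (j , j<p , refl) → cut j j<p (take-↭ (p ∸ j) Q (≤-trans (m∸n≤m p j) (≤-reflexive (sym Q-size)))) }
      where
      cut : ∀ j → j < p → ∃[ Q₁ ] ∃[ Q₂ ] (Q ≡ Q₁ ++ Q₂ × length Q₁ ≡ p ∸ j) → Split Q (s ℤ.^ j)
      cut j j<p (Q₁ , Q₂ , eq , len) = Q₁ , Q₂ , eq , mod-trans (class-power (All.++⁻ʳ Q₁ (subst (All _) eq Q-class)))
        (mod-≡ (cong (s ℤ.^_) (+-cancelˡ-≡ (p ∸ j) (length Q₂) j
          (trans (cong (_+ length Q₂) (sym len)) (trans (sym (length-++ Q₁)) (trans (cong length (sym eq)) (trans Q-size (sym (m∸n+n≡m (<⇒≤ j<p))))))))))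

    1≤cofactor : ∀ {d n} → n * d ≡ m → 1 ≤ n
    1≤cofactor {d} {n} nd = n≢0⇒n>0 λ { refl → ℕ.≢-nonZero⁻¹ m (sym nd) }

    p≤pm : p + p * e * p ≡ p * m
    p≤pm = trans (lemma p e) (cong (p *_) (sym m≡))
      where
      lemma : ∀ p e → p + p * e * p ≡ p * suc (p * e)
      lemma = ℕ-solve

    anchored : Central (Q ++ pool as)
    anchored = decide (exit-or-many 1 as)
      where
      open Filling (val {p}) s p
      decide : _ ⊎ Scattered 1 as → Central (Q ++ pool as)
      decide (inj₁ R) = realises-size (trans (cong (_* p) (*-identityˡ m)) (*-comm m p)) (realises-↭ (++-comm Q (pool as)) (ignore Q R))
      decide (inj₂ many) = by-zeros (e ℕ.≤? length (zeros as))
        where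
        many′ : ∀ {d n} → n * d ≡ m → 1 < d → suc e ≤ n + nonzeros val d as
        many′ {n = n} nd 1<d = many-blocks {p} {n = n} m≡ as-size (many nd 1<d)
        by-zeros : Dec (e ≤ length (zeros as)) → Central (Q ++ pool as)
        -- More than pe = m - 1 blocks are nonzero. The p terms of the anchor and pe blocks have
        -- total length p + p²e = pm.
        by-zeros (no e≰z) = realises-size p≤pm (realises-weaken (λ ()) (twisted-case {u = s} (1 , 1<p , sym (ℤ.*-identityʳ s))
            (subst (λ z → IsUnit m (z ℤ.- 1ℤ)) (ℤ.*-identityʳ s) (RootOfUnity.units s-root (s≤s z≤n) 1<p))
            anchor (p * e) as (≤-reflexive m≡) (≤-trans (m≤m+n (p * e) e) (≤-reflexive (sym as-size))) enough 0ℤ))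
          where
          1<p : 1 < p
          1<p = ℕ.nonTrivial⇒n>1 p {{prime⇒nonTrivial p-prime}}
          all-nonzero : m ≤ suc (nonzeros val m as)
          all-nonzero = ≤-trans (≤-reflexive m≡) (s≤s (+-cancelʳ-≤ e (p * e) _ (≤-trans (≤-reflexive (trans (sym as-size) (length-nz-zeros as)))
            (+-monoʳ-≤ _ (<⇒≤ (≰⇒> e≰z))))))
          enough : ∀ {d} → d ∣ m → 1 < d → d ≤ suc (nonzeros val d as)
          enough {d} d∣m@(ℕ.divides n m≡nd) 1<d with m≤n⇒m<n∨m≡n (∣⇒≤ d∣m)
          ... | inj₂ refl = all-nonzero
          ... | inj₁ d<m with cofactor {d} {n} (sym m≡nd) d<m
          ...   | 1<n , n∣m = unweighted-bound {n = n} m≡ (sym m≡nd) (2p≤ d∣m 1<d) (2p≤ n∣m 1<n) (many′ {n = n} (sym m≡nd) 1<d)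
        -- Each useful block gains p residues, so 1 + p g ≤ m = 1 + p e bounds the number g of
        -- optional blocks by e, and a zero block is at hand for each.
        by-zeros (yes e≤z) = finish (fill-zero s-root (nz as) proper whole)
          where
          bound : ∀ {d n} → n * d ≡ m → 1 < d → d ≤ p * suc (nonzeros val d (nz as))
          bound {d} {n} nd 1<d = subst (λ z → d ≤ p * suc z) (sym (nonzeros-nz as (ℕ.divides n (sym nd))))
            (weighted-bound {n = n} m≡ nd (<⇒≤ (p< (ℕ.divides n (sym nd)) 1<d)) (1≤cofactor {d} {n} nd) (many′ {n = n} nd 1<d))
          proper : ∀ {d} → d ∣ m → 1 < d → d < m → d ≤ p * suc (nonzeros val d (nz as))
          proper (ℕ.divides n m≡nd) 1<d _ = bound {n = n} (sym m≡nd) 1<d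
          whole : m ≤ p * suc (nonzeros val m (nz as))
          whole with <-cmp m 1
          ... | tri< m<1 _ _ = ≤-trans (<⇒≤ m<1) (s≤s z≤n)
          ... | tri≈ _ m≡1 _ = ≤-trans (≤-reflexive m≡1) (s≤s z≤n)
          ... | tri> _ _ 1<m = bound {n = 1} (*-identityˡ m) 1<m
          finish : Filled m (0ℤ ∷ []) (nz as) → Central (Q ++ pool as)
          finish (G , F , σ , small , full) = exchanged (exchange as {G} {F} σ (≤-trans G≤e e≤z))
            where
            g = length G
            G≤e : g ≤ e
            G≤e = *-cancelˡ-≤ p (≤-pred (≤-trans small (≤-reflexive m≡)))
            exchanged : Exchange as G F g → Central (Q ++ pool as)
            exchanged (Z₁ , Z₂ , τ , len-Z₁ , len-z , zs) = forced (use-some (p * e ∸ g) (F ++ Z₂)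
                (m≤n+o⇒m∸n≤o _ _ (subst (λ z → p * e ≤ g + z) (sym (length-++ F))
                  (forced-blocks (trans (sym as-size) (length-nz-zeros as)) (trans (↭-length σ) (length-++ G)) len-z G≤e))))
              where
              forced : ∃[ t ] Realises NoSplit (pool (F ++ Z₂)) ((p * e ∸ g) * p) t → Central (Q ++ pool as)
              forced (t , R) = optional (drop-items {P = Q} {r′ = s} {w = p} (λ {j} j<p → j , j<p , refl) {X = 0ℤ ∷ []} {n = p} {D = 0} {o = βval Q}
                  (λ { (here u≈0) → 0 , z≤n , realises-size (sym (+-identityʳ p)) (realises-resp (mod-sym (mod-trans (mod-+ˡ (βval Q) u≈0) (mod-≡ (ℤ.+-identityʳ (βval Q))))) anchor) })
                  (full (ℤ.- (βval Q ℤ.+ t))))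
                where
                lemma : ∀ o t → o ℤ.+ ℤ.- (o ℤ.+ t) ℤ.+ 0ℤ ℤ.+ t ≡ 0ℤ
                lemma = ℤ-solve
                optional : ∃[ i ] ∃[ k ] (i ≤ 0 × k ≤ length G × Realises J (Q ++ pool G) (p + i + k * p) (βval Q ℤ.+ ℤ.- (βval Q ℤ.+ t))) → Central (Q ++ pool as)
                optional (zero , k , _ , k≤ , R′) = realises-↭ (pool-exchange as {G} {Z₁} {F} {Z₂} Q τ) (realises-size sizes (realises-weaken (λ ()) (realises-resp (mod-≡ (lemma (βval Q) t))
                  (append (append R′ (use-zeros (g ∸ k) Z₁ (≤-trans (m∸n≤m g k) (≤-reflexive (sym len-Z₁))) zs)) R))))
                  where
                  sum-sizes : ∀ p k k′ x → p + 0 + k * p + k′ * p + x * p ≡ p + (k + k′ + x) * p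
                  sum-sizes = ℕ-solve
                  g≤pe : g ≤ p * e
                  g≤pe = ≤-trans G≤e (m≤m+n e (q * e))
                  sizes : p + 0 + k * p + (g ∸ k) * p + (p * e ∸ g) * p ≡ p * m
                  sizes = trans (sum-sizes p k (g ∸ k) (p * e ∸ g)) (trans (cong (λ z → p + z * p)
                    (trans (cong (_+ (p * e ∸ g)) (m+[n∸m]≡n k≤)) (m+[n∸m]≡n g≤pe))) p≤pm)

-- The remaining sequences

module Extraction {q m e : ℕ} {r : ℤ} (𝔾 : Group-data q m e r) .{{_ : NonZero m}} {A : Set} (α : A → ℕ) (β : A → ℤ) where

  open Group-data 𝔾
  open Metacyclic p m r rᵖ≈1 r-units α β
  open Pieces p m r rᵖ≈1 r-units α β
  open Main 𝔾 α β

  p∣pieces : ∀ Ts → p ∣ αsum (concatMap terms Ts)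
  p∣pieces [] = p ℕ.∣0
  p∣pieces (T ∷ Ts) = subst (p ∣_) (sym (αsum-++ (terms T) (concatMap terms Ts))) (∣m∣n⇒∣m+n (Piece.p∣α T) (p∣pieces Ts))

  concat-split : ∀ {Ts Us Vs : List Piece} → Ts ↭ Us ++ Vs → concatMap terms Ts ↭ concatMap terms Us ++ concatMap terms Vs
  concat-split {Us = Us} {Vs} σ = ↭-trans (concatMap-↭ terms σ) (↭-reflexive (concatMap-++ terms Us Vs))

  use-zero-pieces : ∀ Ts → All (λ T → value T ≈ 0ℤ ⟨ m ⟩) Ts → Realises NoSplit (concatMap terms Ts) (length (concatMap terms Ts)) 0ℤ
  use-zero-pieces [] [] = use-none []
  use-zero-pieces (T ∷ Ts) (z ∷ zs) = realises-size (sym (length-++ (terms T)))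
    (append (realises-resp z (use-all (terms T) (Piece.p∣α T))) (use-zero-pieces Ts zs))

  module Unanchored (as : List (Item 1)) (W : List A) (p∤W : All (λ a → ¬ p ∣ α a) W) (W-small : length W ≤ q * q)
    (W-large : p ≤ length W) (S-large : p * m + m + p ≤ 2 + (length as + length W)) (p<m : p < m) where

    module _ (many : Scattered p as) (Ts : List Piece) (W′ : List A) (σ : W ↭ concatMap terms Ts ++ W′) (W′-free : ZeroFree W′) where

      P : List A
      P = concatMap terms Ts

      τ : ℕ
      τ = length P

      W-length : length W ≡ τ + length W′
      W-length = trans (↭-length σ) (length-++ P)

      τ≤ : τ ≤ q * q
      τ≤ = ≤-trans (m≤m+n τ (length W′)) (≤-trans (≤-reflexive (sym W-length)) W-small)

      total-length : p * m + m ≤ suc (length as + τ)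
      total-length = pieces-and-singles {p} {m} S-large W-length (zeroFree-length W′-free)

      proper : ∀ {d} → d ∣ m → 1 < d → d < m → d ≤ suc (nonzeros val d as) × τ + d ≤ m
      proper {d} d∣m@(ℕ.divides n m≡nd) 1<d d<m with cofactor {d} {n} (sym m≡nd) d<m
      ... | 1<n , n∣m = many-singles {q} S-large W-small (many {n = n} (sym m≡nd) 1<d) (sym m≡nd) (p< n∣m 1<n) (p< d∣m 1<d) ,
        τ+d≤ {q} {n = n} τ≤ (sym m≡nd) (p< n∣m 1<n) (p< d∣m 1<d)

      size₁ : ∀ {P n t} → Realises NoSplit P (n * 1) t → Realises NoSplit P n t
      size₁ {n = n} = realises-size (*-identityʳ n)

      -- All pieces are used as one fixed product, cut behind its first term. That term lies outside
      -- ⟨y⟩ while the whole product lies in ⟨y⟩, so the multiplier u at the cut has u - 1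
      -- invertible, and single terms are inserted there or at the end.
      many-nonzeros : m ≤ suc (nonzeros val m as) → Central (P ++ pool as)
      many-nonzeros whole = by-first Ts refl
        where
        by-first : ∀ Us → Ts ≡ Us → Central (P ++ pool as)
        -- Without pieces all of `W` would be zero-free and shorter than p.
        by-first [] refl = contradiction W-large (<⇒≱ (≤-trans (s≤s (≤-reflexive W-length)) (zeroFree-length W′-free)))
        by-first (T ∷ Us) refl = realises-size sizes (realises-weaken (λ ()) (twisted-case {J = λ u → u ≡ r ℤ.^ αsum X} {u = r ℤ.^ αsum X} refl
            (r-units p∤X) anchor (p * m ∸ τ) as (m≤n⇒m≤1+n (m+n≤o⇒m≤o∸n m (≤-trans (≤-reflexive (+-comm m τ)) (τ+m≤ {q} τ≤ p<m))))
            (m≤n+o⇒m∸n≤o _ _ enough-singles) enough 0ℤ))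
          where
          X : List A
          X = Piece.rest T ++ concatMap terms Us
          p∤first : ¬ p ∣ α (Piece.first T)
          p∤first = All.head (Perm.All-resp-↭ σ p∤W)
          p∤X : ¬ p ∣ αsum X
          p∤X p∣X = p∤first (∣m+n∣m⇒∣n (subst (p ∣_) (+-comm (α (Piece.first T)) (αsum X)) (p∣pieces Ts)) p∣X)
          anchor : Realises (λ u → u ≡ r ℤ.^ αsum X) P τ (βval P)
          anchor = realise {chosen = P} {others = []} (↭-reflexive (sym (++-identityʳ P))) refl (p∣pieces Ts) mod-refl
            λ { refl → Piece.first T ∷ [] , X , refl , mod-refl }
          enough-singles : p * m ≤ τ + length as
          enough-singles = +-cancelˡ-≤ 1 _ _ (≤-trans (≤-reflexive (+-comm 1 (p * m))) (≤-trans (+-monoʳ-≤ (p * m) (ℕ.>-nonZero⁻¹ m))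
            (≤-trans total-length (≤-reflexive (cong suc (+-comm (length as) τ))))))
          enough : ∀ {d} → d ∣ m → 1 < d → d ≤ suc (nonzeros val d as)
          enough d∣m 1<d with m≤n⇒m<n∨m≡n (∣⇒≤ d∣m)
          ... | inj₁ d<m  = proj₁ (proper d∣m 1<d d<m)
          ... | inj₂ refl = whole
          sizes : τ + (p * m ∸ τ) * 1 ≡ p * m
          sizes = trans (cong (λ z → τ + z) (*-identityʳ _)) (m+[n∸m]≡n (m+n≤o⇒m≤o τ (τ+m≤ {q} τ≤ p<m)))

      nonzero-piece? : ∀ T → Dec (¬ value T ≈ 0ℤ ⟨ m ⟩)
      nonzero-piece? T = ¬? (mod-≟ (value T) 0ℤ)

      T₁ T₀ : List Piece
      T₁ = filter nonzero-piece? Ts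
      T₀ = filter (¬? ∘ nonzero-piece?) Ts

      P₁ P₀ : List A
      P₁ = concatMap terms T₁
      P₀ = concatMap terms T₀

      P-split : P ↭ P₁ ++ P₀
      P-split = concat-split {Ts} {T₁} {T₀} (filter-↭-split nonzero-piece? Ts)

      τ-split : τ ≡ length P₁ + length P₀
      τ-split = trans (↭-length P-split) (length-++ P₁)

      T₀-zero : Realises NoSplit P₀ (length P₀) 0ℤ
      T₀-zero = use-zero-pieces T₀ (All.map (λ {T} → Dec.decidable-stable (mod-≟ (value T) 0ℤ)) (All.all-filter (¬? ∘ nonzero-piece?) Ts))

      -- Pieces and single terms of value 0 alone supply the pm terms.
      many-zero-terms : p * m ≤ length P₀ + length (zeros as) → Central (P ++ pool as)
      many-zero-terms enough = realises-↭ perm (ignore (P₁ ++ pool (nz as)) (realises-size (trans (cong (λ z → length P₀ + z) (*-identityʳ _)) (m+[n∸m]≡n P₀≤))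
          (append T₀-zero (use-zeros (p * m ∸ length P₀) (zeros as) (m≤n+o⇒m∸n≤o _ _ enough) (zeros-vanish as)))))
        where
        P₀≤ : length P₀ ≤ p * m
        P₀≤ = m+n≤o⇒m≤o (length P₀) (≤-trans (+-monoˡ-≤ m (≤-trans (m≤n+m (length P₀) (length P₁)) (≤-reflexive (sym τ-split)))) (τ+m≤ {q} τ≤ p<m))
        perm : P ++ pool as ↭ (P₀ ++ pool (zeros as)) ++ P₁ ++ pool (nz as)
        perm = begin
          P ++ pool as ↭⟨ ++⁺ P-split (↭-trans (pool-↭ (nz-zeros as)) (↭-reflexive (pool-++ (nz as) (zeros as)))) ⟩
          (P₁ ++ P₀) ++ pool (nz as) ++ pool (zeros as) ↭⟨ ++⁺ (++-comm P₁ P₀) (++-comm (pool (nz as)) (pool (zeros as))) ⟩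
          (P₀ ++ P₁) ++ pool (zeros as) ++ pool (nz as) ≡⟨ ++-assoc P₀ P₁ _ ⟩
          P₀ ++ P₁ ++ pool (zeros as) ++ pool (nz as) ↭⟨ ++⁺ˡ P₀ (shifts P₁ (pool (zeros as))) ⟩
          P₀ ++ pool (zeros as) ++ P₁ ++ pool (nz as) ≡⟨ ++-assoc P₀ (pool (zeros as)) _ ⟨
          (P₀ ++ pool (zeros as)) ++ P₁ ++ pool (nz as) ∎
          where open Perm.PermutationReasoning

      -- With at most m - 2 nonzero single terms there are enough zeros to replace all of the fewer
      -- than m optional terms. Pieces of value 0 are set aside, as they give no new values, and
      -- appended at the end.
      few-nonzeros : suc (suc (nonzeros val m as)) ≤ m → length P₀ + length (zeros as) < p * m → Central (P ++ pool as)
      few-nonzeros few short = finish (outcome-fill (outcome T₁ (All.all-filter nonzero-piece? Ts)) (nz as) proper′ whole)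
        where
        proper′ : ∀ {d} → d ∣ m → 1 < d → d < m → d ≤ suc (nonzeros val d (nz as)) × length P₁ + d ≤ m
        proper′ {d} d∣m 1<d d<m with proper d∣m 1<d d<m
        ... | d≤ , τ+d = subst (λ z → d ≤ suc z) (sym (nonzeros-nz as d∣m)) d≤ ,
          ≤-trans (+-monoˡ-≤ d (≤-trans (m≤m+n (length P₁) (length P₀)) (≤-reflexive (sym τ-split)))) τ+d
        whole : m ≤ length P₁ + nonzeros val m (nz as)
        whole = subst (λ z → m ≤ length P₁ + z) (sym (nonzeros-nz as ∣-refl))
          (nonzero-length {p * m} {ζ = length P₀} {τ′ = length P₁} {z = length (zeros as)} {ν = nonzeros val m as} total-length (trans τ-split (+-comm (length P₁) (length P₀))) (length-nz-zeros as) short)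
        finish : ∃[ n₀ ] ∃[ D ] ∃[ G ] ∃[ F ] (nz as ↭ G ++ F × n₀ + D ≡ length P₁ × D + length G < m ×
          (∀ t → ∃[ i ] (i ≤ D + length G × Realises NoSplit (P₁ ++ pool G) (n₀ + i) t))) → Central (P ++ pool as)
        finish (n₀ , D , G , F , υ , n₀+D , D+g<m , full) = exchanged (exchange as {G} {F} υ
            (many-zeros {q} {m} S-large (length-nz-zeros as) W-small few D+g<m p<m))
          where
          g = length G
          exchanged : Exchange as G F (D + g) → Central (P ++ pool as)
          exchanged (Z₁ , Z₂ , ρ , len-Z₁ , len-z , zs) = forced (use-some (p * m ∸ (τ + g)) (F ++ Z₂)
              (m≤n+o⇒m∸n≤o _ _ (subst (λ z → p * m ≤ τ + g + z) (sym (length-++ F))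
                (forced-singles {p * m} total-length (length-nz-zeros as) (trans (↭-length υ) (length-++ G)) len-z D+g<m))))
            where
            forced : ∃[ t ] Realises NoSplit (pool (F ++ Z₂)) ((p * m ∸ (τ + g)) * 1) t → Central (P ++ pool as)
            forced (t , R) = optional (full (ℤ.- t))
              where
              lemma : ∀ t → ℤ.- t ℤ.+ 0ℤ ℤ.+ t ℤ.+ 0ℤ ≡ 0ℤ
              lemma = ℤ-solve
              optional : ∃[ i ] (i ≤ D + g × Realises NoSplit (P₁ ++ pool G) (n₀ + i) (ℤ.- t)) → Central (P ++ pool as)
              optional (i , i≤ , R′) = realises-↭ perm (realises-size sizes (realises-resp (mod-≡ (lemma t))
                (append (append (append R′ (size₁ (use-zeros (D + g ∸ i) Z₁ (≤-trans (m∸n≤m (D + g) i) (≤-reflexive (sym len-Z₁))) zs))) (size₁ R)) T₀-zero)))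
                where
                perm : P ++ pool as ↭ (((P₁ ++ pool G) ++ pool Z₁) ++ pool (F ++ Z₂)) ++ P₀
                perm = begin
                  P ++ pool as ↭⟨ ++⁺ʳ (pool as) P-split ⟩
                  (P₁ ++ P₀) ++ pool as ≡⟨ ++-assoc P₁ P₀ (pool as) ⟩
                  P₁ ++ P₀ ++ pool as ↭⟨ ++⁺ˡ P₁ (++-comm P₀ (pool as)) ⟩
                  P₁ ++ pool as ++ P₀ ≡⟨ ++-assoc P₁ (pool as) P₀ ⟨
                  (P₁ ++ pool as) ++ P₀ ↭⟨ ++⁺ʳ P₀ (pool-exchange as {G} {Z₁} {F} {Z₂} P₁ ρ) ⟩
                  (((P₁ ++ pool G) ++ pool Z₁) ++ pool (F ++ Z₂)) ++ P₀ ∎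
                  where open Perm.PermutationReasoning
                regroup : ∀ n₀ D g x ζ → n₀ + (D + g) + x + ζ ≡ n₀ + D + ζ + g + x
                regroup = ℕ-solve
                τ+g≤ : τ + g ≤ p * m
                τ+g≤ = ≤-trans (+-monoʳ-≤ τ (≤-trans (m≤n+m g D) (<⇒≤ D+g<m))) (τ+m≤ {q} τ≤ p<m)
                sizes : n₀ + i + (D + g ∸ i) + (p * m ∸ (τ + g)) + length P₀ ≡ p * m
                sizes = begin
                  n₀ + i + (D + g ∸ i) + (p * m ∸ (τ + g)) + length P₀
                    ≡⟨ cong (λ z → z + (p * m ∸ (τ + g)) + length P₀) (trans (+-assoc n₀ i _) (cong (λ z → n₀ + z) (m+[n∸m]≡n i≤))) ⟩
                  n₀ + (D + g) + (p * m ∸ (τ + g)) + length P₀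
                    ≡⟨ regroup n₀ D g (p * m ∸ (τ + g)) (length P₀) ⟩
                  n₀ + D + length P₀ + g + (p * m ∸ (τ + g))
                    ≡⟨ cong (λ z → z + g + (p * m ∸ (τ + g))) (trans (cong (_+ length P₀) n₀+D) (sym τ-split)) ⟩
                  τ + g + (p * m ∸ (τ + g))
                    ≡⟨ m+[n∸m]≡n τ+g≤ ⟩
                  p * m ∎
                  where open ≡-Reasoning

      pieces-case : Central (pool as ++ W)
      pieces-case = realises-↭ perm (ignore W′ (choose (m ℕ.≤? suc (nonzeros val m as))))
        where
        perm : pool as ++ W ↭ (P ++ pool as) ++ W′
        perm = begin
          pool as ++ W ↭⟨ ++⁺ˡ (pool as) σ ⟩
          pool as ++ P ++ W′ ↭⟨ shifts (pool as) P ⟩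
          P ++ pool as ++ W′ ≡⟨ ++-assoc P (pool as) W′ ⟨
          (P ++ pool as) ++ W′ ∎
          where open Perm.PermutationReasoning
        choose : Dec (m ≤ suc (nonzeros val m as)) → Central (P ++ pool as)
        choose (yes whole) = many-nonzeros whole
        choose (no ¬whole) with p * m ℕ.≤? length P₀ + length (zeros as)
        ... | yes enough = many-zero-terms enough
        ... | no ¬enough = few-nonzeros (≰⇒> ¬whole) (≰⇒> ¬enough)

    unanchored : Central (pool as ++ W)
    unanchored = decide (exit-or-many p as)
      where
      decide : _ ⊎ Scattered p as → Central (pool as ++ W)
      decide (inj₁ R) = ignore W (realises-size (*-identityʳ (p * m)) R)
      decide (inj₂ many) with extract W
      ... | Ts , W′ , σ , free = pieces-case many Ts W′ σ free

  -- The residue classes are peeled off from the top; one that cannot supply p terms contributes at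
  -- most q.
  class-or-few : ∀ n W → All (λ a → 0 < α a % p × α a % p ≤ n) W →
    (∃[ c ] ∃[ Q ] ∃[ R ] (0 < c × c < p × W ↭ Q ++ R × length Q ≡ p × All (λ a → α a % p ≡ c) Q)) ⊎ length W ≤ n * q
  class-or-few zero [] [] = inj₂ z≤n
  class-or-few zero (a ∷ W) ((0<c , c≤0) ∷ _) = contradiction (≤-trans 0<c c≤0) λ ()
  class-or-few (suc n) W cs with p ℕ.≤? length (filter (λ a → α a % p ℕ.≟ suc n) W)
  ... | yes p≤ with take-↭ p (filter (λ a → α a % p ℕ.≟ suc n) W) p≤
  ...   | Q , R , eq , Q-size = inj₁ (suc n , Q , R ++ filter (λ a → ¬? (α a % p ℕ.≟ suc n)) W , s≤s z≤n , class<p Q Q-size all-Q ,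
          ↭-trans (filter-↭-split (λ a → α a % p ℕ.≟ suc n) W) (↭-reflexive (trans (cong (_++ _) eq) (++-assoc Q R _))) , Q-size , all-Q)
    where
    all-Q : All (λ a → α a % p ≡ suc n) Q
    all-Q = All.++⁻ˡ Q (subst (All _) eq (All.all-filter (λ a → α a % p ℕ.≟ suc n) W))
    class<p : ∀ Q → length Q ≡ p → All (λ a → α a % p ≡ suc n) Q → suc n < p
    class<p (a ∷ _) _ (c ∷ _) = subst (_< p) c (m%n<n (α a) p)
  class-or-few (suc n) W cs | no p≰ with class-or-few n (filter (λ a → ¬? (α a % p ℕ.≟ suc n)) W)
        (All.zipWith (λ { ((0<c , c≤) , ≢) → 0<c , ≤-pred (≤∧≢⇒< c≤ ≢) })
          (All.filter⁺ (λ a → ¬? (α a % p ℕ.≟ suc n)) cs , All.all-filter (λ a → ¬? (α a % p ℕ.≟ suc n)) W))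
  ... | inj₁ (c , Q , R , 0<c , c<p , σ , len , eqs) = inj₁ (c , Q , R ++ X , 0<c , c<p ,
          ↭-trans (filter-↭-split (λ a → α a % p ℕ.≟ suc n) W) (↭-trans (++-comm X _) (↭-trans (++⁺ʳ X σ) (↭-reflexive (++-assoc Q R X)))) , len , eqs)
    where X = filter (λ a → α a % p ℕ.≟ suc n) W
  ... | inj₂ few = inj₂ (≤-trans (≤-reflexive (filter-length-split (λ a → α a % p ℕ.≟ suc n) W)) (+-mono-≤ (≤-pred (≰⇒> p≰)) few))

  single : (∃[ a ] p ∣ α a) → Item 1
  single (a , p∣a) = item (a ∷ []) refl (subst (p ∣_) (sym (+-identityʳ (α a))) p∣a)

  pool-single : ∀ ss → pool (map single ss) ≡ map proj₁ ss
  pool-single []       = refl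
  pool-single (s ∷ ss) = cong (proj₁ s ∷_) (pool-single ss)

  total-α : ∀ as → total (λ a → + α a) as ≡ + αsum as
  total-α []       = refl
  total-α (a ∷ as) = cong (λ z → + α a ℤ.+ z) (total-α as)

  block-item : Block (λ a → + α a) p → Item p
  block-item B = item (Block.members B) (Block.members-size B)
    (≈0⇒∣ (by-quotient (Block.members-weight B) (trans (sym (total-α (Block.members B))) (trans (Block.members-sum B) (sym (ℤ.+-identityˡ _))))))

  pool-blocks : ∀ Bs → pool (map block-item Bs) ≡ concatMap Block.members Bs
  pool-blocks []       = refl
  pool-blocks (B ∷ Bs) = cong (Block.members B ++_) (pool-blocks Bs)

  -- The Erdős-Ginzburg-Ziv theorem modulo p, applied to α, cuts the remaining terms into blocks
  -- with product in ⟨y⟩.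
  anchored-case : ∀ {c} Q S → 0 < c → c < p → length Q ≡ p → All (λ a → α a % p ≡ c) Q → p * m + m + p ≤ 2 + (p + length S) → Central (Q ++ S)
  anchored-case {c} Q S 0<c c<p Q-size cs S-large with blocks (egz p) (λ a → + α a) (p * e + e) S (blocks-bound {p} m≡ S-large)
  ... | Bs , S′ , σ , len = realises-↭ (↭-trans (++⁺ˡ Q σ) (↭-reflexive (trans (sym (++-assoc Q _ S′)) (cong (λ z → (Q ++ z) ++ S′) (sym (pool-blocks Bs))))))
    (ignore S′ (Anchored.anchored c (>⇒∤ {{ℕ.>-nonZero 0<c}} c<p) Q Q-size (All.map (λ {a} → class a) cs) (map block-item Bs) (trans (length-map block-item Bs) len)))
    where
    class : ∀ a → α a % p ≡ c → ∃[ k ] α a ≡ k * p + c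
    class a eq = α a / p , trans (m≡m%n+[m/n]*n (α a) p) (trans (cong (_+ α a / p * p) eq) (+-comm c _))

  extraction : ∀ S → p * m + m + p ≤ 2 + length S → Central S
  extraction S S-large with m ℕ.≟ 1
  -- Here p < m, required without an anchor, fails; but the group is C_p and the threshold is 2p -
  -- 1.
  ... | yes m≡1 with egz p (λ a → + α a) S (≤-pred (≤-trans (≤-reflexive (eq m≡1)) S-large))
    where
    eq : m ≡ 1 → suc (p + p) ≡ p * m + m + p
    eq refl = lemma p
      where
      lemma : ∀ p → suc (p + p) ≡ p * 1 + 1 + p
      lemma = ℕ-solve
  ...   | bs , cs , σ , len , sum≈0 = realise {chosen = bs} {others = cs} σ (trans len (sym (trans (cong (p *_) m≡1) (*-identityʳ p)))) (≈0⇒∣ (subst (_≈ 0ℤ ⟨ p ⟩) (total-α bs) sum≈0))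
          (subst (βval bs ≈ 0ℤ ⟨_⟩) (sym m≡1) mod-one) (λ ())
  extraction S S-large | no m≢1 = by-size (length W ℕ.<? p)
    where
    p∣? : ∀ a → Dec (p ∣ α a)
    p∣? a = p ∣? α a
    N W : List A
    N = filter p∣? S
    W = filter (¬? ∘ p∣?) S
    ss = proj₁ (subtype (All.all-filter p∣? S))
    as = map single ss
    pool≡N : pool as ≡ N
    pool≡N = trans (pool-single ss) (proj₂ (subtype (All.all-filter p∣? S)))
    as-length : length as ≡ length N
    as-length = trans (length-map single ss) (trans (sym (length-map proj₁ ss)) (cong length (proj₂ (subtype (All.all-filter p∣? S)))))
    S-split : S ↭ pool as ++ W
    S-split = ↭-trans (filter-↭-split p∣? S) (↭-reflexive (cong (_++ W) (sym pool≡N)))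
    S-length : length S ≡ length as + length W
    S-length = trans (filter-length-split p∣? S) (cong (_+ length W) (sym as-length))
    1<m : 1 < m
    1<m = ≤∧≢⇒< (ℕ.>-nonZero⁻¹ m) (λ 1≡m → m≢1 (sym 1≡m))
    classes : All (λ a → 0 < α a % p × α a % p ≤ q) W
    classes = All.map (λ {a} p∤a → n≢0⇒n>0 (λ z → p∤a (m%n≡0⇒n∣m (α a) p z)) , ≤-pred (m%n<n (α a) p)) (All.all-filter (¬? ∘ p∣?) S)
    by-size : Dec (length W < p) → Central S
    -- At least pm + m - 1 terms lie in ⟨y⟩, so d = 1 gives the Erdős-Ginzburg-Ziv theorem in the
    -- whole of ℤ/m.
    by-size (yes W<p) = realises-↭ S-split (ignore W (realises-size (*-identityʳ (p * m)) (divisible-case 1 m (*-identityʳ m) p as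
      (subst (λ z → p * m + m + z ≤ suc (length as)) (sym (nonzeros-none val {1} {as} (All.universal (λ _ → mod-one) as)))
        (few-outside {p} {m} (subst (λ z → p * m + m + p ≤ 2 + z) S-length S-large) W<p)))))
    by-size (no W≮p) = by-class (class-or-few q W classes)
      where
      by-class : _ ⊎ length W ≤ q * q → Central S
      by-class (inj₂ few) = realises-↭ S-split (Unanchored.unanchored as W (All.all-filter (¬? ∘ p∣?) S) few (≮⇒≥ W≮p)
        (subst (λ z → p * m + m + p ≤ 2 + z) S-length S-large) (p< ∣-refl 1<m))
      by-class (inj₁ (c , Q , R , 0<c , c<p , σ , Q-size , cs)) = realises-↭ perm (anchored-case Q (R ++ pool as) 0<c c<p Q-size cs
        (subst (λ z → p * m + m + p ≤ 2 + z) lengths S-large))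
        where
        perm : S ↭ Q ++ R ++ pool as
        perm = begin
          S ↭⟨ S-split ⟩
          pool as ++ W ↭⟨ ++-comm (pool as) W ⟩
          W ++ pool as ↭⟨ ++⁺ʳ (pool as) σ ⟩
          (Q ++ R) ++ pool as ≡⟨ ++-assoc Q R (pool as) ⟩
          Q ++ R ++ pool as ∎
          where open Perm.PermutationReasoning
        lengths : length S ≡ p + length (R ++ pool as)
        lengths = trans (↭-length perm) (trans (length-++ Q) (cong (_+ length (R ++ pool as)) Q-size))

-- Consequences of the hypotheses

prime-divisor : ∀ d → 1 < d → ∃[ q ] (Prime q × q ∣ d)
prime-divisor d = go d d ≤-refl
  where
  go : ∀ k d → d ≤ k → 1 < d → ∃[ q ] (Prime q × q ∣ d)
  go zero    _ z≤n ()
  go (suc k) d d≤k 1<d with prime? d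
  ... | yes d-prime = d , d-prime , ∣-refl
  ... | no ¬prime with ¬prime⇒composite {{ℕ.n>1⇒nonTrivial 1<d}} ¬prime
  ...   | ℕ.hasNonTrivialDivisor {c} {{c>1}} c<d c∣d with go k c (≤-pred (≤-trans c<d d≤k)) (ℕ.nonTrivial⇒n>1 c)
  ...     | q , q-prime , q∣c = q , q-prime , ∣-trans q∣c c∣d

even-or-suc-even : ∀ n → 2 ∣ n ⊎ 2 ∣ suc n
even-or-suc-even zero = inj₁ (2 ℕ.∣0)
even-or-suc-even (suc n) with even-or-suc-even n
... | inj₁ 2∣n  = inj₂ (∣m∣n⇒∣m+n {2} {2} ∣-refl 2∣n)
... | inj₂ 2∣n′ = inj₁ 2∣n′

residues-apart : ∀ {m i j} → i < j → j < m → ¬ + i ≈ + j ⟨ m ⟩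
residues-apart {m} {i} {j} i<j j<m e = <⇒≱ (≤-<-trans (m∸n≤m j i) j<m) (∣⇒≤ {{ℕ.>-nonZero (m<n⇒0<n∸m i<j)}}
  (subst (m ∣_) (cong ℤ.∣_∣ (trans (ℤ.m-n≡m⊖n j i) (ℤ.⊖-≥ (<⇒≤ i<j)))) (≈0⇒∣ (difference-mod (mod-sym e)))))

residue-unique : ∀ {m i j} → i < m → j < m → + i ≈ + j ⟨ m ⟩ → i ≡ j
residue-unique {m} {i} {j} i<m j<m eq with <-cmp i j
... | tri≈ _ i≡j _ = i≡j
... | tri< i<j _ _ = contradiction eq (residues-apart i<j j<m)
... | tri> _ _ j<i = contradiction (mod-sym eq) (residues-apart j<i i<m)

residues-distinct : ∀ m .{{_ : NonZero m}} → Distinct m (residues {m})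
residues-distinct m = AllPairs.map⁺ (AllPairs.applyUpTo⁺₁ id m residues-apart)

-- The nonzero residues form orbits of length w under r.
modulus-by-orbits : ∀ {m r w} .{{_ : NonZero m}} → RootOfUnity m r w → ∃[ k ] m ≡ suc (w * k)
modulus-by-orbits {m} {r} {w} μ = go m (0ℤ ∷ []) 0 (m≤m+n m 1) ([] ∷ []) (here mod-refl) (λ { (here t≈0) → here (mod-*ʳ r t≈0) }) (cong suc (sym (*-zeroʳ w)))
  where
  open RootOfUnity μ
  Stable : List ℤ → Set
  Stable L = ∀ {t} → t ∈ L ⟨ m ⟩ → (t ℤ.* r) ∈ L ⟨ m ⟩
  lemma : ∀ c u r → c ℤ.* u ℤ.* r ≡ c ℤ.* (r ℤ.* u)
  lemma = ℤ-solve
  extend : ∀ c {L} → Stable L → Stable (orbit c ++ L)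
  extend c {L} stable t∈ with Any.++⁻ (orbit c) t∈
  ... | inj₂ t∈L = Any.++⁺ʳ (orbit c) (stable t∈L)
  ... | inj₁ t∈O with Any.applyUpTo⁻ (λ j → c ℤ.* r ℤ.^ j) t∈O
  ...   | j , j<w , t≈ with m≤n⇒m<n∨m≡n j<w
  ...     | inj₁ j+1<w = Any.++⁺ˡ {xs = orbit c} (Any.applyUpTo⁺ (λ j → c ℤ.* r ℤ.^ j) (mod-trans (mod-*ʳ r t≈) (mod-≡ (lemma c (r ℤ.^ j) r))) j+1<w)
  ...     | inj₂ refl = Any.++⁺ˡ {xs = orbit c} (Any.applyUpTo⁺ (λ j → c ℤ.* r ℤ.^ j) (mod-trans (mod-*ʳ r t≈) (mod-trans (mod-≡ (lemma c (r ℤ.^ j) r)) (mod-*ˡ c root))) (s≤s z≤n))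
  go : ∀ n L k → m ≤ n + length L → Distinct m L → 0ℤ ∈ L ⟨ m ⟩ → Stable L → length L ≡ suc (w * k) → ∃[ k ] m ≡ suc (w * k)
  go n L k bound L! 0∈L stable len = decide n bound (All.all? (λ t → mod-∈? t L) (residues {m}))
    where
    size : All (_∈ L ⟨ m ⟩) (residues {m}) → m ≡ length L
    size all = ≤-antisym (subst (_≤ length L) (length-residues {m}) (pigeonhole {m} {residues {m}} {L} (residues-distinct m) covered)) (distinct-length≤ L!)
      where
      covered : ∀ {t} → t ∈ residues {m} ⟨ m ⟩ → t ∈ L ⟨ m ⟩
      covered t∈ with Membership.find t∈
      ... | s , s∈ , t≈s = ∈-resp-≈ (mod-sym t≈s) (All.lookup all s∈)
    larger : ∀ n t → ¬ t ∈ L ⟨ m ⟩ → m ≤ n + length L → ∃[ k ] m ≡ suc (w * k)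
    larger zero t t∉L bound = contradiction (distinct-full L! bound t) t∉L
    larger (suc n) t t∉L bound = go n (orbit t ++ L) (suc k) bound′ L′! (Any.++⁺ʳ (orbit t) 0∈L) (extend t stable) len″
      where
      L′! : Distinct m (orbit t ++ L)
      L′! = proj₁ (orbit-extends L! 0∈L stable t∉L)
      len′ : length (orbit t ++ L) ≡ w + length L
      len′ = proj₂ (orbit-extends L! 0∈L stable t∉L)
      len″ : length (orbit t ++ L) ≡ suc (w * suc k)
      len″ = trans len′ (trans (cong (λ z → w + z) len) (trans (+-suc w (w * k)) (cong suc (sym (*-suc w k)))))
      bound′ : m ≤ n + length (orbit t ++ L)
      bound′ = ≤-trans bound (≤-trans (≤-reflexive (sym (+-suc n (length L)))) (+-monoʳ-≤ n (≤-trans (+-monoˡ-≤ (length L) order>0) (≤-reflexive (sym len′)))))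
    decide : ∀ n → m ≤ n + length L → Dec (All (_∈ L ⟨ m ⟩) (residues {m})) → ∃[ k ] m ≡ suc (w * k)
    decide n bound (yes all) = k , trans (size all) len
    decide n bound (no ¬all) with Membership.find (All.¬All⇒Any¬ (λ t → mod-∈? t L) (residues {m}) ¬all)
    ... | t , _ , t∉L = larger n t t∉L bound

module Hypotheses {q m : ℕ} {r : ℤ} .{{_ : NonZero m}} (p-prime : Prime (suc q)) (root : (r ℤ.^ suc q) ≡ 1ℤ [mod m ])
  (least : IsSmallestPrimeDivisor (suc q) (suc q * m)) (coprime : gcd (+ suc q ℤ.* (r ℤ.- 1ℤ)) (+ m) ≡ 1ℤ) where

  p : ℕ
  p = suc q

  rᵖ≈1 : r ℤ.^ p ≈ 1ℤ ⟨ m ⟩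
  rᵖ≈1 = congruent (ℤS.∣ᵤ⇒∣ root)

  coprime-divisor : ∀ {g} → g ∣ ℤ.∣ + p ℤ.* (r ℤ.- 1ℤ) ∣ → g ∣ m → g ≡ 1
  coprime-divisor g∣ g∣m = ∣1⇒≡1 (subst (_ ∣_) (ℤ.+-injective coprime) (ℕ.gcd-greatest g∣ g∣m))

  p∤m : ¬ p ∣ m
  p∤m p∣m = <⇒≢ (ℕ.nonTrivial⇒n>1 p {{prime⇒nonTrivial p-prime}})
    (sym (coprime-divisor (subst (p ∣_) (sym (ℤ.abs-* (+ p) (r ℤ.- 1ℤ))) (m∣m*n _)) p∣m))

  -- Modulo g = gcd(r^n - 1, m) both r^n and r^p are 1. As n and p are coprime, r ≡ 1 modulo g, so g
  -- divides p (r - 1) and m and equals 1.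
  r-units : ∀ {n} → ¬ p ∣ n → IsUnit m (r ℤ.^ n ℤ.- 1ℤ)
  r-units {n} p∤n = coprime⇒unit (coprime-divisor
      (subst (g ∣_) (sym (ℤ.abs-* (+ p) (r ℤ.- 1ℤ))) (∣n⇒∣m*n p (≈0⇒∣ (difference-mod r≈1)))) g∣m)
    where
    g = ℕ.gcd ℤ.∣ r ℤ.^ n ℤ.- 1ℤ ∣ m
    g∣m = ℕ.gcd[m,n]∣n ℤ.∣ r ℤ.^ n ℤ.- 1ℤ ∣ m
    rⁿ≈1 : r ℤ.^ n ≈ 1ℤ ⟨ g ⟩
    rⁿ≈1 = mod-difference (∣⇒≈0 (ℕ.gcd[m,n]∣m ℤ.∣ r ℤ.^ n ℤ.- 1ℤ ∣ m))
    multiples : ∀ {k} x → r ℤ.^ k ≈ 1ℤ ⟨ g ⟩ → r ℤ.^ (x * k) ≈ 1ℤ ⟨ g ⟩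
    multiples {k} x e = mod-trans (mod-≡ (trans (cong (r ℤ.^_) (*-comm x k)) (sym (ℤ.^-*-assoc r k x)))) (mod-trans (mod-^ x e) (mod-≡ (ℤ.^-zeroˡ x)))
    one-more : ∀ {k l} → 1 + k ≡ l → r ℤ.^ k ≈ 1ℤ ⟨ g ⟩ → r ℤ.^ l ≈ 1ℤ ⟨ g ⟩ → r ≈ 1ℤ ⟨ g ⟩
    one-more refl rᵏ rˡ = mod-trans (mod-≡ (sym (ℤ.*-identityʳ r))) (mod-trans (mod-*ˡ r (mod-sym rᵏ)) rˡ)
    gcd-one : ℕ.gcd n p ≡ 1
    gcd-one with prime⇒irreducible p-prime (ℕ.gcd[m,n]∣n n p)
    ... | inj₁ eq = eq
    ... | inj₂ eq = contradiction (subst (_∣ n) eq (ℕ.gcd[m,n]∣m n p)) p∤n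
    r≈1 : r ≈ 1ℤ ⟨ g ⟩
    r≈1 with subst (λ d → ℕ.Bézout.Identity d n p) gcd-one (ℕ.Bézout.identity (ℕ.gcd-GCD n p))
    ... | ℕ.Bézout.+- x y e = one-more e (multiples y (mod-weaken g∣m rᵖ≈1)) (multiples x rⁿ≈1)
    ... | ℕ.Bézout.-+ x y e = one-more e (multiples x rⁿ≈1) (multiples y (mod-weaken g∣m rᵖ≈1))

  -- A prime divisor of d divides |G| and so is at least p; equality is excluded as p does not
  -- divide m.
  p< : ∀ {d} → d ∣ m → 1 < d → p < d
  p< {d} d∣m 1<d with prime-divisor d 1<d
  ... | s , s-prime , s∣d = ≤∧≢⇒< (≤-trans (proj₂ least s (s-prime , ∣n⇒∣m*n p (∣-trans s∣d d∣m))) (∣⇒≤ {{ℕ.>-nonZero (<-trans (s≤s z≤n) 1<d)}} s∣d))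
    λ { refl → p∤m d∣m }

  r-root : RootOfUnity m r p
  r-root = record { order>0 = s≤s z≤n ; root = rᵖ≈1 ; units = λ 0<i i<p → r-units λ p∣i → <⇒≱ i<p (∣⇒≤ {{ℕ.>-nonZero 0<i}} p∣i) }

  e : ℕ
  e = proj₁ (modulus-by-orbits r-root)

  -- Orbits modulo d give d = 1 + p k with k ≥ 1. For k ≥ 2 this is large enough. For k = 1, d = p +
  -- 1 is even when p is odd, and 2 would be a smaller prime divisor of |G|; when p = 2, d = 3 = 2p
  -- - 1.
  2p≤ : ∀ {d} → d ∣ m → 1 < d → p + p ≤ suc d
  2p≤ {zero}  _   ()
  2p≤ {suc _} d∣m 1<d with modulus-by-orbits (root-weaken d∣m r-root)
  ... | zero , refl = contradiction (subst (1 <_) (cong suc (*-zeroʳ p)) 1<d) (<-irrefl refl)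
  ... | suc (suc k) , refl = ≤-trans (m≤m+n (p + p) (2 + p * k)) (≤-reflexive (lemma p k))
    where
    lemma : ∀ p k → p + p + (2 + p * k) ≡ suc (suc (p * suc (suc k)))
    lemma = ℕ-solve
  ... | suc zero , refl with p ℕ.≤? 2
  ...   | yes p≤2 = ≤-trans (+-monoʳ-≤ p p≤2) (≤-reflexive (lemma p))
    where
    lemma : ∀ p → p + 2 ≡ suc (suc (p * 1))
    lemma = ℕ-solve
  ...   | no p≰2 with even-or-suc-even p
  ...     | inj₁ 2∣p with prime⇒irreducible p-prime 2∣p
  ...       | inj₁ ()
  ...       | inj₂ refl = contradiction ≤-refl p≰2
  2p≤ {suc _} d∣m 1<d | suc zero , refl | no p≰2 | inj₂ 2∣p+1 =
    contradiction (proj₂ least 2 (prime[2] , ∣n⇒∣m*n p (∣-trans (subst (λ z → 2 ∣ suc z) (sym (*-identityʳ p)) 2∣p+1) d∣m))) p≰2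

  group-data : Group-data q m e r
  group-data = record { p-prime = p-prime ; rᵖ≈1 = rᵖ≈1 ; r-units = r-units ; m≡ = proj₂ (modulus-by-orbits r-root) ; p< = p< ; 2p≤ = 2p≤ }

-- Normal forms

module Presentation {q m : ℕ} {r : ℤ} .{{_ : NonZero m}} (rᵖ≈1 : r ℤ.^ suc q ≈ 1ℤ ⟨ m ⟩) where

  p : ℕ
  p = suc q

  G : Group 0ℓ 0ℓ
  G = metacyclicGroup p m r

  open Group G using () renaming (_≈_ to _≋_)
  open SetoidReasoning (Group.setoid G)

  Word : Set
  Word = Term Generator

  -- The word s equals x^(α s) y^(β s).
  α : Word → ℕ
  α (gen 𝕩) = 1
  α (gen 𝕪) = 0
  α ε       = 0
  α (s ∙ t) = α s + α t
  -- As q = p - 1 is -1 modulo p, the exponents of x can remain natural numbers.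
  α (s ⁻¹)  = α s * q

  β : Word → ℤ
  β (gen 𝕩) = 0ℤ
  β (gen 𝕪) = 1ℤ
  β ε       = 0ℤ
  β (s ∙ t) = β s ℤ.* r ℤ.^ α t ℤ.+ β t
  β (s ⁻¹)  = ℤ.- (β s ℤ.* r ℤ.^ (α s * q))

  -- Congruence of naturals without subtraction, so that it can be applied to natural powers.
  pos-mod : ∀ {n a b} → + a ≈ + b ⟨ n ⟩ → ∃[ k ] ∃[ l ] a + k * n ≡ b + l * n
  pos-mod {n} {a} {b} (congruent (divides (+ k) eq)) = 0 , k , ℤ.+-injective begin′
    where
    lemma : ∀ a b → a ≡ b ℤ.+ (a ℤ.- b)
    lemma = ℤ-solve
    begin′ : + (a + 0 * n) ≡ + (b + k * n)
    begin′ = trans (cong +_ (+-identityʳ a)) (trans (lemma (+ a) (+ b)) (cong (λ z → + b ℤ.+ z) (trans eq (sym (ℤ.pos-* k n)))))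
  pos-mod {n} {a} {b} (congruent (divides -[1+ k ] eq)) = suc k , 0 , ℤ.+-injective begin′
    where
    lemma : ∀ a b u → a ℤ.+ u ≡ b ℤ.+ ((a ℤ.- b) ℤ.+ u)
    lemma = ℤ-solve
    begin′ : + (a + suc k * n) ≡ + (b + 0 * n)
    begin′ = trans (cong (λ z → + a ℤ.+ z) (ℤ.pos-* (suc k) n)) (trans (lemma (+ a) (+ b) (+ suc k ℤ.* + n))
      (cong (λ z → + b ℤ.+ z) (trans (cong (λ z → z ℤ.+ + suc k ℤ.* + n) eq) (trans (sym (ℤ.*-distribʳ-+ (+ n) -[1+ k ] (+ suc k)))
        (trans (cong (ℤ._* + n) (ℤ.+-inverseˡ (+ suc k))) (ℤ.*-zeroˡ (+ n)))))))

  r-power-cong : ∀ {a b} → + a ≈ + b ⟨ p ⟩ → r ℤ.^ a ≈ r ℤ.^ b ⟨ m ⟩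
  r-power-cong {a} {b} eq with pos-mod eq
  ... | k , l , e = mod-trans (mod-sym (absorb a k)) (mod-trans (mod-≡ (cong (r ℤ.^_) e)) (absorb b l))
    where
    absorb : ∀ a k → r ℤ.^ (a + k * p) ≈ r ℤ.^ a ⟨ m ⟩
    absorb a k = mod-trans (mod-≡ (trans (ℤ.^-distribˡ-+-* r a (k * p)) (cong (λ z → r ℤ.^ a ℤ.* z) (trans (cong (r ℤ.^_) (*-comm k p)) (sym (ℤ.^-*-assoc r p k))))))
      (mod-trans (mod-*ˡ (r ℤ.^ a) (mod-trans (mod-^ k rᵖ≈1) (mod-≡ (ℤ.^-zeroˡ k)))) (mod-≡ (ℤ.*-identityʳ (r ℤ.^ a))))

  α-mod-0 : ∀ k → + (k * p) ≈ 0ℤ ⟨ p ⟩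
  α-mod-0 k = by-quotient (+ k) (trans (ℤ.pos-* k p) (sym (ℤ.+-identityˡ _)))

  α-x^ : ∀ n → α (x ^ (+ n)) ≡ n
  α-x^ zero    = refl
  α-x^ (suc n) = cong suc (α-x^ n)

  β-x^ : ∀ n → β (x ^ (+ n)) ≡ 0ℤ
  β-x^ zero    = refl
  β-x^ (suc n) = trans (cong₂ ℤ._+_ (ℤ.*-zeroˡ (r ℤ.^ α (x ^ (+ n)))) (β-x^ n)) refl

  α-y^ : ∀ n → α (y ^ (+ n)) ≡ 0
  α-y^ zero    = refl
  α-y^ (suc n) = α-y^ n

  β-y^ : ∀ n → β (y ^ (+ n)) ≡ + n
  β-y^ zero    = refl
  β-y^ (suc n) = trans (cong₂ (λ k z → 1ℤ ℤ.* r ℤ.^ k ℤ.+ z) (α-y^ n) (β-y^ n)) refl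

  αβ-y^ : ∀ k → α (y ^ k) ≡ 0 × β (y ^ k) ≡ k
  αβ-y^ (+ n)    = α-y^ n , β-y^ n
  αβ-y^ -[1+ n ] = cong (_* q) (α-y^ (suc n)) , cong ℤ.-_ (trans (cong₂ (λ z k → z ℤ.* r ℤ.^ (k * q)) (β-y^ (suc n)) (α-y^ (suc n))) (ℤ.*-identityʳ (+ suc n)))

  Same : Word → Word → Set
  Same s t = + α s ≈ + α t ⟨ p ⟩ × β s ≈ β t ⟨ m ⟩

  inverse-α : ∀ n → + (n * q + n) ≈ 0ℤ ⟨ p ⟩
  inverse-α n = subst (λ k → + k ≈ 0ℤ ⟨ p ⟩) (trans (*-suc n q) (+-comm n (n * q))) (α-mod-0 n)

  -- Words are interpreted in the semidirect product of exponent pairs. This shows that the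
  -- relations do not collapse the group; together with `complete` it identifies the group with
  -- these pairs, whence its order.
  sound : ∀ {s t} → s ≋ t → Same s t
  sound (relation xᵖ≈1) = subst (λ k → + k ≈ 0ℤ ⟨ p ⟩) (sym (α-x^ p)) modulus≈0 , mod-≡ (β-x^ p)
  sound (relation yᵐ≈1) = mod-≡ (cong +_ (α-y^ m)) , mod-trans (mod-≡ (β-y^ m)) modulus≈0
  sound (relation x⁻¹yx≈yʳ) = subst (λ k → + k ≈ + α (y ^ r) ⟨ p ⟩) (lemma q) (mod-trans modulus≈0 (mod-≡ (cong +_ (sym (proj₁ (αβ-y^ r)))))) ,
    mod-≡ (trans (value r (0ℤ ℤ.* r ℤ.^ (1 * q)) (ℤ.*-zeroˡ (r ℤ.^ (1 * q)))) (sym (proj₂ (αβ-y^ r))))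
    where
    lemma : ∀ q → suc q ≡ 1 * q + 0 + 1
    lemma = ℕ-solve
    value : ∀ r z → z ≡ 0ℤ → (ℤ.- z ℤ.* 1ℤ ℤ.+ 1ℤ) ℤ.* (r ℤ.* 1ℤ) ℤ.+ 0ℤ ≡ r
    value r _ refl = identity r
      where
      identity : ∀ r → (ℤ.- 0ℤ ℤ.* 1ℤ ℤ.+ 1ℤ) ℤ.* (r ℤ.* 1ℤ) ℤ.+ 0ℤ ≡ r
      identity = ℤ-solve
  sound ≈-refl = mod-refl , mod-refl
  sound (≈-sym e) = mod-sym (proj₁ (sound e)) , mod-sym (proj₂ (sound e))
  sound (≈-trans e f) = mod-trans (proj₁ (sound e)) (proj₁ (sound f)) , mod-trans (proj₂ (sound e)) (proj₂ (sound f))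
  sound (∙-cong e f) = mod-+ (proj₁ (sound e)) (proj₁ (sound f)) ,
    mod-+ (mod-* (proj₂ (sound e)) (r-power-cong (proj₁ (sound f)))) (proj₂ (sound f))
  sound (⁻¹-cong {s} {t} e) = αs , mod-neg (mod-* (proj₂ (sound e)) (r-power-cong αs))
    where
    αs : + (α s * q) ≈ + (α t * q) ⟨ p ⟩
    αs = subst₂ (_≈_⟨ p ⟩) (sym (ℤ.pos-* (α s) q)) (sym (ℤ.pos-* (α t) q)) (mod-*ʳ (+ q) (proj₁ (sound e)))
  sound (assoc s t u) = mod-≡ (cong +_ (+-assoc (α s) (α t) (α u))) ,
    mod-≡ (trans (lemma (β s) (β t) (β u) (r ℤ.^ α t) (r ℤ.^ α u)) (cong (λ z → β s ℤ.* z ℤ.+ (β t ℤ.* r ℤ.^ α u ℤ.+ β u)) (sym (ℤ.^-distribˡ-+-* r (α t) (α u)))))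
    where
    lemma : ∀ a b c v w → (a ℤ.* v ℤ.+ b) ℤ.* w ℤ.+ c ≡ a ℤ.* (v ℤ.* w) ℤ.+ (b ℤ.* w ℤ.+ c)
    lemma = ℤ-solve
  sound (identityˡ s) = mod-refl , mod-≡ (lemma (β s) (r ℤ.^ α s))
    where
    lemma : ∀ b u → 0ℤ ℤ.* u ℤ.+ b ≡ b
    lemma = ℤ-solve
  sound (identityʳ s) = mod-≡ (cong +_ (+-identityʳ (α s))) , mod-≡ (lemma (β s))
    where
    lemma : ∀ b → b ℤ.* 1ℤ ℤ.+ 0ℤ ≡ b
    lemma = ℤ-solve
  sound (inverseˡ s) = inverse-α (α s) , mod-trans
    (mod-≡ (trans (lemma (β s) (r ℤ.^ (α s * q)) (r ℤ.^ α s)) (cong (λ z → β s ℤ.- β s ℤ.* z) (sym (ℤ.^-distribˡ-+-* r (α s * q) (α s))))))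
    (mod-trans (mod-+ˡ (β s) (mod-neg (mod-*ˡ (β s) (r-power-cong {b = 0} (inverse-α (α s)))))) (mod-≡ (cancel (β s))))
    where
    lemma : ∀ b u v → ℤ.- (b ℤ.* u) ℤ.* v ℤ.+ b ≡ b ℤ.- b ℤ.* (u ℤ.* v)
    lemma = ℤ-solve
    cancel : ∀ b → b ℤ.- b ℤ.* 1ℤ ≡ 0ℤ
    cancel = ℤ-solve
  sound (inverseʳ s) = subst (λ k → + k ≈ 0ℤ ⟨ p ⟩) (+-comm (α s * q) (α s)) (inverse-α (α s)) , mod-≡ (ℤ.+-inverseʳ (β s ℤ.* r ℤ.^ (α s * q)))

  x^-+ : ∀ (t : Word) a b → t ^ (+ (a + b)) ≋ t ^ (+ a) ∙ t ^ (+ b)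
  x^-+ t zero    b = ≈-sym (identityˡ _)
  x^-+ t (suc a) b = ≈-trans (∙-cong ≈-refl (x^-+ t a b)) (≈-sym (assoc t _ _))

  ^-trivial : ∀ {t : Word} {n} → t ^ (+ n) ≋ ε → ∀ k → t ^ (+ (k * n)) ≋ ε
  ^-trivial h zero    = ≈-refl
  ^-trivial {t} {n} h (suc k) = ≈-trans (x^-+ t n (k * n)) (≈-trans (∙-cong h (^-trivial h k)) (identityˡ ε))

  ^-periodic : ∀ {t : Word} {n} → t ^ (+ n) ≋ ε → ∀ {a b} → + a ≈ + b ⟨ n ⟩ → t ^ (+ a) ≋ t ^ (+ b)
  ^-periodic {t} {n} h {a} {b} eq with pos-mod eq
  ... | k , l , e = begin
    t ^ (+ a) ≈⟨ drop-multiple a k ⟨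
    t ^ (+ (a + k * n)) ≡⟨ cong (λ z → t ^ (+ z)) e ⟩
    t ^ (+ (b + l * n)) ≈⟨ drop-multiple b l ⟩
    t ^ (+ b) ∎
    where
    drop-multiple : ∀ a k → t ^ (+ (a + k * n)) ≋ t ^ (+ a)
    drop-multiple a k = ≈-trans (x^-+ t a (k * n)) (≈-trans (∙-cong ≈-refl (^-trivial h k)) (identityʳ _))

  Y : ℤ → Word
  Y b = y ^ (+ (b ℤ.%ℕ m))

  Y-cong : ∀ {b c} → b ≈ c ⟨ m ⟩ → Y b ≋ Y c
  Y-cong {b} {c} eq = ^-periodic (relation yᵐ≈1) (mod-trans (mod-sym (mod-% m b)) (mod-trans eq (mod-% m c)))

  Y-pos : ∀ n → Y (+ n) ≋ y ^ (+ n)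
  Y-pos n = ^-periodic (relation yᵐ≈1) (mod-sym (mod-% m (+ n)))

  Y-+ : ∀ b c → Y (b ℤ.+ c) ≋ Y b ∙ Y c
  Y-+ b c = ≈-trans (^-periodic (relation yᵐ≈1) (mod-trans (mod-sym (mod-% m (b ℤ.+ c))) (mod-+ (mod-% m b) (mod-% m c)))) (x^-+ y (b ℤ.%ℕ m) (c ℤ.%ℕ m))

  -- For negative r the word y ^ r is an inverse, and uniqueness of inverses identifies it with the
  -- nonnegative power.
  Y-r : Y r ≋ y ^ r
  Y-r = by-sign r refl
    where
    by-sign : ∀ k → r ≡ k → Y k ≋ y ^ k
    by-sign (+ n)    _ = Y-pos n
    by-sign -[1+ n ] _ = GroupProperties.inverseʳ-unique G (y ^ (+ suc n)) (Y -[1+ n ]) (begin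
      y ^ (+ suc n) ∙ Y -[1+ n ] ≈⟨ ∙-cong (≈-sym (Y-pos (suc n))) ≈-refl ⟩
      Y (+ suc n) ∙ Y -[1+ n ] ≈⟨ Y-+ (+ suc n) -[1+ n ] ⟨
      Y (+ suc n ℤ.+ -[1+ n ]) ≈⟨ Y-cong (mod-≡ (ℤ.+-inverseʳ (+ suc n))) ⟩
      Y 0ℤ ≈⟨ Y-pos 0 ⟩
      ε ∎)

  yx : y ∙ x ≋ x ∙ Y r
  yx = begin
    y ∙ x ≈⟨ identityˡ _ ⟨
    ε ∙ (y ∙ x) ≈⟨ ∙-cong (≈-sym (inverseʳ x)) ≈-refl ⟩
    x ∙ x ⁻¹ ∙ (y ∙ x) ≈⟨ assoc x (x ⁻¹) (y ∙ x) ⟩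
    x ∙ (x ⁻¹ ∙ (y ∙ x)) ≈⟨ ∙-cong ≈-refl (≈-sym (assoc (x ⁻¹) y x)) ⟩
    x ∙ (x ⁻¹ ∙ y ∙ x) ≈⟨ ∙-cong ≈-refl (≈-trans (relation x⁻¹yx≈yʳ) (≈-sym Y-r)) ⟩
    x ∙ Y r ∎

  y^x : ∀ n → y ^ (+ n) ∙ x ≋ x ∙ Y (+ n ℤ.* r)
  y^x zero = begin
    ε ∙ x ≈⟨ identityˡ x ⟩
    x ≈⟨ identityʳ x ⟨
    x ∙ ε ≈⟨ ∙-cong ≈-refl (Y-pos 0) ⟨
    x ∙ Y 0ℤ ≈⟨ ∙-cong ≈-refl (Y-cong (mod-≡ (sym (ℤ.*-zeroˡ r)))) ⟩
    x ∙ Y (0ℤ ℤ.* r) ∎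
  y^x (suc n) = begin
    y ∙ y ^ (+ n) ∙ x ≈⟨ assoc y _ x ⟩
    y ∙ (y ^ (+ n) ∙ x) ≈⟨ ∙-cong ≈-refl (y^x n) ⟩
    y ∙ (x ∙ Y (+ n ℤ.* r)) ≈⟨ assoc y x _ ⟨
    y ∙ x ∙ Y (+ n ℤ.* r) ≈⟨ ∙-cong yx ≈-refl ⟩
    x ∙ Y r ∙ Y (+ n ℤ.* r) ≈⟨ assoc x _ _ ⟩
    x ∙ (Y r ∙ Y (+ n ℤ.* r)) ≈⟨ ∙-cong ≈-refl (Y-+ r (+ n ℤ.* r)) ⟨
    x ∙ Y (r ℤ.+ + n ℤ.* r) ≈⟨ ∙-cong ≈-refl (Y-cong (mod-≡ (lemma r (+ n)))) ⟩
    x ∙ Y (+ suc n ℤ.* r) ∎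
    where
    lemma : ∀ r n → r ℤ.+ n ℤ.* r ≡ (1ℤ ℤ.+ n) ℤ.* r
    lemma = ℤ-solve

  Y-x^ : ∀ a b → Y b ∙ x ^ (+ a) ≋ x ^ (+ a) ∙ Y (b ℤ.* r ℤ.^ a)
  Y-x^ zero b = begin
    Y b ∙ ε ≈⟨ identityʳ _ ⟩
    Y b ≈⟨ Y-cong (mod-≡ (sym (ℤ.*-identityʳ b))) ⟩
    Y (b ℤ.* 1ℤ) ≈⟨ identityˡ _ ⟨
    ε ∙ Y (b ℤ.* 1ℤ) ∎
  Y-x^ (suc a) b = begin
    Y b ∙ (x ∙ x ^ (+ a)) ≈⟨ assoc _ x _ ⟨
    Y b ∙ x ∙ x ^ (+ a) ≈⟨ ∙-cong (y^x (b ℤ.%ℕ m)) ≈-refl ⟩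
    x ∙ Y (+ (b ℤ.%ℕ m) ℤ.* r) ∙ x ^ (+ a) ≈⟨ ∙-cong (∙-cong ≈-refl (Y-cong (mod-*ʳ r (mod-sym (mod-% m b))))) ≈-refl ⟩
    x ∙ Y (b ℤ.* r) ∙ x ^ (+ a) ≈⟨ assoc x _ _ ⟩
    x ∙ (Y (b ℤ.* r) ∙ x ^ (+ a)) ≈⟨ ∙-cong ≈-refl (Y-x^ a (b ℤ.* r)) ⟩
    x ∙ (x ^ (+ a) ∙ Y (b ℤ.* r ℤ.* r ℤ.^ a)) ≈⟨ assoc x _ _ ⟨
    x ∙ x ^ (+ a) ∙ Y (b ℤ.* r ℤ.* r ℤ.^ a) ≈⟨ ∙-cong ≈-refl (Y-cong (mod-≡ (ℤ.*-assoc b r (r ℤ.^ a)))) ⟩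
    x ∙ x ^ (+ a) ∙ Y (b ℤ.* (r ℤ.* r ℤ.^ a)) ∎

  normal : ℕ → ℤ → Word
  normal a b = x ^ (+ a) ∙ Y b

  normal-cong : ∀ {a b c d} → + a ≈ + c ⟨ p ⟩ → b ≈ d ⟨ m ⟩ → normal a b ≋ normal c d
  normal-cong e f = ∙-cong (^-periodic (relation xᵖ≈1) e) (Y-cong f)

  normal-∙ : ∀ a b c d → normal a b ∙ normal c d ≋ normal (a + c) (b ℤ.* r ℤ.^ c ℤ.+ d)
  normal-∙ a b c d = begin
    x ^ (+ a) ∙ Y b ∙ (x ^ (+ c) ∙ Y d) ≈⟨ assoc _ _ _ ⟩
    x ^ (+ a) ∙ (Y b ∙ (x ^ (+ c) ∙ Y d)) ≈⟨ ∙-cong ≈-refl (assoc _ _ _) ⟨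
    x ^ (+ a) ∙ (Y b ∙ x ^ (+ c) ∙ Y d) ≈⟨ ∙-cong ≈-refl (∙-cong (Y-x^ c b) ≈-refl) ⟩
    x ^ (+ a) ∙ (x ^ (+ c) ∙ Y (b ℤ.* r ℤ.^ c) ∙ Y d) ≈⟨ ∙-cong ≈-refl (assoc _ _ _) ⟩
    x ^ (+ a) ∙ (x ^ (+ c) ∙ (Y (b ℤ.* r ℤ.^ c) ∙ Y d)) ≈⟨ assoc _ _ _ ⟨
    x ^ (+ a) ∙ x ^ (+ c) ∙ (Y (b ℤ.* r ℤ.^ c) ∙ Y d) ≈⟨ ∙-cong (x^-+ x a c) (Y-+ (b ℤ.* r ℤ.^ c) d) ⟨
    x ^ (+ (a + c)) ∙ Y (b ℤ.* r ℤ.^ c ℤ.+ d) ∎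

  normal-ε : normal 0 0ℤ ≋ ε
  normal-ε = ≈-trans (identityˡ _) (Y-pos 0)

  complete : ∀ s → s ≋ normal (α s) (β s)
  complete (gen 𝕩) = begin
    x ≈⟨ identityʳ x ⟨
    x ∙ ε ≈⟨ ∙-cong (≈-sym (identityʳ x)) (≈-sym (Y-pos 0)) ⟩
    x ∙ ε ∙ Y 0ℤ ∎
  complete (gen 𝕪) = begin
    y ≈⟨ identityʳ y ⟨
    y ∙ ε ≈⟨ Y-pos 1 ⟨
    Y 1ℤ ≈⟨ identityˡ _ ⟨
    ε ∙ Y 1ℤ ∎
  complete ε = ≈-sym normal-ε
  complete (s ∙ t) = ≈-trans (∙-cong (complete s) (complete t)) (normal-∙ (α s) (β s) (α t) (β t))
  complete (s ⁻¹) = ≈-sym (GroupProperties.inverseʳ-unique G s (normal (α (s ⁻¹)) (β (s ⁻¹))) (begin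
    s ∙ normal (α (s ⁻¹)) (β (s ⁻¹)) ≈⟨ ∙-cong (complete s) ≈-refl ⟩
    normal (α s) (β s) ∙ normal (α (s ⁻¹)) (β (s ⁻¹)) ≈⟨ normal-∙ (α s) (β s) (α (s ⁻¹)) (β (s ⁻¹)) ⟩
    normal (α (s ∙ s ⁻¹)) (β (s ∙ s ⁻¹)) ≈⟨ normal-cong (proj₁ (sound (inverseʳ s))) (proj₂ (sound (inverseʳ s))) ⟩
    normal 0 0ℤ ≈⟨ normal-ε ⟩
    ε ∎))

  same⇒≋ : ∀ {s t} → Same s t → s ≋ t
  same⇒≋ {s} {t} (e , f) = ≈-trans (complete s) (≈-trans (normal-cong e f) (≈-sym (complete t)))

  %-cong : ∀ n .{{_ : NonZero n}} {a b} → a ≈ b ⟨ n ⟩ → a ℤ.%ℕ n ≡ b ℤ.%ℕ n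
  %-cong n {a} {b} e = residue-unique (ℤ.n%ℕd<d a n) (ℤ.n%ℕd<d b n) (mod-trans (mod-sym (mod-% n a)) (mod-trans e (mod-% n b)))

  order : HasOrder G (p * m)
  order = record
    { to        = to
    ; from      = from
    ; to-cong   = λ { refl → ≈-refl }
    ; from-cong = from-cong
    ; inverse   = (λ { {s} refl → to-from s }) , λ {i} {s} e → trans (from-cong {s} {to i} e) (from-to i)
    }
    where
    word : Fin p × Fin m → Word
    word (i , j) = x ^ (+ Fin.toℕ i) ∙ y ^ (+ Fin.toℕ j)
    to : Fin (p * m) → Word
    to k = word (Fin.remQuot {p} m k)
    coordinates : Word → Fin p × Fin m
    coordinates s = Fin.fromℕ< (ℤ.n%ℕd<d (+ α s) p) , Fin.fromℕ< (ℤ.n%ℕd<d (β s) m)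
    from : Word → Fin (p * m)
    from s = Fin.combine (proj₁ (coordinates s)) (proj₂ (coordinates s))
    from-cong : ∀ {s t} → s ≋ t → from s ≡ from t
    from-cong {s} {t} e = cong₂ Fin.combine
      (Fin.fromℕ<-cong _ _ (%-cong p (proj₁ (sound e))) (ℤ.n%ℕd<d (+ α s) p) (ℤ.n%ℕd<d (+ α t) p))
      (Fin.fromℕ<-cong _ _ (%-cong m (proj₂ (sound e))) (ℤ.n%ℕd<d (β s) m) (ℤ.n%ℕd<d (β t) m))
    to-from : ∀ s → to (from s) ≋ s
    to-from s = begin
      to (from s) ≡⟨ cong word (Fin.remQuot-combine (proj₁ (coordinates s)) (proj₂ (coordinates s))) ⟩
      word (coordinates s) ≡⟨ cong₂ (λ i j → x ^ (+ i) ∙ y ^ (+ j)) (Fin.toℕ-fromℕ< (ℤ.n%ℕd<d (+ α s) p)) (Fin.toℕ-fromℕ< (ℤ.n%ℕd<d (β s) m)) ⟩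
      x ^ (+ ((+ α s) ℤ.%ℕ p)) ∙ Y (β s) ≈⟨ ∙-cong (^-periodic (relation xᵖ≈1) (mod-sym (mod-% p (+ α s)))) ≈-refl ⟩
      normal (α s) (β s) ≈⟨ complete s ⟨
      s ∎
    α-word : ∀ i j → α (word (i , j)) ≡ Fin.toℕ i
    α-word i j = trans (cong₂ _+_ (α-x^ (Fin.toℕ i)) (α-y^ (Fin.toℕ j))) (+-identityʳ _)
    β-word : ∀ i j → β (word (i , j)) ≡ + Fin.toℕ j
    β-word i j = trans (cong₂ (λ z k → z ℤ.* r ℤ.^ α (y ^ (+ Fin.toℕ j)) ℤ.+ k) (β-x^ (Fin.toℕ i)) (β-y^ (Fin.toℕ j)))
      (trans (cong (ℤ._+ + Fin.toℕ j) (ℤ.*-zeroˡ (r ℤ.^ α (y ^ (+ Fin.toℕ j))))) (ℤ.+-identityˡ (+ Fin.toℕ j)))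
    small : ∀ {n k} .{{_ : NonZero n}} (i : Fin n) → k ≡ + Fin.toℕ i → k ℤ.%ℕ n ≡ Fin.toℕ i
    small {n} i refl = residue-unique (ℤ.n%ℕd<d (+ Fin.toℕ i) n) (Fin.toℕ<n i) (mod-sym (mod-% n (+ Fin.toℕ i)))
    from-word : ∀ i j → from (word (i , j)) ≡ Fin.combine i j
    from-word i j = cong₂ Fin.combine
      (Fin.toℕ-injective (trans (Fin.toℕ-fromℕ< (ℤ.n%ℕd<d (+ α (word (i , j))) p)) (small i (cong +_ (α-word i j)))))
      (Fin.toℕ-injective (trans (Fin.toℕ-fromℕ< (ℤ.n%ℕd<d (β (word (i , j))) m)) (small j (β-word i j))))
    from-to : ∀ k → from (to k) ≡ k
    from-to k = trans (from-word (proj₁ (Fin.remQuot {p} m k)) (proj₂ (Fin.remQuot {p} m k))) (Fin.combine-remQuot {p} m k)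

-- The constants

module Constants {q m e : ℕ} {r : ℤ} (𝔾 : Group-data q m e r) .{{_ : NonZero m}} where

  open Group-data 𝔾 using (rᵖ≈1; r-units; p-prime)
  open Presentation {q} {m} {r} rᵖ≈1
  open Metacyclic p m r rᵖ≈1 r-units α β
  open Extraction 𝔾 α β using (extraction)

  open Group G using () renaming (_≈_ to _≋_; isEquivalence to ≋-isEquivalence)
  open Homogeneous using (Permutation)

  infix 4 _⋈_
  _⋈_ : List Word → List Word → Set
  _⋈_ = Permutation _≋_

  α-product : ∀ T → α (orderedProduct G T) ≡ αsum T
  α-product []      = refl
  α-product (t ∷ T) = cong (λ k → α t + k) (α-product T)

  β-product : ∀ T → β (orderedProduct G T) ≡ βval T
  β-product []      = refl
  β-product (t ∷ T) = cong₂ (λ k z → β t ℤ.* r ℤ.^ k ℤ.+ z) (α-product T) (β-product T)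

  αβ⇒productOne : ∀ T → p ∣ αsum T → βval T ≈ 0ℤ ⟨ m ⟩ → ProductOne G T
  αβ⇒productOne T p∣ eq = T , Perm.↭⇒↭ₛ′ ≋-isEquivalence ↭-refl , same⇒≋
    ( subst (λ k → 0ℤ ≈ + k ⟨ p ⟩) (sym (α-product T)) (mod-sym (∣⇒≈0 p∣))
    , subst (0ℤ ≈_⟨ m ⟩) (sym (β-product T)) (mod-sym eq))

  GoodSubsequence : List Word → Set
  GoodSubsequence S = ∃[ T ] (IsSubsequenceOf G T S × length T ≡ p * m × ProductOne G T)

  long⇒good : ∀ S → p * m + m + p ≤ 2 + length S → GoodSubsequence S
  long⇒good S long = good (extraction S long)
    where
    good : Realises NoSplit S (p * m) 0ℤ → GoodSubsequence S
    good (realise {T} {U} σ size p∣ eq _) = T , (U , Perm.↭⇒↭ₛ′ ≋-isEquivalence σ) , size , αβ⇒productOne T p∣ eq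

  -- Subsequences are taken up to order and equality in the group, so they are compared only through
  -- additive weights that respect both.
  module Weight (w : Word → ℕ) (w-resp : ∀ {s t} → s ≋ t → w s ≡ w t) where

    weight : List Word → ℕ
    weight T = sum (map w T)

    weight-++ : ∀ S T → weight (S ++ T) ≡ weight S + weight T
    weight-++ []      T = refl
    weight-++ (s ∷ S) T = trans (cong (λ k → w s + k) (weight-++ S T)) (sym (+-assoc (w s) (weight S) (weight T)))

    weight-pointwise : ∀ {S T} → Pointwise _≋_ S T → weight S ≡ weight T
    weight-pointwise []       = refl
    weight-pointwise (e ∷ es) = cong₂ _+_ (w-resp e) (weight-pointwise es)

    weight-⋈ : ∀ {S T} → S ⋈ T → weight S ≡ weight T
    weight-⋈ (Homogeneous.refl es)     = weight-pointwise es
    weight-⋈ (Homogeneous.prep e σ)    = cong₂ _+_ (w-resp e) (weight-⋈ σ)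
    weight-⋈ (Homogeneous.swap {xs} {ys} {s} {t} {s′} {t′} e f σ) = trans (cong₂ _+_ (w-resp e) (cong₂ _+_ (w-resp f) (weight-⋈ σ))) (lemma (w s′) (w t′) (weight ys))
      where
      lemma : ∀ a b c → a + (b + c) ≡ b + (a + c)
      lemma = ℕ-solve
    weight-⋈ (Homogeneous.trans σ τ)   = trans (weight-⋈ σ) (weight-⋈ τ)

    weight-replicate : ∀ n {t k} → w t ≤ k → weight (replicate n t) ≤ n * k
    weight-replicate zero    _  = z≤n
    weight-replicate (suc n) wt = +-mono-≤ wt (weight-replicate n wt)

    weight-zero : ∀ T → weight T ≡ 0 → All (λ t → w t ≡ 0) T
    weight-zero []      _  = []
    weight-zero (t ∷ T) eq = m+n≡0⇒m≡0 (w t) eq ∷ weight-zero T (m+n≡0⇒n≡0 (w t) eq)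

    weight-one : ∀ {T} → All (λ t → w t ≡ 1) T → weight T ≡ length T
    weight-one []         = refl
    weight-one (eq ∷ eqs) = cong₂ _+_ eq (weight-one eqs)

  -- The least nonnegative residues of the two exponents, and the indicator function of the
  -- identity.
  αw βw δw : Word → ℕ
  αw s = (+ α s) ℤ.%ℕ p
  βw s = β s ℤ.%ℕ m
  δw s = (1 ∸ αw s) * (1 ∸ βw s)

  αw-resp : ∀ {s t} → s ≋ t → αw s ≡ αw t
  αw-resp eq = %-cong p (proj₁ (sound eq))

  βw-resp : ∀ {s t} → s ≋ t → βw s ≡ βw t
  βw-resp eq = %-cong m (proj₂ (sound eq))

  δw-resp : ∀ {s t} → s ≋ t → δw s ≡ δw t
  δw-resp eq = cong₂ (λ a b → (1 ∸ a) * (1 ∸ b)) (αw-resp eq) (βw-resp eq)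

  module A = Weight αw αw-resp
  module B = Weight βw βw-resp
  module D = Weight δw δw-resp

  -- The extremal sequence y^(m−1) x^(p−1), padded with n copies of the identity.
  extremal : ℕ → List Word
  extremal n = replicate n ε ++ replicate (ℕ.pred m) y ++ replicate q x

  length-extremal : ∀ n → length (extremal n) ≡ n + (ℕ.pred m + q)
  length-extremal n = trans (length-++ (replicate n ε)) (cong₂ _+_ (length-replicate n)
    (trans (length-++ (replicate (ℕ.pred m) y)) (cong₂ _+_ (length-replicate (ℕ.pred m)) (length-replicate q))))

  module _ (n : ℕ) where

    module Bound (w : Word → ℕ) (w-resp : ∀ {s t} → s ≋ t → w s ≡ w t) where
      open Weight w w-resp

      bound : ∀ {a b c} → w ε ≤ a → weight (replicate (ℕ.pred m) y) ≤ b → w x ≤ c → weight (extremal n) ≤ n * a + (b + q * c)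
      bound ε≤ y≤ x≤ = ≤-trans (≤-reflexive (trans (weight-++ (replicate n ε) _) (cong (λ k → weight (replicate n ε) + k) (weight-++ (replicate (ℕ.pred m) y) _))))
        (+-mono-≤ (weight-replicate n ε≤) (+-mono-≤ y≤ (weight-replicate q x≤)))

    1<p : 1 < p
    1<p = ℕ.nonTrivial⇒n>1 p {{prime⇒nonTrivial p-prime}}

    αw-extremal : A.weight (extremal n) ≤ q
    αw-extremal = ≤-trans (Bound.bound αw αw-resp (ℕ.m%n≤m 0 p) (A.weight-replicate (ℕ.pred m) (ℕ.m%n≤m 0 p)) (ℕ.m%n≤m 1 p)) (≤-reflexive (lemma n (ℕ.pred m) q))
      where
      lemma : ∀ n k q → n * 0 + (k * 0 + q * 1) ≡ q
      lemma = ℕ-solve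

    βw-extremal : B.weight (extremal n) ≤ ℕ.pred m
    βw-extremal = ≤-trans (Bound.bound βw βw-resp (ℕ.m%n≤m 0 m) (B.weight-replicate (ℕ.pred m) (ℕ.m%n≤m 1 m)) (ℕ.m%n≤m 0 m)) (≤-reflexive (lemma n (ℕ.pred m) q))
      where
      lemma : ∀ n k q → n * 0 + (k * 1 + q * 0) ≡ k
      lemma = ℕ-solve

    δw-extremal : D.weight (extremal n) ≤ n
    δw-extremal = ≤-trans (Bound.bound δw δw-resp (*-mono-≤ (m∸n≤m 1 (αw ε)) (m∸n≤m 1 (βw ε))) (y-weight (<-cmp m 1))
        (≤-reflexive (cong (λ k → (1 ∸ k) * (1 ∸ βw x)) (ℕ.m<n⇒m%n≡m 1<p)))) (≤-reflexive (lemma n q))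
      where
      lemma : ∀ n q → n * 1 + (0 + q * 0) ≡ n
      lemma = ℕ-solve
      none : ∀ {k} → k ≡ 0 → D.weight (replicate k y) ≤ 0
      none refl = z≤n
      -- For m = 1 the element y is itself the identity, but then there are m - 1 = 0 copies of it.
      y-weight : _ → D.weight (replicate (ℕ.pred m) y) ≤ 0
      y-weight (tri< m<1 _ _) = none (cong ℕ.pred (n<1⇒n≡0 m<1))
      y-weight (tri≈ _ m≡1 _) = none (cong ℕ.pred m≡1)
      y-weight (tri> _ _ 1<m) = ≤-trans (D.weight-replicate (ℕ.pred m) (≤-reflexive (trans (cong (λ k → (1 ∸ αw y) * (1 ∸ k)) (ℕ.m<n⇒m%n≡m 1<m)) (*-zeroʳ (1 ∸ αw y)))))
        (≤-reflexive (*-zeroʳ (ℕ.pred m)))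

    αw-sum : ∀ T → + A.weight T ≈ + αsum T ⟨ p ⟩
    αw-sum []      = mod-refl
    αw-sum (t ∷ T) = mod-+ (mod-sym (mod-% p (+ α t))) (αw-sum T)

    αw-zero : ∀ t → αw t ≡ 0 → p ∣ α t
    αw-zero t eq = ≈0⇒∣ (mod-trans (mod-% p (+ α t)) (mod-≡ (cong +_ eq)))

    αw-zeros : ∀ {T} → All (λ t → αw t ≡ 0) T → p ∣ αsum T
    αw-zeros []                 = p ℕ.∣0
    αw-zeros {t ∷ T} (eq ∷ eqs) = ∣m∣n⇒∣m+n (αw-zero t eq) (αw-zeros eqs)

    βw-sum : ∀ {T} → All (λ t → αw t ≡ 0) T → + B.weight T ≈ βval T ⟨ m ⟩
    βw-sum [] = mod-refl
    βw-sum {t ∷ T} (_ ∷ eqs) = mod-+ (mod-trans (mod-sym (mod-% m (β t))) (mod-trans (mod-≡ (sym (ℤ.*-identityʳ (β t))))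
      (mod-*ˡ (β t) (mod-sym (r-periodic (αw-zeros eqs)))))) (βw-sum eqs)

    -- The weights `αw` sum to 0 modulo p and to at most p - 1, so all vanish. The order of the
    -- terms then no longer matters, and the same argument modulo m shows that all `βw` vanish. Only
    -- copies of the identity remain.
    few-product-one : ∀ {T} → IsSubsequenceOf G T (extremal n) → ProductOne G T → length T ≤ n
    few-product-one {T} (U , σ) (T′ , τ , one) = ≤-trans (≤-reflexive (trans (sym (PermSetoid.xs↭ys⇒|xs|≡|ys| (Group.setoid G) τ)) (sym (D.weight-one δw≡1))))
        (part δw δw-resp δw-extremal)
      where
      part : ∀ w (w-resp : ∀ {s t} → s ≋ t → w s ≡ w t) {k} → Weight.weight w w-resp (extremal n) ≤ k → Weight.weight w w-resp T′ ≤ k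
      part w w-resp small = ≤-trans (≤-reflexive (weight-⋈ τ)) (≤-trans (m≤m+n (weight T) (weight U))
        (≤-trans (≤-reflexive (trans (sym (weight-++ T U)) (sym (weight-⋈ σ)))) small))
        where open Weight w w-resp
      αw≡0 : All (λ t → αw t ≡ 0) T′
      αw≡0 = A.weight-zero T′ (residue-unique (s≤s (part αw αw-resp αw-extremal)) (s≤s z≤n)
        (mod-trans (αw-sum T′) (mod-sym (subst (λ k → 0ℤ ≈ + k ⟨ p ⟩) (α-product T′) (proj₁ (sound one))))))
      βw≡0 : All (λ t → βw t ≡ 0) T′
      βw≡0 = B.weight-zero T′ (residue-unique (≤-<-trans (part βw βw-resp βw-extremal) (≤-reflexive (suc-pred m))) (ℕ.>-nonZero⁻¹ m)
        (mod-trans (βw-sum αw≡0) (mod-sym (subst (0ℤ ≈_⟨ m ⟩) (β-product T′) (proj₂ (sound one))))))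
      δw≡1 : All (λ t → δw t ≡ 1) T′
      δw≡1 = All.zipWith (λ (a , b) → cong₂ (λ a b → (1 ∸ a) * (1 ∸ b)) a b) (αw≡0 , βw≡0)

  d : ℕ
  d = m + p ∸ 2

  d≡ : d ≡ ℕ.pred m + q
  d≡ = trans (cong (λ k → k + p ∸ 2) (sym (suc-pred m))) (cong (_∸ 1) (+-suc (ℕ.pred m) q))

  extremal-free : ProductOneFree G (extremal 0)
  extremal-free ([] , []≢[] , _)       = []≢[] refl
  extremal-free (t ∷ T , _ , sub , one) = n≮0 (few-product-one 0 sub one)

  threshold : p * m + m + p ≡ 2 + (d + p * m)
  threshold = trans (cong (λ k → p * m + k + p) (sym (suc-pred m))) (trans (lemma (p * m) (ℕ.pred m) q) (cong (λ k → 2 + (k + p * m)) (sym d≡)))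
    where
    lemma : ∀ P m q → P + suc m + suc q ≡ 2 + (m + q + P)
    lemma = ℕ-solve

  instance
    pm≢0 : NonZero (p * m)
    pm≢0 = m*n≢0 p m

  -- Padding with identities, represented by nothing.
  module _ (S : List Word) where

    padded : List (Maybe Word)
    padded = map just S ++ replicate (ℕ.pred (p * m)) nothing

    α⁺ : Maybe Word → ℕ
    α⁺ = maybe α 0

    β⁺ : Maybe Word → ℤ
    β⁺ = maybe β 0ℤ

    module M⁺ = Metacyclic p m r rᵖ≈1 r-units α⁺ β⁺

    αsum⁺ : ∀ T → M⁺.αsum T ≡ αsum (catMaybes T)
    αsum⁺ []            = refl
    αsum⁺ (just t ∷ T)  = cong (λ k → α t + k) (αsum⁺ T)
    αsum⁺ (nothing ∷ T) = αsum⁺ T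

    βval⁺ : ∀ T → M⁺.βval T ≡ βval (catMaybes T)
    βval⁺ []            = refl
    βval⁺ (just t ∷ T)  = cong₂ (λ k z → β t ℤ.* r ℤ.^ k ℤ.+ z) (αsum⁺ T) (βval⁺ T)
    βval⁺ (nothing ∷ T) = trans (cong₂ ℤ._+_ (ℤ.*-zeroˡ (r ℤ.^ M⁺.αsum T)) (βval⁺ T)) (ℤ.+-identityˡ (βval (catMaybes T)))

    catMaybes-padded : catMaybes padded ≡ S
    catMaybes-padded = trans (catMaybes-++ (map just S) _) (trans (cong₂ _++_ (justs S) (nothings (ℕ.pred (p * m)))) (++-identityʳ S))
      where
      justs : ∀ S → catMaybes (map just S) ≡ S
      justs []      = refl
      justs (s ∷ S) = cong (s ∷_) (justs S)
      nothings : ∀ n → catMaybes (replicate n (nothing {A = Word})) ≡ []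
      nothings zero    = refl
      nothings (suc n) = nothings n

    length-padded : length padded ≡ length S + ℕ.pred (p * m)
    length-padded = trans (length-++ (map just S)) (cong₂ _+_ (length-map just S) (length-replicate (ℕ.pred (p * m))))

    -- Among the pm chosen terms at most pm - 1 are padding, so discarding the padding leaves a
    -- nonempty product-one subsequence of `S`.
    long⇒not-free : d < length S → ¬ ProductOneFree G S
    long⇒not-free long free = contradicts (Extraction.extraction 𝔾 α⁺ β⁺ padded
        (≤-trans (≤-reflexive threshold) (+-monoʳ-≤ 2 (≤-trans enough (≤-reflexive (sym length-padded))))))
      where
      enough : d + p * m ≤ length S + ℕ.pred (p * m)
      enough = ≤-trans (≤-reflexive (trans (cong (λ k → d + k) (sym (suc-pred (p * m)))) (+-suc d _))) (+-monoˡ-≤ (ℕ.pred (p * m)) long)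
      contradicts : M⁺.Realises M⁺.NoSplit padded (p * m) 0ℤ → ⊥
      contradicts (M⁺.realise {T} {U} σ size p∣ eq _) = free (catMaybes T , nonempty ,
          (catMaybes U , Perm.↭⇒↭ₛ′ ≋-isEquivalence σ′) ,
          αβ⇒productOne (catMaybes T) (subst (p ∣_) (αsum⁺ T) p∣) (subst (_≈ 0ℤ ⟨ m ⟩) (βval⁺ T) eq))
        where
        σ′ : S ↭ catMaybes T ++ catMaybes U
        σ′ = ↭-trans (↭-reflexive (sym catMaybes-padded)) (↭-trans (Perm.catMaybes-↭ σ) (↭-reflexive (catMaybes-++ T U)))
        nonempty : catMaybes T ≢ []
        nonempty none = <⇒≱ (≤-reflexive (suc-pred (p * m))) (+-cancelʳ-≤ (length U) (p * m) (ℕ.pred (p * m)) (≤-trans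
          (≤-reflexive (trans (cong (_+ length U) (sym size)) (trans (sym (length-++ T)) (trans (sym (↭-length σ)) (trans length-padded (+-comm (length S) _))))))
          (+-monoʳ-≤ (ℕ.pred (p * m)) (≤-trans (≤-reflexive (trans (↭-length σ′) (cong (λ T → length (T ++ catMaybes U)) none))) (length-catMaybes U)))))

  small-davenport : IsSmallDavenportConstant G d
  small-davenport = (extremal 0 , trans (length-extremal 0) (sym d≡) , extremal-free) ,
    λ { k (S , refl , free) → ≮⇒≥ λ long → long⇒not-free S long free }

  E-constant : IsE G (d + p * m)
  E-constant = p * m , order , (λ S len → long⇒good S (≤-reflexive (trans threshold (cong (λ k → 2 + k) (sym len))))) , minimal
    where
    minimal : ∀ k → (∀ S → length S ≡ k → GoodSubsequence S) → d + p * m ≤ k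
    minimal k good = ≮⇒≥ λ k< → too-long (good (take k (extremal n)) (truncated k<))
      where
      -- With pm - 1 identities the extremal sequence has one term fewer than claimed, and no
      -- product-one subsequence of it reaches length pm; shorter lengths are served by its initial
      -- segments.
      n = ℕ.pred (p * m)
      truncated : k < d + p * m → length (take k (extremal n)) ≡ k
      truncated k< = trans (length-take k (extremal n)) (m≤n⇒m⊓n≡m (≤-pred (≤-trans k< (≤-reflexive (sym (trans (cong suc (length-extremal n))
        (trans (cong (_+ (ℕ.pred m + q)) (suc-pred (p * m))) (trans (+-comm (p * m) _) (cong (_+ p * m) (sym d≡))))))))))
      too-long : GoodSubsequence (take k (extremal n)) → ⊥
      too-long (T , (U , σ) , size , one) = <⇒≱ (≤-reflexive (suc-pred (p * m))) (subst (_≤ n) size (few-product-one n (U ++ drop k (extremal n) , σ′) one))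
        where
        σ′ : extremal n ⋈ T ++ U ++ drop k (extremal n)
        σ′ = subst₂ _⋈_ (take++drop≡id k (extremal n)) (++-assoc T U (drop k (extremal n)))
          (PermSetoid.++⁺ʳ (Group.setoid G) (drop k (extremal n)) σ)

theorem1p4 : (p m : ℕ) (r : ℤ) → Prime p → 1 ≤ m →
    (r ℤ.^ p) ≡ 1ℤ [mod m ] →
    IsSmallestPrimeDivisor p (p * m) →
    gcd (ℤ.+ p ℤ.* (r ℤ.- 1ℤ)) (ℤ.+ m) ≡ 1ℤ →
    let G = metacyclicGroup p m r in
    HasOrder G (p * m)
    × IsSmallDavenportConstant G (m + p ∸ 2)
    × IsE G ((m + p ∸ 2) + p * m)
theorem1p4 zero    m r 0-prime _ _ _ _ = contradiction 0-prime ¬prime[0]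
theorem1p4 (suc q) m r p-prime 1≤m root least coprime = order , small-davenport , E-constant
  where
  instance
    m≢0 : NonZero m
    m≢0 = ℕ.>-nonZero 1≤m
  open Hypotheses {q} {m} {r} p-prime root least coprime using (group-data; rᵖ≈1)
  open Presentation {q} {m} {r} rᵖ≈1 using (order)
  open Constants {q} {m} group-data using (small-davenport; E-constant)
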